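{- A looped simple graph is a rigid $\mathcal{M}_{lc}$-circuit if and only if it can be obtained from $K_1^{[3]}$ by recursively applying the $1$-extension and $K_4$-extension operations.
   Context: A looped simple graph $G=(V,E,L)$: $E$ is a set of non-loop edges with no parallel edges, $L$ a set of loops (several may be at one vertex). For $X\subseteq V$, $i_E(X)$ and $i_L(X)$ are the numbers of edges, resp. loops, of the subgraph induced by $X$, and $i_{E\cup L}(X)=i_E(X)+i_L(X)$. $G$ is a rigid $\mathcal{M}_{lc}$-circuit if $|E|+|L|=2|V|+1$, $i_E(X)\le 2|X|-3$ for all $X\subseteq V$ with $|X|\ge 2$, and $i_{E\cup L}(X)\le 2|X|$ for all $X\subsetneq V$. $K_1^{[3]}$ is one vertex with three loops. The $1$-extension at an edge $uw$ deletes $uw$ and adds a new vertex $v$, edges $uv,wv$ and either an edge $vx$ ($x\in V\setminus\{u,w\}$) or a loop at $v$; the $1$-extension at a loop at $u$ deletes it and adds a new vertex $v$, an edge $uv$, a loop at $v$ and either an edge $wv$ ($w\in V-u$) or a second loop at $v$. $G$ is the $2$-sum of $G_1=(V_1,E_1,L_1)$ and $G_2=(V_2,E_2,L_2)$ along an edge $uv$ if $V_1\cup V_2=V$, $V_1\cap V_2=\{u,v\}$, $E_1\cap E_2=\{uv\}$, $E=(E_1\cup E_2)-uv$, $L=L_1\cup L_2$, $L_1\cap L_2=\emptyset$. A $K_4$-extension replaces a graph $G_1$ containing an edge $uv$ by the $2$-sum of $G_1$ and a copy of $K_4$ along $uv$. -}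

module Defs where

open import Data.Nat using (ℕ; zero; suc; _+_; _*_; _∸_; _≤_)
open import Data.Bool using (Bool; true; false; _∧_; _∨_; not; if_then_else_)
open import Data.Fin using (Fin; zero; suc; _≟_; _<?_)
open import Data.Fin.Subset using (Subset; ∣_∣; ⊤)
open import Data.Vec using (lookup)
open import Data.Product using (_×_)
open import Function.Bundles using (_↔_; Inverse)
open import Relation.Nullary using (¬_; does)
open import Relation.Binary.PropositionalEquality using (_≡_; _≢_)

-- Looped graphs on the vertex set Fin n.
-- adj i j = true  means there is a (non-loop) edge ij;
-- loops i         is the number of loops at vertex i (several allowed).
record LGraph (n : ℕ) : Set where
  field
    adj   : Fin n → Fin n → Bool
    loops : Fin n → ℕ
open LGraph public

record IsLoopedSimple {n : ℕ} (G : LGraph n) : Set where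
  field
    adj-sym    : ∀ i j → adj G i j ≡ adj G j i
    adj-irrefl : ∀ i → adj G i i ≡ false
open IsLoopedSimple public

sumFin : {n : ℕ} → (Fin n → ℕ) → ℕ
sumFin {zero}  f = 0
sumFin {suc n} f = f zero + sumFin (λ i → f (suc i))

b2n : Bool → ℕ
b2n true  = 1
b2n false = 0

_==_ : {n : ℕ} → Fin n → Fin n → Bool
i == j = does (i ≟ j)

iE : {n : ℕ} → LGraph n → Subset n → ℕ
iE G X = sumFin λ i → sumFin λ j →
  b2n (does (i <? j) ∧ lookup X i ∧ lookup X j ∧ adj G i j)

iL : {n : ℕ} → LGraph n → Subset n → ℕ
iL G X = sumFin λ i → if lookup X i then loops G i else 0

nE nL : {n : ℕ} → LGraph n → ℕ
nE G = iE G ⊤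
nL G = iL G ⊤

record RigidCircuit {n : ℕ} (G : LGraph n) : Set where
  field
    count  : nE G + nL G ≡ 2 * n + 1
    sparseE : ∀ (X : Subset n) → 2 ≤ ∣ X ∣ → iE G X + 3 ≤ 2 * ∣ X ∣
    sparseEL : ∀ (X : Subset n) → X ≢ ⊤ → iE G X + iL G X ≤ 2 * ∣ X ∣

-- Basic graph operations (new vertices are placed at the front:
-- the new vertex is `zero`, the old vertex i becomes `suc i`).

K1-3 : LGraph 1
K1-3 = record { adj = λ _ _ → false ; loops = λ _ → 3 }

deleteEdge : {n : ℕ} → LGraph n → Fin n → Fin n → LGraph n
deleteEdge G u w = record
  { adj = λ i j → adj G i j ∧ not ((i == u ∧ j == w) ∨ (i == w ∧ j == u))
  ; loops = loops G }

deleteLoop : {n : ℕ} → LGraph n → Fin n → LGraph n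
deleteLoop G u = record
  { adj = adj G
  ; loops = λ i → if i == u then loops G i ∸ 1 else loops G i }

addVertex : {n : ℕ} → LGraph n → (Fin n → Bool) → ℕ → LGraph (suc n)
addVertex G nbr k = record { adj = a ; loops = l }
  where
  a : _ → _ → Bool
  a zero    zero    = false
  a zero    (suc j) = nbr j
  a (suc i) zero    = nbr i
  a (suc i) (suc j) = adj G i j
  l : _ → ℕ
  l zero    = k
  l (suc i) = loops G i

ext1-edge-edge : {n : ℕ} → LGraph n → (u w x : Fin n) → LGraph (suc n)
ext1-edge-edge G u w x =
  addVertex (deleteEdge G u w) (λ j → j == u ∨ j == w ∨ j == x) 0

ext1-edge-loop : {n : ℕ} → LGraph n → (u w : Fin n) → LGraph (suc n)
ext1-edge-loop G u w =
  addVertex (deleteEdge G u w) (λ j → j == u ∨ j == w) 1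

ext1-loop-edge : {n : ℕ} → LGraph n → (u w : Fin n) → LGraph (suc n)
ext1-loop-edge G u w =
  addVertex (deleteLoop G u) (λ j → j == u ∨ j == w) 1

ext1-loop-loop : {n : ℕ} → LGraph n → (u : Fin n) → LGraph (suc n)
ext1-loop-loop G u =
  addVertex (deleteLoop G u) (λ j → j == u) 2

-- K4-extension along the edge uv: the 2-sum of G with a copy of K4
-- (vertices u, v, a, b) along uv, i.e. delete uv and add new vertices
-- a, b with edges ua, va, ub, vb, ab (no new loops).
-- In the result b = zero, a = suc zero, old i = suc (suc i).
K4-ext : {n : ℕ} → LGraph n → (u v : Fin n) → LGraph (suc (suc n))
K4-ext G u v =
  addVertex (addVertex (deleteEdge G u v) (λ j → j == u ∨ j == v) 0)
            (λ { zero → true ; (suc j) → j == u ∨ j == v }) 0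

record _≅_ {n : ℕ} (G H : LGraph n) : Set where
  field
    σ         : Fin n ↔ Fin n
    pres-adj   : ∀ i j → adj H (Inverse.to σ i) (Inverse.to σ j) ≡ adj G i j
    pres-loops : ∀ i → loops H (Inverse.to σ i) ≡ loops G i

data Constructible : {n : ℕ} → LGraph n → Set where
  base : Constructible K1-3
  iso  : {n : ℕ} {G H : LGraph n} → Constructible G → G ≅ H → Constructible H
  e-ee : {n : ℕ} {G : LGraph n} (u w x : Fin n) → Constructible G →
         adj G u w ≡ true → x ≢ u → x ≢ w →
         Constructible (ext1-edge-edge G u w x)
  e-el : {n : ℕ} {G : LGraph n} (u w : Fin n) → Constructible G →
         adj G u w ≡ true →
         Constructible (ext1-edge-loop G u w)
  e-le : {n : ℕ} {G : LGraph n} (u w : Fin n) → Constructible G →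
         1 ≤ loops G u → w ≢ u →
         Constructible (ext1-loop-edge G u w)
  e-ll : {n : ℕ} {G : LGraph n} (u : Fin n) → Constructible G →
         1 ≤ loops G u →
         Constructible (ext1-loop-loop G u)
  e-K4 : {n : ℕ} {G : LGraph n} (u v : Fin n) → Constructible G →
         adj G u v ≡ true →
         Constructible (K4-ext G u v)

{-# OPTIONS --safe #-}
module Submission where

-- Each extension changes the counts by a bounded amount, so it preserves rigid circuits.
-- Conversely, let G be a rigid circuit on at least two vertices, and call a vertex a node if
-- its edges and loops number three. Counting degrees, there are nodes, and they span a forest.
-- If all vertices are nodes, a leaf of the forest has two loops, and it can be removed by
-- undoing a 1-extension at a loop. Otherwise take a set X of maximum size such that
-- iE X + iL X = 2 ∣ X ∣ and some vertex outside X is not a node. Outside X there are nodes,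
-- and by maximality each of them has at most one edge to X or loop. A leaf w of the forest of
-- nodes outside X thus has a neighbour q ∉ X that is not a node, a neighbour t ∉ X, and a
-- third neighbour c (or a loop). Let a set Y prevent w from being replaced by one of the
-- edges ct, tq or cq (or by a loop at t). If Y is tight for edges and loops together, then
-- X ∪ Y contradicts the maximality of X, with a separate argument for tq when c ∈ X. So if
-- no replacement is possible, then Y is tight for edges alone. For ct and tq this makes
-- {w , t , c , q} the K4 of a K4-extension if t is a node. If t is not a node, such Y exist
-- for all three edges, and their union together with w violates the bound on iE.

open import Defs
open import Data.Bool as Bool using (Bool; true; false; _∧_; _∨_; not; if_then_else_)
open import Data.Bool.Properties using (T-∧; ∧-comm; ∧-assoc; ∧-zeroʳ; ∨-zeroʳ; ∨-comm)
open import Data.Empty using (⊥; ⊥-elim)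
open import Data.Fin using (Fin; zero; suc; _≟_; _<?_; punchIn)
open import Data.Fin.Permutation as Perm using (Permutation; insert; _⟨$⟩ʳ_; _⟨$⟩ˡ_)
open import Data.Fin.Properties using (<-cmp; any?; punchInᵢ≢i; punchIn-injective; punchIn-punchOut)
open import Data.Fin.Subset using (Subset; ∣_∣; ⊤; _∪_; _∩_; ∁) renaming (⊥ to ∅)
open import Data.Fin.Subset.Properties using (∣⊤∣≡n; ∣⊥∣≡0; ∣p∣≤n; anySubset?)
open import Data.Nat using (ℕ; zero; suc; _+_; _*_; _∸_; _≤_; _<_; _≤ᵇ_; _≤?_; z≤n; s≤s; s≤s⁻¹)
open import Data.Nat.Properties hiding (_≟_; _<?_; _≤?_; <-cmp)
open import Data.Nat.Properties using () renaming (_≟_ to _≟ℕ_; _<?_ to _<?ℕ_)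
open import Data.Nat.Tactic.RingSolver using (solve-∀)
open import Data.Product using (Σ; ∃; _×_; _,_; proj₁; proj₂)
open import Data.Sum using (_⊎_; inj₁; inj₂)
open import Data.Vec using (Vec; _∷_; []; lookup; insertAt; tabulate; replicate; zipWith; map; _[_]≔_)
open import Data.Vec.Properties using (lookup-zipWith; lookup-map; lookup-replicate; insertAt-lookup; insertAt-punchIn; lookup∘tabulate)
open import Function using (Equivalence; _∘_; _|>_)
open import Relation.Binary using (tri<; tri≈; tri>)
open import Relation.Nullary using (¬_; Dec; yes; no; does; _×-dec_; ¬?)
open import Relation.Nullary.Decidable using (dec-true; dec-false; map′; decidable-stable)
open import Relation.Binary.PropositionalEquality
open import Algebra.Properties.CommutativeSemigroup +-commutativeSemigroup using (interchange)
open import Algebra.Properties.Semiring.Sum +-*-semiring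
  using (sum; sum-cong-≗; ∑-distrib-+; ∑-comm; sum-replicate-zero; *-distribˡ-sum; sum-permute; sum-remove)

-- Deleting a node takes away three of the 2n + 1 edges and loops, and putting one back restores the
-- count for n - 1 vertices. So a replacement can fail only on a set that was tight before. The
-- complement of a single node is always tight for edges and loops together, since 2n + 1 - 3 = 2(n
-- - 1). A largest proper tight set would be such a complement and give no information. Asking for a
-- vertex outside that is not a node rules these sets out, and this vertex has to survive in the
-- complement of every union X ∪ Y. For tq with c ∈ X no such vertex is at hand, so that edge needs
-- its own argument. The edge count of the definition runs over pairs i < j, which suits neither
-- unions nor bijections. Counts therefore go through the bilinear form of the adjacency matrix:
-- there, sets are sums of disjoint indicator functions, supermodularity is a polynomial identity,
-- and a factor 2 is cancelled at the end.

private variable k n : ℕ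

-- Linear arithmetic

infixl 6 _:+_
infixl 7 _:*_
infix  4 _≼_
infixr 3 _⇒_
infix  3 ⊢_

data Lin (k : ℕ) : Set where
  var  : Fin k → Lin k
  con  : ℕ → Lin k
  _:+_ : Lin k → Lin k → Lin k
  _:*_ : ℕ → Lin k → Lin k

data Ineq (k : ℕ) : Set where
  _≼_ : Lin k → Lin k → Ineq k

data Claim (k : ℕ) : Set where
  ⊢_  : Ineq k → Claim k
  _⇒_ : Ineq k → Claim k → Claim k

⟦_⟧ : Lin k → Vec ℕ k → ℕ
⟦ var i ⟧  ρ = lookup ρ i
⟦ con c ⟧  ρ = c
⟦ a :+ b ⟧ ρ = ⟦ a ⟧ ρ + ⟦ b ⟧ ρ
⟦ c :* a ⟧ ρ = c * ⟦ a ⟧ ρ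

Holds : Ineq k → Vec ℕ k → Set
Holds (a ≼ b) ρ = ⟦ a ⟧ ρ ≤ ⟦ b ⟧ ρ

Meaning : Claim k → Vec ℕ k → Set
Meaning (⊢ h)   ρ = Holds h ρ
Meaning (h ⇒ c) ρ = Holds h ρ → Meaning c ρ

private
  val : Vec ℕ k → Vec ℕ k → ℕ
  val []       []       = 0
  val (c ∷ cs) (x ∷ xs) = c * x + val cs xs

  -- The head entry is the constant term, because `val` pairs the vector with `1 ∷ ρ`.
  coeffs : Lin k → Vec ℕ (suc k)
  coeffs {k} (var i) = 0 ∷ (replicate k 0 [ i ]≔ 1)
  coeffs {k} (con c) = c ∷ replicate k 0
  coeffs (a :+ b)    = zipWith _+_ (coeffs a) (coeffs b)
  coeffs (c :* a)    = map (c *_) (coeffs a)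

  val-0 : (ρ : Vec ℕ k) → val (replicate k 0) ρ ≡ 0
  val-0 []      = refl
  val-0 (x ∷ ρ) = val-0 ρ

  val-var : (i : Fin k) (ρ : Vec ℕ k) → val (replicate k 0 [ i ]≔ 1) ρ ≡ lookup ρ i
  val-var zero    (x ∷ ρ) = trans (cong (1 * x +_) (val-0 ρ)) (trans (+-identityʳ _) (*-identityˡ x))
  val-var (suc i) (x ∷ ρ) = val-var i ρ

  val-+ : (cs ds ρ : Vec ℕ k) → val (zipWith _+_ cs ds) ρ ≡ val cs ρ + val ds ρ
  val-+ []       []       []      = refl
  val-+ (c ∷ cs) (d ∷ ds) (x ∷ ρ) = trans (cong ((c + d) * x +_) (val-+ cs ds ρ)) (eq c d x (val cs ρ) (val ds ρ))
    where
    eq : ∀ c d x p q → (c + d) * x + (p + q) ≡ (c * x + p) + (d * x + q)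
    eq = solve-∀

  val-* : (c : ℕ) (cs ρ : Vec ℕ k) → val (map (c *_) cs) ρ ≡ c * val cs ρ
  val-* c []       []      = sym (*-zeroʳ c)
  val-* c (d ∷ cs) (x ∷ ρ) = trans (cong (c * d * x +_) (val-* c cs ρ)) (eq c d x (val cs ρ))
    where
    eq : ∀ c d x p → c * d * x + c * p ≡ c * (d * x + p)
    eq = solve-∀

  coeffs-sound : (a : Lin k) (ρ : Vec ℕ k) → ⟦ a ⟧ ρ ≡ val (coeffs a) (1 ∷ ρ)
  coeffs-sound (var i)  ρ = sym (val-var i ρ)
  coeffs-sound {k} (con c)  ρ = sym (trans (cong (c * 1 +_) (val-0 ρ)) (trans (+-identityʳ _) (*-identityʳ c)))
  coeffs-sound (a :+ b) ρ = trans (cong₂ _+_ (coeffs-sound a ρ) (coeffs-sound b ρ))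
                                  (sym (val-+ (coeffs a) (coeffs b) (1 ∷ ρ)))
  coeffs-sound (c :* a) ρ = trans (cong (c *_) (coeffs-sound a ρ)) (sym (val-* c (coeffs a) (1 ∷ ρ)))

  _≤ᵛ_ : Vec ℕ k → Vec ℕ k → Bool
  []       ≤ᵛ []       = true
  (c ∷ cs) ≤ᵛ (d ∷ ds) = (c ≤ᵇ d) ∧ (cs ≤ᵛ ds)

  val-mono : (cs ds ρ : Vec ℕ k) → Bool.T (cs ≤ᵛ ds) → val cs ρ ≤ val ds ρ
  val-mono []       []       []      t = z≤n
  val-mono (c ∷ cs) (d ∷ ds) (x ∷ ρ) t =
    let p , q = Equivalence.to (T-∧ {c ≤ᵇ d}) t in
    +-mono-≤ (*-monoˡ-≤ x (≤ᵇ⇒≤ c d p)) (val-mono cs ds ρ q)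

  check : Lin k → Lin k → Claim k → Bool
  check a b (⊢ c ≼ d)       = coeffs (c :+ b) ≤ᵛ coeffs (d :+ a)
  check a b ((c ≼ d) ⇒ φ)   = check (a :+ c) (b :+ d) φ

  check-sound : (a b : Lin k) (φ : Claim k) → Bool.T (check a b φ) →
                (ρ : Vec ℕ k) → ⟦ a ⟧ ρ ≤ ⟦ b ⟧ ρ → Meaning φ ρ
  check-sound a b ((c ≼ d) ⇒ φ) t ρ h p = check-sound (a :+ c) (b :+ d) φ t ρ (+-mono-≤ h p)
  check-sound a b (⊢ c ≼ d) t ρ h = +-cancelʳ-≤ (⟦ a ⟧ ρ) _ _ (begin
    ⟦ c ⟧ ρ + ⟦ a ⟧ ρ                ≤⟨ +-monoʳ-≤ (⟦ c ⟧ ρ) h ⟩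
    ⟦ c :+ b ⟧ ρ                     ≡⟨ coeffs-sound (c :+ b) ρ ⟩
    val (coeffs (c :+ b)) (1 ∷ ρ)    ≤⟨ val-mono (coeffs (c :+ b)) (coeffs (d :+ a)) (1 ∷ ρ) t ⟩
    val (coeffs (d :+ a)) (1 ∷ ρ)    ≡⟨ sym (coeffs-sound (d :+ a) ρ) ⟩
    ⟦ d ⟧ ρ + ⟦ a ⟧ ρ                ∎)
    where open ≤-Reasoning

-- A claim is accepted if its conclusion c ≼ d follows from the unweighted sum a ≼ b of its
-- hypotheses because c + b ≤ d + a coefficientwise.
linear : ∀ k (φ : Vec (Lin k) k → Claim k) → {Bool.T (check (con 0) (con 0) (φ (tabulate var)))} →
         (ρ : Vec ℕ k) → Meaning (φ (tabulate var)) ρ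
linear k φ {t} ρ = check-sound (con 0) (con 0) (φ (tabulate var)) t ρ z≤n

infixr 4 _⊕_
_⊕_ : ∀ {a b c d} → a ≤ b → c ≤ d → a + c ≤ b + d
_⊕_ = +-mono-≤

eq≤ : ∀ {a b : ℕ} → a ≡ b → a ≤ b
eq≤ = ≤-reflexive

eq≥ : ∀ {a b : ℕ} → a ≡ b → b ≤ a
eq≥ p = ≤-reflexive (sym p)

2*-mono : ∀ {a b} → a ≤ b → 2 * a ≤ 2 * b
2*-mono = *-monoʳ-≤ 2

-- Sums and inner products

-- With this order of the arguments, `δ u j` unfolds to `b2n (j == u)`, the test made by the
-- neighbour functions of the extensions.
δ : Fin n → Fin n → ℕ
δ i j = b2n (j == i)

infixl 6 _⊞_
_⊞_ : (Fin n → ℕ) → (Fin n → ℕ) → Fin n → ℕ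
(a ⊞ b) i = a i + b i

𝟙 𝟘 : Fin n → ℕ
𝟙 _ = 1
𝟘 _ = 0

-- Abstract, so that unification recovers the arguments of Sum and dot.
abstract
  Sum : (Fin n → ℕ) → ℕ
  Sum = sum

  dot : (Fin n → ℕ) → (Fin n → ℕ) → ℕ
  dot a b = sum λ i → a i * b i

  dot≡ : (a b : Fin n → ℕ) → dot a b ≡ Sum λ i → a i * b i
  dot≡ a b = refl

  Sum-cong : {f g : Fin n → ℕ} → f ≗ g → Sum f ≡ Sum g
  Sum-cong = sum-cong-≗

  Sum-+ : (f g : Fin n → ℕ) → Sum (λ i → f i + g i) ≡ Sum f + Sum g
  Sum-+ = ∑-distrib-+

  Sum-swap : (f : Fin n → Fin n → ℕ) → Sum (λ i → Sum (f i)) ≡ Sum (λ j → Sum (λ i → f i j))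
  Sum-swap f = ∑-comm f

  *-Sum : (x : ℕ) (f : Fin n → ℕ) → x * Sum f ≡ Sum (λ i → x * f i)
  *-Sum = *-distribˡ-sum

  Sum-mono : {f g : Fin n → ℕ} → (∀ i → f i ≤ g i) → Sum f ≤ Sum g
  Sum-mono {zero}  h = z≤n
  Sum-mono {suc n} h = h zero ⊕ Sum-mono (h ∘ suc)

  Sum-0 : Sum {n} 𝟘 ≡ 0
  Sum-0 {n} = sum-replicate-zero n

  sumFin≡ : (f : Fin n → ℕ) → sumFin f ≡ Sum f
  sumFin≡ {zero}  f = refl
  sumFin≡ {suc n} f = cong (f zero +_) (sumFin≡ (f ∘ suc))

  dot-suc : (a b : Fin (suc n) → ℕ) → dot a b ≡ a zero * b zero + dot (a ∘ suc) (b ∘ suc)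
  dot-suc a b = refl

  dot-nil : (a b : Fin 0 → ℕ) → dot a b ≡ 0
  dot-nil a b = refl

  term≤dot : (a b : Fin n → ℕ) (i : Fin n) → a i * b i ≤ dot a b
  term≤dot a b zero    = m≤m+n _ _
  term≤dot a b (suc i) = ≤-trans (term≤dot (a ∘ suc) (b ∘ suc) i) (m≤n+m _ _)

  dot-permute : (a b : Fin n → ℕ) (π : Permutation n n) →
                dot a b ≡ dot (λ i → a (π ⟨$⟩ʳ i)) (λ i → b (π ⟨$⟩ʳ i))
  dot-permute a b π = sum-permute (λ i → a i * b i) π

  dot-punchIn : (a b : Fin (suc n) → ℕ) (w : Fin (suc n)) →
                dot a b ≡ a w * b w + dot (a ∘ punchIn w) (b ∘ punchIn w)
  dot-punchIn a b w = sum-remove {i = w} (λ i → a i * b i)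

  sum-𝟙 : dot {n} 𝟙 𝟙 ≡ n
  sum-𝟙 {zero}  = refl
  sum-𝟙 {suc n} = cong suc sum-𝟙

dot-cong : {a b c d : Fin n → ℕ} → a ≗ b → c ≗ d → dot a c ≡ dot b d
dot-cong p q = trans (dot≡ _ _) (trans (Sum-cong λ i → cong₂ _*_ (p i) (q i)) (sym (dot≡ _ _)))

dot-comm : (a b : Fin n → ℕ) → dot a b ≡ dot b a
dot-comm a b = trans (dot≡ a b) (trans (Sum-cong λ i → *-comm (a i) (b i)) (sym (dot≡ b a)))

dot-⊞ˡ : (a b c : Fin n → ℕ) → dot (a ⊞ b) c ≡ dot a c + dot b c
dot-⊞ˡ a b c = trans (dot≡ _ _) (trans (Sum-cong λ i → *-distribʳ-+ (c i) (a i) (b i))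
  (trans (Sum-+ _ _) (sym (cong₂ _+_ (dot≡ a c) (dot≡ b c)))))

dot-⊞ʳ : (a b c : Fin n → ℕ) → dot a (b ⊞ c) ≡ dot a b + dot a c
dot-⊞ʳ a b c = trans (dot-comm a (b ⊞ c))
  (trans (dot-⊞ˡ b c a) (cong₂ _+_ (dot-comm b a) (dot-comm c a)))

dot-0 : (a : Fin n → ℕ) → dot 𝟘 a ≡ 0
dot-0 a = trans (dot≡ 𝟘 a) Sum-0

dot-δ : (w : Fin n) (a : Fin n → ℕ) → dot (δ w) a ≡ a w
dot-δ zero a = trans (dot-suc (δ zero) a) (trans (cong (a zero + 0 +_) (dot-0 (a ∘ suc)))
                     (trans (+-identityʳ _) (+-identityʳ _)))
dot-δ (suc w) a = trans (dot-suc (δ (suc w)) a) (dot-δ w (a ∘ suc))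

dot-mono : {a b : Fin n → ℕ} (c : Fin n → ℕ) → (∀ i → a i ≤ b i) → dot a c ≤ dot b c
dot-mono c h = subst₂ _≤_ (sym (dot≡ _ c)) (sym (dot≡ _ c)) (Sum-mono λ i → *-monoˡ-≤ (c i) (h i))

dot-pos : (a b : Fin n → ℕ) → 1 ≤ dot a b → ∃ λ i → 1 ≤ a i × 1 ≤ b i
dot-pos {zero} a b h with () ← subst (1 ≤_) (dot-nil a b) h
dot-pos {suc n} a b h with a zero in p | b zero in q | subst (1 ≤_) (dot-suc a b) h
... | zero | _ | h′ with dot-pos (a ∘ suc) (b ∘ suc) h′
...   | i , r = suc i , r
dot-pos {suc n} a b h | suc x | zero | h′ with dot-pos (a ∘ suc) (b ∘ suc)
      (subst (λ z → 1 ≤ z + dot (a ∘ suc) (b ∘ suc)) (*-zeroʳ (suc x)) h′)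
...   | i , r = suc i , r
dot-pos {suc n} a b h | suc x | suc y | _ =
  zero , subst (1 ≤_) (sym p) (s≤s z≤n) , subst (1 ≤_) (sym q) (s≤s z≤n)

-- Applied to a row of the adjacency matrix, this lists the neighbours of a vertex one at a time:
-- the row becomes a sum of `δ`s and a remainder.
split-at : (a : Fin n → ℕ) (i : Fin n) → 1 ≤ a i → ∃ λ b → a ≗ δ i ⊞ b
split-at a i h = (λ j → a j ∸ δ i j) , λ j → sym (m+[n∸m]≡n (le j))
  where
  le : ∀ j → δ i j ≤ a j
  le j with j ≟ i
  ... | yes refl = h
  ... | no  _    = z≤n

dot-0→ : (a : Fin n → ℕ) → dot a 𝟙 ≤ 0 → a ≗ 𝟘
dot-0→ a h i = n≤0⇒n≡0 (≤-trans (eq≤ (sym (*-identityʳ (a i)))) (≤-trans (term≤dot a 𝟙 i) h))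

b2n≤1 : (b : Bool) → b2n b ≤ 1
b2n≤1 true  = ≤-refl
b2n≤1 false = z≤n

==-refl : (i : Fin n) → (i == i) ≡ true
==-refl i = dec-true (i ≟ i) refl

==-≢ : {i j : Fin n} → i ≢ j → (i == j) ≡ false
==-≢ {i = i} {j} = dec-false (i ≟ j)

δ-self : (i : Fin n) → δ i i ≡ 1
δ-self i = cong b2n (==-refl i)

δ-≢ : {i j : Fin n} → j ≢ i → δ i j ≡ 0
δ-≢ p = cong b2n (==-≢ p)

-- Indicator functions

ind : Subset n → Fin n → ℕ
ind X i = b2n (lookup X i)

-- A record, so that `i` and `X` can be read off the type; the bare equation about `lookup X i`
-- would not determine them. Non-membership is a positive equation as well, not a negation.
record _∈_ (i : Fin n) (X : Subset n) : Set where
  constructor mem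
  field unmem : lookup X i ≡ true

record _∉_ (i : Fin n) (X : Subset n) : Set where
  constructor mem
  field unmem : lookup X i ≡ false

open _∈_ public using () renaming (unmem to ∈-look)
open _∉_ public using () renaming (unmem to ∉-look)

_∈?_ : (i : Fin n) (X : Subset n) → i ∈ X ⊎ i ∉ X
i ∈? X with lookup X i in p
... | true  = inj₁ (mem p)
... | false = inj₂ (mem p)

_∈ᵈ_ : (i : Fin n) (X : Subset n) → Dec (i ∈ X)
i ∈ᵈ X = map′ mem ∈-look (lookup X i Bool.≟ true)

_∉ᵈ_ : (i : Fin n) (X : Subset n) → Dec (i ∉ X)
i ∉ᵈ X = map′ mem ∉-look (lookup X i Bool.≟ false)

in→1 : {X : Subset n} {i : Fin n} → i ∈ X → ind X i ≡ 1
in→1 (mem p) = cong b2n p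

out→0 : {X : Subset n} {i : Fin n} → i ∉ X → ind X i ≡ 0
out→0 (mem p) = cong b2n p

1→in : (X : Subset n) (i : Fin n) → 1 ≤ ind X i → i ∈ X
1→in X i h with lookup X i in p
... | true = mem p

∈∉ : {X : Subset n} {i : Fin n} → i ∈ X → i ∉ X → ⊥
∈∉ (mem p) (mem q) with () ← trans (sym p) q

∈∉-≢ : {X : Subset n} {i j : Fin n} → i ∈ X → j ∉ X → i ≢ j
∈∉-≢ p q refl = ∈∉ p q

card≡ : (X : Subset n) → ∣ X ∣ ≡ dot (ind X) 𝟙
card≡ []           = sym (dot-nil _ _)
card≡ (true  ∷ X)  = trans (cong suc (card≡ X)) (sym (dot-suc _ _))
card≡ (false ∷ X)  = trans (card≡ X) (sym (dot-suc _ _))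

card-decomp : (X : Subset n) (a b : Fin n → ℕ) → ind X ≗ a ⊞ b → ∣ X ∣ ≡ dot a 𝟙 + dot b 𝟙
card-decomp X a b h = trans (card≡ X) (trans (dot-cong h (λ _ → refl)) (dot-⊞ˡ a b 𝟙))

ind-⊤ : ind (⊤ {n}) ≗ 𝟙
ind-⊤ {n} i = cong b2n (lookup-replicate i true)

ind-∅ : ind (∅ {n}) ≗ λ _ → 0
ind-∅ {n} i = cong b2n (lookup-replicate i false)

≢⊤ : {X : Subset n} {i : Fin n} → i ∉ X → X ≢ ⊤
≢⊤ {i = i} h refl = ∈∉ (mem (lookup-replicate i true)) h

Full⊎missing : (X : Subset n) → X ≡ ⊤ ⊎ ∃ λ i → i ∉ X
Full⊎missing [] = inj₁ refl
Full⊎missing (false ∷ X) = inj₂ (zero , mem refl)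
Full⊎missing (true ∷ X) with Full⊎missing X
... | inj₁ p           = inj₁ (cong (true ∷_) p)
... | inj₂ (i , mem p) = inj₂ (suc i , mem p)

_∪₁_ : Subset n → Fin n → Subset n
X ∪₁ w = tabulate λ j → lookup X j ∨ (j == w)

_∖_ : Subset n → Subset n → Subset n
X ∖ Y = tabulate λ j → lookup X j ∧ not (lookup Y j)

_-₁_ : Subset n → Fin n → Subset n
X -₁ w = tabulate λ j → lookup X j ∧ not (j == w)

ind-∪₁ : {X : Subset n} {w : Fin n} → w ∉ X → ind (X ∪₁ w) ≗ ind X ⊞ δ w
ind-∪₁ {X = X} {w} (mem h) j = trans (cong b2n (lookup∘tabulate _ j)) aux
  where
  aux : b2n (lookup X j ∨ (j == w)) ≡ ind X j + b2n (j == w)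
  aux with j ≟ w
  ... | yes refl rewrite h = refl
  ... | no _ with lookup X j
  ...   | true  = refl
  ...   | false = refl

ind--₁ : {X : Subset n} {w : Fin n} → w ∈ X → ind X ≗ ind (X -₁ w) ⊞ δ w
ind--₁ {X = X} {w} (mem h) j = trans aux (cong (_+ δ w j) (cong b2n (sym (lookup∘tabulate _ j))))
  where
  aux : ind X j ≡ b2n (lookup X j ∧ not (j == w)) + b2n (j == w)
  aux with j ≟ w
  ... | yes refl rewrite h = refl
  ... | no _ with lookup X j
  ...   | true  = refl
  ...   | false = refl

module _ (X Y : Subset n) where
  private
    look-∖ : ∀ Z W (j : Fin n) → ind (Z ∖ W) j ≡ b2n (lookup Z j ∧ not (lookup W j))
    look-∖ Z W j = cong b2n (lookup∘tabulate _ j)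
    look-∩ : ∀ j → ind (X ∩ Y) j ≡ b2n (lookup X j ∧ lookup Y j)
    look-∩ j = cong b2n (lookup-zipWith _∧_ j X Y)

  -- Let p, q and m be the indicators of the two differences and of the intersection. Then `X`, `Y`
  -- and `X ∪ Y` become p + m, q + m and p + q + m, and every identity about unions and
  -- intersections is an identity in p, q and m.
  ind-splitˡ : ind X ≗ ind (X ∖ Y) ⊞ ind (X ∩ Y)
  ind-splitˡ j rewrite look-∖ X Y j | look-∩ j with lookup X j | lookup Y j
  ... | true  | true  = refl
  ... | true  | false = refl
  ... | false | _     = refl

  ind-splitʳ : ind Y ≗ ind (Y ∖ X) ⊞ ind (X ∩ Y)
  ind-splitʳ j rewrite look-∖ Y X j | look-∩ j with lookup X j | lookup Y j
  ... | true  | true  = refl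
  ... | true  | false = refl
  ... | false | true  = refl
  ... | false | false = refl

  ind-∪ : ind (X ∪ Y) ≗ ind (X ∖ Y) ⊞ ind (Y ∖ X) ⊞ ind (X ∩ Y)
  ind-∪ j rewrite look-∖ X Y j | look-∖ Y X j | look-∩ j | lookup-zipWith _∨_ j X Y
    with lookup X j | lookup Y j
  ... | true  | true  = refl
  ... | true  | false = refl
  ... | false | true  = refl
  ... | false | false = refl

ind-∁ : (X : Subset n) → 𝟙 ≗ ind X ⊞ ind (∁ X)
ind-∁ X j rewrite lookup-map j not X with lookup X j
... | true  = refl
... | false = refl

∪-out : {X Y : Subset n} {i : Fin n} → i ∉ X → i ∉ Y → i ∉ (X ∪ Y)
∪-out {X = X} {Y} {i} (mem p) (mem q) = mem (trans (lookup-zipWith _∨_ i X Y) (cong₂ _∨_ p q))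

∪-inˡ : {X : Subset n} (Y : Subset n) {i : Fin n} → i ∈ X → i ∈ (X ∪ Y)
∪-inˡ {X = X} Y {i} (mem p) = mem (trans (lookup-zipWith _∨_ i X Y) (cong (_∨ lookup Y i) p))

∪-inʳ : (X : Subset n) {Y : Subset n} {i : Fin n} → i ∈ Y → i ∈ (X ∪ Y)
∪-inʳ X {Y} {i} (mem p) =
  mem (trans (lookup-zipWith _∨_ i X Y) (trans (cong (lookup X i ∨_) p) (∨-zeroʳ _)))

∩-in : {X Y : Subset n} {i : Fin n} → i ∈ X → i ∈ Y → i ∈ (X ∩ Y)
∩-in {X = X} {Y} {i} (mem p) (mem q) = mem (trans (lookup-zipWith _∧_ i X Y) (cong₂ _∧_ p q))

∩-outˡ : {X : Subset n} (Y : Subset n) {i : Fin n} → i ∉ X → i ∉ (X ∩ Y)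
∩-outˡ {X = X} Y {i} (mem p) = mem (trans (lookup-zipWith _∧_ i X Y) (cong (_∧ lookup Y i) p))

∩-outʳ : (X : Subset n) {Y : Subset n} {i : Fin n} → i ∉ Y → i ∉ (X ∩ Y)
∩-outʳ X {Y} {i} (mem p) = mem (trans (lookup-zipWith _∧_ i X Y) (trans (cong (lookup X i ∧_) p) (∧-zeroʳ _)))

∁-in : {X : Subset n} {i : Fin n} → i ∉ X → i ∈ ∁ X
∁-in {X = X} {i} (mem p) = mem (trans (lookup-map i not X) (cong not p))

∁-out′ : {X : Subset n} {i : Fin n} → i ∈ X → i ∉ ∁ X
∁-out′ {X = X} {i} (mem p) = mem (trans (lookup-map i not X) (cong not p))

∁-out : {X : Subset n} {i : Fin n} → i ∈ ∁ X → i ∉ X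
∁-out {X = X} {i} p with i ∈? X
... | inj₁ q = ⊥-elim (∈∉ p (∁-out′ q))
... | inj₂ q = q

∖-in : {X Y : Subset n} {i : Fin n} → i ∈ X → i ∉ Y → i ∈ (X ∖ Y)
∖-in {i = i} (mem p) (mem q) = mem (trans (lookup∘tabulate _ i) (cong₂ (λ a b → a ∧ not b) p q))

∪₁-out : {X : Subset n} {w i : Fin n} → i ∉ X → i ≢ w → i ∉ (X ∪₁ w)
∪₁-out {i = i} (mem p) q = mem (trans (lookup∘tabulate _ i) (cong₂ _∨_ p (==-≢ q)))

-₁-self : (X : Subset n) (w : Fin n) → w ∉ (X -₁ w)
-₁-self X w = mem (trans (lookup∘tabulate _ w)
  (trans (cong (λ b → lookup X w ∧ not b) (==-refl w)) (∧-zeroʳ (lookup X w))))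

-₁-in : {X : Subset n} {w i : Fin n} → i ∈ X → i ≢ w → i ∈ (X -₁ w)
-₁-in {i = i} (mem p) q = mem (trans (lookup∘tabulate _ i) (cong₂ (λ a b → a ∧ not b) p (==-≢ q)))

card-∪₁ : {X : Subset n} {w : Fin n} → w ∉ X → ∣ X ∪₁ w ∣ ≡ ∣ X ∣ + 1
card-∪₁ {X = X} {w} h = trans (card-decomp (X ∪₁ w) (ind X) (δ w) (ind-∪₁ h)) (cong₂ _+_ (sym (card≡ X)) (dot-δ w 𝟙))

card--₁ : {X : Subset n} {w : Fin n} → w ∈ X → ∣ X ∣ ≡ ∣ X -₁ w ∣ + 1
card--₁ {X = X} {w} h = trans (card-decomp X (ind (X -₁ w)) (δ w) (ind--₁ h)) (cong₂ _+_ (sym (card≡ (X -₁ w))) (dot-δ w 𝟙))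

card-pos : {X : Subset n} {i : Fin n} → i ∈ X → 1 ≤ ∣ X ∣
card-pos {X = X} {i} h = subst (1 ≤_) (sym (card--₁ h)) (m≤n+m 1 ∣ X -₁ i ∣)

card-pos-2 : {X : Subset n} {i j : Fin n} → i ∈ X → j ∈ X → i ≢ j → 2 ≤ ∣ X ∣
card-pos-2 p q i≢j = subst (2 ≤_) (sym (card--₁ q)) (card-pos (-₁-in p i≢j) ⊕ ≤-refl {1})

card-∁ : (X : Subset n) → n ≡ ∣ X ∣ + ∣ ∁ X ∣
card-∁ {n} X = begin
  n                                 ≡⟨ sym sum-𝟙 ⟩
  dot {n} 𝟙 𝟙                       ≡⟨ dot-cong (ind-∁ X) (λ _ → refl) ⟩
  dot (ind X ⊞ ind (∁ X)) 𝟙         ≡⟨ dot-⊞ˡ (ind X) (ind (∁ X)) 𝟙 ⟩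
  dot (ind X) 𝟙 + dot (ind (∁ X)) 𝟙 ≡⟨ cong₂ _+_ (sym (card≡ X)) (sym (card≡ (∁ X))) ⟩
  ∣ X ∣ + ∣ ∁ X ∣                   ∎
  where
  open ≡-Reasoning

card-∪∩ : (X Y : Subset n) → ∣ X ∣ + ∣ Y ∣ ≡ ∣ X ∪ Y ∣ + ∣ X ∩ Y ∣
card-∪∩ X Y
  rewrite card-decomp X (ind (X ∖ Y)) (ind (X ∩ Y)) (ind-splitˡ X Y) | card-decomp Y (ind (Y ∖ X)) (ind (X ∩ Y)) (ind-splitʳ X Y)
        | card-decomp (X ∪ Y) (ind (X ∖ Y) ⊞ ind (Y ∖ X)) (ind (X ∩ Y)) (ind-∪ X Y) | dot-⊞ˡ (ind (X ∖ Y)) (ind (Y ∖ X)) 𝟙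
        | card≡ (X ∩ Y)
  = ar (dot (ind (X ∖ Y)) 𝟙) (dot (ind (Y ∖ X)) 𝟙) (dot (ind (X ∩ Y)) 𝟙)
  where
  ar : ∀ p q m → (p + m) + (q + m) ≡ (p + q + m) + m
  ar = solve-∀

pair : Fin n → Fin n → Subset n
pair a b = tabulate λ j → (j == a) ∨ (j == b)

ind-pair : {a b : Fin n} → a ≢ b → ind (pair a b) ≗ δ a ⊞ δ b
ind-pair {a = a} {b} a≢b j = trans (cong b2n (lookup∘tabulate _ j)) aux
  where
  aux : b2n ((j == a) ∨ (j == b)) ≡ b2n (j == a) + b2n (j == b)
  aux with j ≟ a
  ... | yes refl = sym (cong (λ z → 1 + b2n z) (==-≢ a≢b))
  ... | no _     = refl

pair-inˡ : (a b : Fin n) → a ∈ pair a b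
pair-inˡ a b = mem (trans (lookup∘tabulate _ a) (cong (_∨ (a == b)) (==-refl a)))

pair-inʳ : (a b : Fin n) → b ∈ pair a b
pair-inʳ a b = mem (trans (lookup∘tabulate _ b) (trans (cong ((b == a) ∨_) (==-refl b)) (∨-zeroʳ _)))

pair-out : {a b i : Fin n} → i ≢ a → i ≢ b → i ∉ pair a b
pair-out {i = i} p q = mem (trans (lookup∘tabulate _ i) (cong₂ _∨_ (==-≢ p) (==-≢ q)))

card-pair : (X : Subset n) {a b : Fin n} → ind X ≗ δ a ⊞ δ b → ∣ X ∣ ≡ 2
card-pair X {a} {b} h = trans (card-decomp X (δ a) (δ b) h) (cong₂ _+_ (dot-δ a 𝟙) (dot-δ b 𝟙))

-- Degrees and edge counts

module Count (G : LGraph n) (ls : IsLoopedSimple G) where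

  A : Fin n → Fin n → ℕ
  A i j = b2n (adj G i j)

  R : (Fin n → ℕ) → Fin n → ℕ
  R b i = dot (A i) b

  -- The bilinear form of the adjacency matrix. On indicators it counts the ordered adjacent pairs,
  -- hence for disjoint sets the edges between them; `R (ind X) i` is the number of neighbours of
  -- `i` in `X`.
  E : (Fin n → ℕ) → (Fin n → ℕ) → ℕ
  E a b = dot a (R b)

  L : (Fin n → ℕ) → ℕ
  L a = dot a (loops G)

  dg : Fin n → ℕ
  dg i = R 𝟙 i + loops G i

  A-sym : ∀ i j → A i j ≡ A j i
  A-sym i j = cong b2n (adj-sym ls i j)

  A-irr : ∀ i → A i i ≡ 0
  A-irr i = cong b2n (adj-irrefl ls i)

  R-δ : ∀ w i → R (δ w) i ≡ A i w
  R-δ w i = trans (dot-comm (A i) (δ w)) (dot-δ w (A i))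

  R-cong : {a b : Fin n → ℕ} → a ≗ b → R a ≗ R b
  R-cong h i = dot-cong {a = A i} (λ _ → refl) h

  R-⊞ : ∀ a b → R (a ⊞ b) ≗ R a ⊞ R b
  R-⊞ a b i = dot-⊞ʳ (A i) a b

  E-cong : {a b c d : Fin n → ℕ} → a ≗ b → c ≗ d → E a c ≡ E b d
  E-cong p q = dot-cong p (R-cong q)

  E-⊞ˡ : ∀ a b c → E (a ⊞ b) c ≡ E a c + E b c
  E-⊞ˡ a b c = dot-⊞ˡ a b (R c)

  E-⊞ʳ : ∀ a b c → E a (b ⊞ c) ≡ E a b + E a c
  E-⊞ʳ a b c = trans (dot-cong {a = a} (λ _ → refl) (R-⊞ b c)) (dot-⊞ʳ a (R b) (R c))

  E-sum : ∀ a b → E a b ≡ Sum λ i → Sum λ j → a i * (A i j * b j)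
  E-sum a b = trans (dot≡ a (R b)) (Sum-cong λ i →
    trans (cong (a i *_) (dot≡ (A i) b)) (*-Sum (a i) (λ j → A i j * b j)))

  E-sym : ∀ a b → E a b ≡ E b a
  E-sym a b = begin
    E a b                                         ≡⟨ E-sum a b ⟩
    Sum (λ i → Sum (λ j → a i * (A i j * b j)))   ≡⟨ Sum-swap _ ⟩
    Sum (λ j → Sum (λ i → a i * (A i j * b j)))
      ≡⟨ Sum-cong (λ j → Sum-cong (λ i → trans (ar (a i) (A i j) (b j)) (cong (λ z → b j * (z * a i)) (A-sym i j)))) ⟩
    Sum (λ j → Sum (λ i → b j * (A j i * a i)))   ≡⟨ sym (E-sum b a) ⟩
    E b a                                         ∎
    where
    open ≡-Reasoning
    ar : ∀ x y z → x * (y * z) ≡ z * (y * x)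
    ar = solve-∀

  E-δ : ∀ w b → E (δ w) b ≡ R b w
  E-δ w b = dot-δ w (R b)

  E-diag : ∀ a b → E (a ⊞ b) (a ⊞ b) ≡ E a a + 2 * E a b + E b b
  E-diag a b rewrite E-⊞ˡ a b (a ⊞ b) | E-⊞ʳ a a b | E-⊞ʳ b a b | E-sym b a =
    ar (E a a) (E a b) (E b b)
    where
    ar : ∀ x y z → x + y + (y + z) ≡ x + 2 * y + z
    ar = solve-∀

  E-pos : (X Y : Subset n) {i j : Fin n} → i ∈ X → j ∈ Y → A i j ≤ E (ind X) (ind Y)
  E-pos X Y {i} {j} p q = begin
    A i j                          ≡⟨ sym (trans (cong₂ (λ a b → a * (A i j * b)) (in→1 p) (in→1 q)) (trans (+-identityʳ _) (*-identityʳ _))) ⟩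
    ind X i * (A i j * ind Y j)    ≤⟨ *-monoʳ-≤ (ind X i) (term≤dot (A i) (ind Y) j) ⟩
    ind X i * R (ind Y) i          ≤⟨ term≤dot (ind X) (R (ind Y)) i ⟩
    E (ind X) (ind Y)              ∎
    where open ≤-Reasoning

  -- The form sees each edge in both orders, `iE` only in the order i < j; the diagonal contributes
  -- nothing by irreflexivity.
  2iE : ∀ X → 2 * iE G X ≡ E (ind X) (ind X)
  2iE X = begin
    2 * iE G X                     ≡⟨ cong (2 *_) iE≡ ⟩
    2 * S lt                       ≡⟨ cong (S lt +_) (+-identityʳ _) ⟩
    S lt + S lt                    ≡⟨ cong (S lt +_) flip ⟩
    S lt + S gt                    ≡⟨ sym (Sum-+ _ _) ⟩
    Sum (λ i → Sum (λ j → lt i j) + Sum (λ j → gt i j))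
                                   ≡⟨ Sum-cong (λ i → sym (Sum-+ (lt i) (gt i))) ⟩
    Sum (λ i → Sum (λ j → lt i j + gt i j))
                                   ≡⟨ Sum-cong (λ i → Sum-cong (λ j → pt i j)) ⟩
    Sum (λ i → Sum (λ j → ind X i * (A i j * ind X j)))
                                   ≡⟨ sym (E-sum (ind X) (ind X)) ⟩
    E (ind X) (ind X)              ∎
    where
    open ≡-Reasoning
    x = lookup X
    lt gt : Fin n → Fin n → ℕ
    lt i j = b2n (does (i <? j) ∧ x i ∧ x j ∧ adj G i j)
    gt i j = lt j i
    S : (Fin n → Fin n → ℕ) → ℕ
    S f = Sum λ i → Sum λ j → f i j
    iE≡ : iE G X ≡ S lt
    iE≡ = trans (sumFin≡ _) (Sum-cong λ i → sumFin≡ (lt i))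
    flip : S lt ≡ S gt
    flip = Sum-swap lt
    prod : ∀ a b c → b2n (a ∧ b ∧ c) ≡ b2n a * (b2n c * b2n b)
    prod true  true  true  = refl
    prod true  true  false = refl
    prod true  false true  = refl
    prod true  false false = refl
    prod false _     _     = refl
    comm3 : ∀ a b c → b ∧ a ∧ c ≡ a ∧ b ∧ c
    comm3 a b c = trans (sym (∧-assoc b a c)) (trans (cong (_∧ c) (∧-comm b a)) (∧-assoc a b c))
    pt : ∀ i j → lt i j + gt i j ≡ ind X i * (A i j * ind X j)
    pt i j with <-cmp i j
    ... | tri< p _ q rewrite dec-true (i <? j) p | dec-false (j <? i) q =
      trans (+-identityʳ _) (prod (x i) (x j) (adj G i j))
    ... | tri> q _ p rewrite dec-true (j <? i) p | dec-false (i <? j) q =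
      trans (cong b2n (trans (cong (λ z → x j ∧ x i ∧ z) (adj-sym ls j i)) (comm3 (x i) (x j) (adj G i j))))
            (prod (x i) (x j) (adj G i j))
    ... | tri≈ q refl _ rewrite dec-false (i <? i) q | adj-irrefl ls i = sym (*-zeroʳ (ind X i))

  iL≡ : ∀ X → iL G X ≡ L (ind X)
  iL≡ X = trans (sumFin≡ _) (trans (Sum-cong pt) (sym (dot≡ _ _)))
    where
    pt : ∀ i → (if lookup X i then loops G i else 0) ≡ ind X i * loops G i
    pt i with lookup X i
    ... | true  = sym (+-identityʳ _)
    ... | false = refl

  iL-decomp : ∀ X a b → ind X ≗ a ⊞ b → iL G X ≡ L a + L b
  iL-decomp X a b h = trans (iL≡ X) (trans (dot-cong h (λ _ → refl)) (dot-⊞ˡ a b (loops G)))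

  2iE-decomp : ∀ X a b → ind X ≗ a ⊞ b → 2 * iE G X ≡ E a a + 2 * E a b + E b b
  2iE-decomp X a b h = trans (2iE X) (trans (E-cong h h) (E-diag a b))

  iE-δ : ∀ X Y {w} → ind Y ≗ ind X ⊞ δ w → iE G Y ≡ iE G X + R (ind X) w
  iE-δ X Y {w} h = *-cancelˡ-≡ _ _ 2 (begin
    2 * iE G Y                                          ≡⟨ 2iE-decomp Y x (δ w) h ⟩
    E x x + 2 * E x (δ w) + E (δ w) (δ w)
      ≡⟨ cong₂ _+_ (cong₂ (λ a b → a + 2 * b) (sym (2iE X)) (trans (E-sym x (δ w)) (E-δ w x))) (trans (E-δ w (δ w)) (trans (R-δ w w) (A-irr w))) ⟩
    2 * iE G X + 2 * R x w + 0                          ≡⟨ ar (iE G X) (R x w) ⟩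
    2 * (iE G X + R x w)                                ∎)
    where
    open ≡-Reasoning
    x = ind X
    ar : ∀ a b → 2 * a + 2 * b + 0 ≡ 2 * (a + b)
    ar = solve-∀

  iL-δ : ∀ X Y {w} → ind Y ≗ ind X ⊞ δ w → iL G Y ≡ iL G X + loops G w
  iL-δ X Y {w} h = trans (iL-decomp Y (ind X) (δ w) h) (cong₂ _+_ (sym (iL≡ X)) (dot-δ w (loops G)))

  iL-∪∩ : ∀ X Y → iL G X + iL G Y ≡ iL G (X ∪ Y) + iL G (X ∩ Y)
  iL-∪∩ X Y
    rewrite iL-decomp X (ind (X ∖ Y)) (ind (X ∩ Y)) (ind-splitˡ X Y) | iL-decomp Y (ind (Y ∖ X)) (ind (X ∩ Y)) (ind-splitʳ X Y)
          | iL-decomp (X ∪ Y) (ind (X ∖ Y) ⊞ ind (Y ∖ X)) (ind (X ∩ Y)) (ind-∪ X Y) | dot-⊞ˡ (ind (X ∖ Y)) (ind (Y ∖ X)) (loops G)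
          | iL≡ (X ∩ Y)
    = ar (L (ind (X ∖ Y))) (L (ind (Y ∖ X))) (L (ind (X ∩ Y)))
    where
    ar : ∀ p q m → (p + m) + (q + m) ≡ (p + q + m) + m
    ar = solve-∀

  -- Supermodularity with its slack made explicit. The slack is the number of edges between the two
  -- differences: it must vanish for two sets tight for edges and loops, and in `TT-union₁` it
  -- accounts for a single edge.
  iE-∪∩ : ∀ X Y → iE G X + iE G Y + E (ind (X ∖ Y)) (ind (Y ∖ X)) ≡ iE G (X ∪ Y) + iE G (X ∩ Y)
  iE-∪∩ X Y = *-cancelˡ-≡ _ _ 2 (begin
    2 * (iE G X + iE G Y + E p q)  ≡⟨ d3 (iE G X) (iE G Y) (E p q) ⟩
    2 * iE G X + 2 * iE G Y + 2 * E p q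
      ≡⟨ cong₂ (λ a b → a + b + 2 * E p q) (2iE-decomp X (ind (X ∖ Y)) (ind (X ∩ Y)) (ind-splitˡ X Y)) (2iE-decomp Y (ind (Y ∖ X)) (ind (X ∩ Y)) (ind-splitʳ X Y)) ⟩
    (E p p + 2 * E p m + E m m) + (E q q + 2 * E q m + E m m) + 2 * E p q
      ≡⟨ ar (E p p) (E p m) (E m m) (E q q) (E q m) (E p q) ⟩
    ((E p p + 2 * E p q + E q q) + 2 * (E p m + E q m) + E m m) + E m m
      ≡⟨ cong₂ _+_ (cong₂ (λ a b → a + 2 * b + E m m) (sym (E-diag p q)) (sym (E-⊞ˡ p q m))) (sym (2iE (X ∩ Y))) ⟩
    (E (p ⊞ q) (p ⊞ q) + 2 * E (p ⊞ q) m + E m m) + 2 * iE G (X ∩ Y)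
      ≡⟨ cong (_+ 2 * iE G (X ∩ Y)) (sym (2iE-decomp (X ∪ Y) (ind (X ∖ Y) ⊞ ind (Y ∖ X)) (ind (X ∩ Y)) (ind-∪ X Y))) ⟩
    2 * iE G (X ∪ Y) + 2 * iE G (X ∩ Y)  ≡⟨ sym (*-distribˡ-+ 2 (iE G (X ∪ Y)) _) ⟩
    2 * (iE G (X ∪ Y) + iE G (X ∩ Y)) ∎)
    where
    open ≡-Reasoning
    p = ind (X ∖ Y)
    q = ind (Y ∖ X)
    m = ind (X ∩ Y)
    d3 : ∀ a b c → 2 * (a + b + c) ≡ 2 * a + 2 * b + 2 * c
    d3 = solve-∀
    ar : ∀ pp pm mm qq qm pq → (pp + 2 * pm + mm) + (qq + 2 * qm + mm) + 2 * pq
       ≡ ((pp + 2 * pq + qq) + 2 * (pm + qm) + mm) + mm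
    ar = solve-∀

  iE-pair : ∀ X {a b} → ind X ≗ δ a ⊞ δ b → iE G X ≡ A a b
  iE-pair X {a} {b} h = *-cancelˡ-≡ _ _ 2 (trans (2iE-decomp X (δ a) (δ b) h)
    (trans (cong₂ _+_ (cong₂ (λ x y → x + 2 * y) (trans (E-δ a (δ a)) (trans (R-δ a a) (A-irr a))) (trans (E-δ a (δ b)) (R-δ b a)))
      (trans (E-δ b (δ b)) (trans (R-δ b b) (A-irr b)))) (+-identityʳ _)))

  -- In the sum of the degrees over `X`, an edge inside `X` is counted twice, and every other edge
  -- or loop that meets `X` once. Adding what lies inside the complement `Y` counts everything once,
  -- and the edges inside `X` once more.
  degree-sum : ∀ X Y → 𝟙 ≗ ind Y ⊞ ind X →
    dot (ind X) dg + (iE G Y + iL G Y) ≡ iE G X + (nE G + nL G)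
  degree-sum X Y h = *-cancelˡ-≡ _ _ 2 (begin
    2 * (dot x dg + (iE G Y + iL G Y))   ≡⟨ cong (λ z → 2 * (z + (iE G Y + iL G Y))) dgs ⟩
    2 * (E x y + E x x + L x + (iE G Y + iL G Y)) ≡⟨ ar₁ (E x y) (E x x) (L x) (iE G Y) (iL G Y) ⟩
    2 * E x y + 2 * E x x + 2 * L x + (2 * iE G Y + 2 * iL G Y)
      ≡⟨ cong₂ (λ a b → 2 * E x y + 2 * E x x + 2 * L x + (a + 2 * b)) (2iE Y) (iL≡ Y) ⟩
    2 * E x y + 2 * E x x + 2 * L x + (E y y + 2 * L y) ≡⟨ ar₂ (E x y) (E x x) (L x) (E y y) (L y) ⟩
    E x x + ((E y y + 2 * E x y + E x x) + 2 * (L y + L x))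
      ≡⟨ cong (λ z → E x x + ((E y y + 2 * z + E x x) + 2 * (L y + L x))) (E-sym x y) ⟩
    E x x + ((E y y + 2 * E y x + E x x) + 2 * (L y + L x))
      ≡⟨ sym (cong₂ (λ a b → a + b) (2iE X) (cong₂ (λ a b → a + 2 * b) (2iE-decomp ⊤ y x h′) (iL-decomp ⊤ y x h′))) ⟩
    2 * iE G X + (2 * nE G + 2 * nL G)   ≡⟨ ar₃ (iE G X) (nE G) (nL G) ⟩
    2 * (iE G X + (nE G + nL G))         ∎)
    where
    open ≡-Reasoning
    x = ind X
    y = ind Y
    h′ : ind ⊤ ≗ ind Y ⊞ ind X
    h′ i = trans (ind-⊤ i) (h i)
    dgs : dot x dg ≡ E x y + E x x + L x
    dgs = trans (dot-⊞ʳ x (R 𝟙) (loops G)) (cong (_+ L x) (trans (E-cong {a = x} (λ _ → refl) h) (E-⊞ʳ x y x)))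
    ar₁ : ∀ a b c d e → 2 * (a + b + c + (d + e)) ≡ 2 * a + 2 * b + 2 * c + (2 * d + 2 * e)
    ar₁ = solve-∀
    ar₂ : ∀ a b c d e → 2 * a + 2 * b + 2 * c + (d + 2 * e) ≡ b + ((d + 2 * a + b) + 2 * (e + c))
    ar₂ = solve-∀
    ar₃ : ∀ a b c → 2 * a + (2 * b + 2 * c) ≡ 2 * (a + (b + c))
    ar₃ = solve-∀

-- The averaging step that yields nodes, with `k` = 4, and leaves, with `k` = 2.
dot-< : (X : Subset n) (g : Fin n → ℕ) (k : ℕ) → dot (ind X) g < k * ∣ X ∣ →
        ∃ λ i → i ∈ X × g i < k
dot-< [] g k h = ⊥-elim (n≮0 (subst (dot (ind []) g <_) (*-zeroʳ k) h))
dot-< (false ∷ X) g k h with dot-< X (g ∘ suc) k (subst (_< k * ∣ X ∣) (dot-suc _ g) h)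
... | i , mem p , r = suc i , mem p , r
dot-< (true ∷ X) g k h with g zero <?ℕ k
... | yes p = zero , mem refl , p
... | no ¬p with dot-< X (g ∘ suc) k
      (+-cancelˡ-< k _ _ (≤-<-trans (≮⇒≥ ¬p ⊕ ≤-refl)
        (subst₂ _<_ (trans (dot-suc _ g) (cong (_+ dot (ind X) (g ∘ suc)) (+-identityʳ (g zero)))) (*-suc k ∣ X ∣) h)))
...   | i , mem q , r = suc i , mem q , r

-- Tight sets

module Tightness {n : ℕ} (G : LGraph n) (ls : IsLoopedSimple G) (rc : RigidCircuit G) where
  open Count G ls public
  open RigidCircuit rc public

  -- F: tight for edges and loops together; T: tight for edges alone, which forces 2 ≤ ∣ X ∣.
  F T : Subset n → Set
  F X = iE G X + iL G X ≡ 2 * ∣ X ∣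
  T X = iE G X + 3 ≡ 2 * ∣ X ∣

  iE-empty : ∀ X → ∣ X ∣ ≤ 0 → iE G X ≡ 0
  iE-empty X h = *-cancelˡ-≡ _ 0 2 (trans (2iE X) (trans (E-cong x0 x0) (dot-0 (R 𝟘))))
    where
    x0 : ind X ≗ 𝟘
    x0 = dot-0→ (ind X) (subst (_≤ 0) (card≡ X) h)

  ∪₁-E : ∀ {X w} → w ∉ X → iE G (X ∪₁ w) ≡ iE G X + R (ind X) w
  ∪₁-E {X} {w} h = iE-δ X (X ∪₁ w) (ind-∪₁ h)

  ∪₁-L : ∀ {X w} → w ∉ X → iL G (X ∪₁ w) ≡ iL G X + loops G w
  ∪₁-L {X} {w} h = iL-δ X (X ∪₁ w) (ind-∪₁ h)

  -₁-E : ∀ {X w} → w ∈ X → iE G X ≡ iE G (X -₁ w) + R (ind X) w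
  -₁-E {X} {w} h = trans (iE-δ (X -₁ w) X (ind--₁ h)) (cong (iE G (X -₁ w) +_) (sym r))
    where
    r : R (ind X) w ≡ R (ind (X -₁ w)) w
    r = trans (R-cong (ind--₁ h) w) (trans (R-⊞ (ind (X -₁ w)) (δ w) w)
      (trans (cong (R (ind (X -₁ w)) w +_) (trans (R-δ w w) (A-irr w))) (+-identityʳ _)))

  -- A singleton meets the edge bound with 2 in place of 3, so with the weaker constant it is enough
  -- that the set is nonempty.
  sparse₁ : ∀ {X i} → i ∈ X → iE G X + 2 ≤ 2 * ∣ X ∣
  sparse₁ {X} {i} h with 2 ≤? ∣ X ∣
  ... | yes p = ≤-trans (+-monoʳ-≤ (iE G X) (s≤s (s≤s z≤n))) (sparseE X p)
  ... | no ¬p = begin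
    iE G X + 2                            ≡⟨ cong (_+ 2) (-₁-E h) ⟩
    iE G (X -₁ i) + R (ind X) i + 2       ≡⟨ cong (λ z → z + R (ind X) i + 2) (iE-empty (X -₁ i) empty) ⟩
    R (ind X) i + 2                       ≡⟨ cong (_+ 2) r ⟩
    2                                     ≤⟨ 2*-mono (card-pos h) ⟩
    2 * ∣ X ∣                             ∎
    where
    open ≤-Reasoning
    empty : ∣ X -₁ i ∣ ≤ 0
    empty = s≤s⁻¹ (subst (_≤ 1) (trans (card--₁ h) (+-comm _ 1)) (s≤s⁻¹ (≰⇒> ¬p)))
    r : R (ind X) i ≡ 0
    r = trans (R-cong (ind--₁ h) i) (trans (R-⊞ (ind (X -₁ i)) (δ i) i)
      (cong₂ _+_ (trans (R-cong (dot-0→ (ind (X -₁ i)) (subst (_≤ 0) (card≡ (X -₁ i)) empty)) i) (trans (dot-comm (A i) 𝟘) (dot-0 (A i)))) (trans (R-δ i i) (A-irr i))))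

  -- The vertex `m` keeps the union and the intersection proper, so both obey the bound.
  -- Supermodularity then holds with equality throughout, which leaves no room for its slack term.
  FF-union : ∀ {X Y m} → F X → F Y → m ∉ X → m ∉ Y →
             F (X ∪ Y) × E (ind (X ∖ Y)) (ind (Y ∖ X)) ≤ 0
  FF-union {X} {Y} {m} fX fY p q = (≤-antisym s∪ tight) , modular
    where
    s∪ = sparseEL (X ∪ Y) (≢⊤ (∪-out p q))
    s∩ = sparseEL (X ∩ Y) (≢⊤ (∩-outˡ Y p))
    tight : 2 * ∣ X ∪ Y ∣ ≤ iE G (X ∪ Y) + iL G (X ∪ Y)
    tight = linear 13 (λ where
      (e₁ ∷ e₂ ∷ b ∷ e∪ ∷ e∩ ∷ l₁ ∷ l₂ ∷ l∪ ∷ l∩ ∷ x₁ ∷ x₂ ∷ u ∷ m ∷ []) →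
        2 :* x₁ ≼ e₁ :+ l₁ ⇒ 2 :* x₂ ≼ e₂ :+ l₂ ⇒ e∩ :+ l∩ ≼ 2 :* m ⇒
        e₁ :+ e₂ :+ b ≼ e∪ :+ e∩ ⇒ l₁ :+ l₂ ≼ l∪ :+ l∩ ⇒ 2 :* (u :+ m) ≼ 2 :* (x₁ :+ x₂) ⇒
        ⊢ 2 :* u ≼ e∪ :+ l∪)
      (iE G X ∷ iE G Y ∷ E (ind (X ∖ Y)) (ind (Y ∖ X)) ∷ iE G (X ∪ Y) ∷ iE G (X ∩ Y) ∷ iL G X ∷ iL G Y ∷ iL G (X ∪ Y) ∷ iL G (X ∩ Y) ∷
         ∣ X ∣ ∷ ∣ Y ∣ ∷ ∣ X ∪ Y ∣ ∷ ∣ X ∩ Y ∣ ∷ [])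
      (eq≥ fX) (eq≥ fY) s∩ (eq≤ (iE-∪∩ X Y)) (eq≤ (iL-∪∩ X Y)) (2*-mono (eq≥ (card-∪∩ X Y)))
    modular : E (ind (X ∖ Y)) (ind (Y ∖ X)) ≤ 0
    modular = linear 13 (λ where
      (e₁ ∷ e₂ ∷ b ∷ e∪ ∷ e∩ ∷ l₁ ∷ l₂ ∷ l∪ ∷ l∩ ∷ x₁ ∷ x₂ ∷ u ∷ m ∷ []) →
        2 :* x₁ ≼ e₁ :+ l₁ ⇒ 2 :* x₂ ≼ e₂ :+ l₂ ⇒ e∪ :+ l∪ ≼ 2 :* u ⇒ e∩ :+ l∩ ≼ 2 :* m ⇒
        e₁ :+ e₂ :+ b ≼ e∪ :+ e∩ ⇒ l₁ :+ l₂ ≼ l∪ :+ l∩ ⇒ 2 :* (u :+ m) ≼ 2 :* (x₁ :+ x₂) ⇒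
        ⊢ b ≼ con 0)
      (iE G X ∷ iE G Y ∷ E (ind (X ∖ Y)) (ind (Y ∖ X)) ∷ iE G (X ∪ Y) ∷ iE G (X ∩ Y) ∷ iL G X ∷ iL G Y ∷ iL G (X ∪ Y) ∷ iL G (X ∩ Y) ∷
         ∣ X ∣ ∷ ∣ Y ∣ ∷ ∣ X ∪ Y ∣ ∷ ∣ X ∩ Y ∣ ∷ [])
      (eq≥ fX) (eq≥ fY) s∪ s∩ (eq≤ (iE-∪∩ X Y)) (eq≤ (iL-∪∩ X Y)) (2*-mono (eq≥ (card-∪∩ X Y)))

  iL-monoʳ : ∀ X Y → iL G (X ∩ Y) ≤ iL G Y
  iL-monoʳ X Y = subst (iL G (X ∩ Y) ≤_)
    (sym (trans (iL-decomp Y _ _ (ind-splitʳ X Y)) (cong (L (ind (Y ∖ X)) +_) (sym (iL≡ (X ∩ Y))))))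
    (m≤n+m _ _)

  -- The defect 3 of `Y` is paid for by the edge bound on the intersection, which needs two common
  -- vertices. Since the loops of the intersection are among those of `Y`, the union has at least as
  -- many loops as `X`.
  FT-union : ∀ {X Y m} → F X → T Y → 2 ≤ ∣ X ∩ Y ∣ → m ∉ X → m ∉ Y → F (X ∪ Y)
  FT-union {X} {Y} {m} fX tY c p q = ≤-antisym (sparseEL (X ∪ Y) (≢⊤ (∪-out p q))) (linear 13 (λ where
      (e₁ ∷ e₂ ∷ b ∷ e∪ ∷ e∩ ∷ l₁ ∷ l₂ ∷ l∪ ∷ l∩ ∷ x₁ ∷ x₂ ∷ u ∷ m ∷ []) →
        2 :* x₁ ≼ e₁ :+ l₁ ⇒ 2 :* x₂ ≼ e₂ :+ con 3 ⇒ e∩ :+ con 3 ≼ 2 :* m ⇒ l∩ ≼ l₂ ⇒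
        e₁ :+ e₂ :+ b ≼ e∪ :+ e∩ ⇒ l₁ :+ l₂ ≼ l∪ :+ l∩ ⇒ 2 :* (u :+ m) ≼ 2 :* (x₁ :+ x₂) ⇒
        ⊢ 2 :* u ≼ e∪ :+ l∪)
      (iE G X ∷ iE G Y ∷ E (ind (X ∖ Y)) (ind (Y ∖ X)) ∷ iE G (X ∪ Y) ∷ iE G (X ∩ Y) ∷ iL G X ∷ iL G Y ∷ iL G (X ∪ Y) ∷ iL G (X ∩ Y) ∷
         ∣ X ∣ ∷ ∣ Y ∣ ∷ ∣ X ∪ Y ∣ ∷ ∣ X ∩ Y ∣ ∷ [])
      (eq≥ fX) (eq≥ tY) (sparseE (X ∩ Y) c) (iL-monoʳ X Y) (eq≤ (iE-∪∩ X Y)) (eq≤ (iL-∪∩ X Y)) (2*-mono (eq≥ (card-∪∩ X Y))))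

  -- Defects behave like 3 + 3 - 3 here. Only the inequality is kept, as this is all that
  -- `degree-into-T` asks for.
  TT-union : ∀ {X Y} → T X → T Y → 2 ≤ ∣ X ∩ Y ∣ → 2 * ∣ X ∪ Y ∣ ≤ iE G (X ∪ Y) + 3
  TT-union {X} {Y} tX tY c = linear 9 (λ where
      (e₁ ∷ e₂ ∷ b ∷ e∪ ∷ e∩ ∷ x₁ ∷ x₂ ∷ u ∷ m ∷ []) →
        2 :* x₁ ≼ e₁ :+ con 3 ⇒ 2 :* x₂ ≼ e₂ :+ con 3 ⇒ e∩ :+ con 3 ≼ 2 :* m ⇒
        e₁ :+ e₂ :+ b ≼ e∪ :+ e∩ ⇒ 2 :* (u :+ m) ≼ 2 :* (x₁ :+ x₂) ⇒
        ⊢ 2 :* u ≼ e∪ :+ con 3)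
      (iE G X ∷ iE G Y ∷ E (ind (X ∖ Y)) (ind (Y ∖ X)) ∷ iE G (X ∪ Y) ∷ iE G (X ∩ Y) ∷ ∣ X ∣ ∷ ∣ Y ∣ ∷ ∣ X ∪ Y ∣ ∷ ∣ X ∩ Y ∣ ∷ [])
      (eq≥ tX) (eq≥ tY) (sparseE (X ∩ Y) c) (eq≤ (iE-∪∩ X Y)) (2*-mono (eq≥ (card-∪∩ X Y)))

  -- A single common vertex has defect 2, so the union gets 3 + 3 - 2 = 4, one too many to be tight.
  -- An edge from `a` to `b` would run between the two differences and use up the excess; the term
  -- `A a b` keeps both possibilities in one inequality.
  TT-union₁ : ∀ {X Y t a b} → T X → T Y → ind (X ∩ Y) ≗ δ t → a ∈ (X ∖ Y) → b ∈ (Y ∖ X) →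
              2 * ∣ X ∪ Y ∣ + A a b ≤ iE G (X ∪ Y) + 4
  TT-union₁ {X} {Y} {t} {a} {b} tX tY h p q = linear 10 (λ where
      (e₁ ∷ e₂ ∷ b ∷ e∪ ∷ e∩ ∷ x₁ ∷ x₂ ∷ u ∷ m ∷ a ∷ []) →
        2 :* x₁ ≼ e₁ :+ con 3 ⇒ 2 :* x₂ ≼ e₂ :+ con 3 ⇒ e∩ ≼ con 0 ⇒ 2 :* con 1 ≼ 2 :* m ⇒ a ≼ b ⇒
        e₁ :+ e₂ :+ b ≼ e∪ :+ e∩ ⇒ 2 :* (u :+ m) ≼ 2 :* (x₁ :+ x₂) ⇒
        ⊢ 2 :* u :+ a ≼ e∪ :+ con 4)
      (iE G X ∷ iE G Y ∷ E (ind (X ∖ Y)) (ind (Y ∖ X)) ∷ iE G (X ∪ Y) ∷ iE G (X ∩ Y) ∷ ∣ X ∣ ∷ ∣ Y ∣ ∷ ∣ X ∪ Y ∣ ∷ ∣ X ∩ Y ∣ ∷ A a b ∷ [])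
      (eq≥ tX) (eq≥ tY) (eq≤ e0) (2*-mono (eq≥ c1)) (E-pos (X ∖ Y) (Y ∖ X) p q) (eq≤ (iE-∪∩ X Y)) (2*-mono (eq≥ (card-∪∩ X Y)))
    where
    e0 : iE G (X ∩ Y) ≡ 0
    e0 = *-cancelˡ-≡ _ 0 2 (trans (2iE (X ∩ Y)) (trans (E-cong h h) (trans (E-δ t (δ t)) (trans (R-δ t t) (A-irr t)))))
    c1 : ∣ X ∩ Y ∣ ≡ 1
    c1 = trans (card≡ (X ∩ Y)) (trans (dot-cong h (λ _ → refl)) (dot-δ t 𝟙))

  -- The intersection consists of `a` and `b` and has defect 4 less `A a b`, the same as the bound
  -- assumed for `X`. The two cancel, whether or not ab is an edge, and the defect 3 of `Y` remains.
  TT-union₂ : ∀ {X Y a b} → 2 * ∣ X ∣ + A a b ≤ iE G X + 4 → T Y → ind (X ∩ Y) ≗ δ a ⊞ δ b →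
              2 * ∣ X ∪ Y ∣ ≤ iE G (X ∪ Y) + 3
  TT-union₂ {X} {Y} {a} {b} tX tY h = linear 10 (λ where
      (e₁ ∷ e₂ ∷ b ∷ e∪ ∷ e∩ ∷ x₁ ∷ x₂ ∷ u ∷ m ∷ a ∷ []) →
        2 :* x₁ :+ a ≼ e₁ :+ con 4 ⇒ 2 :* x₂ ≼ e₂ :+ con 3 ⇒ e∩ ≼ a ⇒ 2 :* con 2 ≼ 2 :* m ⇒
        e₁ :+ e₂ :+ b ≼ e∪ :+ e∩ ⇒ 2 :* (u :+ m) ≼ 2 :* (x₁ :+ x₂) ⇒
        ⊢ 2 :* u ≼ e∪ :+ con 3)
      (iE G X ∷ iE G Y ∷ E (ind (X ∖ Y)) (ind (Y ∖ X)) ∷ iE G (X ∪ Y) ∷ iE G (X ∩ Y) ∷ ∣ X ∣ ∷ ∣ Y ∣ ∷ ∣ X ∪ Y ∣ ∷ ∣ X ∩ Y ∣ ∷ A a b ∷ [])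
      tX (eq≥ tY) (eq≤ e0) (2*-mono (eq≥ c1)) (eq≤ (iE-∪∩ X Y)) (2*-mono (eq≥ (card-∪∩ X Y)))
    where
    e0 : iE G (X ∩ Y) ≡ A a b
    e0 = iE-pair (X ∩ Y) h
    c1 : ∣ X ∩ Y ∣ ≡ 2
    c1 = card-pair (X ∩ Y) h

  degree-into-T : ∀ {U w i} → i ∈ U → w ∉ U → 2 * ∣ U ∣ ≤ iE G U + 3 → R (ind U) w ≤ 2
  degree-into-T {U} {w} i∈ w∉ h =
    ar (iE G U) (R (ind U) w) (∣ U ∣) h
      (subst₂ (λ a b → a + 3 ≤ 2 * b) (∪₁-E w∉) (card-∪₁ w∉)
        (sparseE (U ∪₁ w) (subst (2 ≤_) (sym (card-∪₁ w∉)) (card-pos i∈ ⊕ ≤-refl {1}))))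
    where
    ar : ∀ e r u → 2 * u ≤ e + 3 → e + r + 3 ≤ 2 * (u + 1) → r ≤ 2
    ar e r u = linear 3 (λ where (e ∷ r ∷ u ∷ []) → 2 :* u ≼ e :+ con 3 ⇒ e :+ r :+ con 3 ≼ 2 :* (u :+ con 1) ⇒ ⊢ r ≼ con 2) (e ∷ r ∷ u ∷ [])

  private
    sparse-∪₁ : ∀ {U w m} → w ∉ U → m ∉ U → m ≢ w →
                (iE G U + R (ind U) w) + (iL G U + loops G w) ≤ 2 * (∣ U ∣ + 1)
    sparse-∪₁ {U} {w} w∉ m∉ m≢w = subst₂ _≤_ (cong₂ _+_ (∪₁-E w∉) (∪₁-L w∉)) (cong (2 *_) (card-∪₁ w∉))
      (sparseEL (U ∪₁ w) (≢⊤ (∪₁-out m∉ m≢w)))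

  -- The vertex `m` is there to keep `U ∪₁ w` proper; adding `w` raises the right-hand side of the
  -- bound by 2.
  degree-into-F : ∀ {U w m} → F U → w ∉ U → m ∉ U → m ≢ w → R (ind U) w + loops G w ≤ 2
  degree-into-F {U} {w} h w∉ m∉ m≢w = ar (iE G U) (iL G U) (R (ind U) w) (loops G w) (∣ U ∣) h (sparse-∪₁ w∉ m∉ m≢w)
    where
    ar : ∀ e l r k u → e + l ≡ 2 * u → e + r + (l + k) ≤ 2 * (u + 1) → r + k ≤ 2
    ar e l r k u p = linear 5 (λ where (e ∷ l ∷ r ∷ k ∷ u ∷ []) → 2 :* u ≼ e :+ l ⇒ e :+ r :+ (l :+ k) ≼ 2 :* (u :+ con 1) ⇒ ⊢ r :+ k ≼ con 2) (e ∷ l ∷ r ∷ k ∷ u ∷ []) (eq≥ p)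

  F-∪₁ : ∀ {U w m} → F U → w ∉ U → m ∉ U → m ≢ w → 2 ≤ R (ind U) w + loops G w → F (U ∪₁ w)
  F-∪₁ {U} {w} h w∉ m∉ m≢w d =
    trans (cong₂ _+_ (∪₁-E w∉) (∪₁-L w∉)) (trans
      (≤-antisym (sparse-∪₁ w∉ m∉ m≢w) (ar (iE G U) (iL G U) (R (ind U) w) (loops G w) (∣ U ∣) h d))
      (sym (cong (2 *_) (card-∪₁ w∉))))
    where
    ar : ∀ e l r k u → e + l ≡ 2 * u → 2 ≤ r + k → 2 * (u + 1) ≤ e + r + (l + k)
    ar e l r k u p = linear 5 (λ where (e ∷ l ∷ r ∷ k ∷ u ∷ []) → 2 :* u ≼ e :+ l ⇒ con 2 ≼ r :+ k ⇒ ⊢ 2 :* (u :+ con 1) ≼ e :+ r :+ (l :+ k)) (e ∷ l ∷ r ∷ k ∷ u ∷ []) (eq≥ p)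

  T-degree : ∀ {Y c j} → T Y → c ∈ Y → j ∈ Y → j ≢ c → 1 ≤ R (ind Y) c
  T-degree {Y} {c} h c∈ j∈ j≢c =
    ar (iE G (Y -₁ c)) (R (ind Y) c) (∣ Y -₁ c ∣) (subst₂ (λ a b → a + 3 ≡ 2 * b) (-₁-E c∈) (card--₁ c∈) h) (sparse₁ (-₁-in j∈ j≢c))
    where
    ar : ∀ e r u → e + r + 3 ≡ 2 * (u + 1) → e + 2 ≤ 2 * u → 1 ≤ r
    ar e r u p = linear 3 (λ where (e ∷ r ∷ u ∷ []) → 2 :* (u :+ con 1) ≼ e :+ r :+ con 3 ⇒ e :+ con 2 ≼ 2 :* u ⇒ ⊢ con 1 ≼ r) (e ∷ r ∷ u ∷ []) (eq≥ p)

  T-neighbour : ∀ {Y c j} → T Y → c ∈ Y → j ∈ Y → j ≢ c → ∃ λ i → i ∈ Y × A c i ≡ 1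
  T-neighbour {Y} {c} h c∈ j∈ j≢c =
    let i , a , p = dot-pos (A c) (ind Y) (T-degree h c∈ j∈ j≢c)
    in i , 1→in Y i p , ≤-antisym (b2n≤1 (adj G c i)) a

  -- If `t` had a neighbour in `Y` other than `c`, then `Y -₁ t` would contain two vertices, and the
  -- edge bound there would force a second edge from `t` into `Y`. So the neighbour given by
  -- `T-neighbour` is `c`.
  T-leaf : ∀ {Y t c} → T Y → t ∈ Y → c ∈ Y → c ≢ t → R (ind Y) t ≤ 1 → A t c ≡ 1
  T-leaf {Y} {t} {c} h t∈ c∈ c≢t r =
    let j , j∈ , a = T-neighbour h t∈ c∈ c≢t in unique j j∈ a (j ≟ c)
    where
    ar : ∀ e r u → e + r + 3 ≡ 2 * (u + 1) → e + 3 ≤ 2 * u → r ≤ 1 → 1 ≤ 0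
    ar e r u p = linear 3 (λ where
      (e ∷ r ∷ u ∷ []) → 2 :* (u :+ con 1) ≼ e :+ r :+ con 3 ⇒ e :+ con 3 ≼ 2 :* u ⇒ r ≼ con 1 ⇒ ⊢ con 1 ≼ con 0)
      (e ∷ r ∷ u ∷ []) (eq≥ p)
    unique : ∀ j → j ∈ Y → A t j ≡ 1 → Dec (j ≡ c) → A t c ≡ 1
    unique j j∈ a (yes refl) = a
    unique j j∈ a (no j≢c)   = ⊥-elim (n≮0 (ar (iE G (Y -₁ t)) (R (ind Y) t) (∣ Y -₁ t ∣)
        (subst₂ (λ a b → a + 3 ≡ 2 * b) (-₁-E t∈) (card--₁ t∈) h)
        (sparseE (Y -₁ t) (card-pos-2 (-₁-in j∈ j≢t) (-₁-in c∈ c≢t) j≢c)) r))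
      where
      j≢t : j ≢ t
      j≢t refl = 0≢1+n (trans (sym (A-irr t)) a)

-- Deleting a vertex

del : Fin (suc n) → LGraph (suc n) → LGraph n
del w G = record
  { adj   = λ i j → adj G (punchIn w i) (punchIn w j)
  ; loops = λ i → loops G (punchIn w i) }

del-looped : (w : Fin (suc n)) {G : LGraph (suc n)} → IsLoopedSimple G → IsLoopedSimple (del w G)
del-looped w ls = record
  { adj-sym    = λ i j → adj-sym ls (punchIn w i) (punchIn w j)
  ; adj-irrefl = λ i → adj-irrefl ls (punchIn w i) }

row : LGraph (suc n) → Fin (suc n) → Fin n → ℕ
row G w j = b2n (adj G w (punchIn w j))

ins : Fin (suc n) → Bool → Subset n → Subset (suc n)
ins w b X = insertAt X w b

ind-ins : (w : Fin (suc n)) (b : Bool) (X : Subset n) → ind (ins w b X) ∘ punchIn w ≗ ind X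
ind-ins w b X j = cong b2n (insertAt-punchIn X w b j)

ins-self : (w : Fin (suc n)) (X : Subset n) → w ∉ ins w false X
ins-self w X = mem (insertAt-lookup X w false)

ins-in : {w : Fin (suc n)} {b : Bool} {X : Subset n} {i : Fin n} → i ∈ X → punchIn w i ∈ ins w b X
ins-in {w = w} {b} {X} {i} (mem p) = mem (trans (insertAt-punchIn X w b i) p)

ins-out : {w : Fin (suc n)} {b : Bool} {X : Subset n} {i : Fin n} → i ∉ X → punchIn w i ∉ ins w b X
ins-out {w = w} {b} {X} {i} (mem p) = mem (trans (insertAt-punchIn X w b i) p)

ins-⊤ : (w : Fin (suc n)) → ins w true ⊤ ≡ ⊤
ins-⊤ zero = refl
ins-⊤ {suc n} (suc w) = cong (true ∷_) (ins-⊤ w)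

ins-card : (w : Fin (suc n)) (b : Bool) (X : Subset n) → ∣ ins w b X ∣ ≡ b2n b + ∣ X ∣
ins-card w b X = trans (card≡ (ins w b X)) (trans (dot-punchIn (ind (ins w b X)) 𝟙 w)
  (cong₂ _+_ (trans (*-identityʳ _) (cong b2n (insertAt-lookup X w b)))
             (trans (dot-cong (ind-ins w b X) (λ _ → refl)) (sym (card≡ X)))))

module Del {n : ℕ} (G : LGraph (suc n)) (ls : IsLoopedSimple G) (w : Fin (suc n)) where
  private
    module G = Count G ls
    module K = Count (del w G) (del-looped w ls)

  R-ins-self : ∀ b X → G.R (ind (ins w b X)) w ≡ dot (row G w) (ind X)
  R-ins-self b X = trans (dot-punchIn (G.A w) (ind (ins w b X)) w)
    (cong₂ _+_ (cong (_* ind (ins w b X) w) (G.A-irr w)) (dot-cong (λ _ → refl) (ind-ins w b X)))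

  iL-ins : ∀ b X → iL G (ins w b X) ≡ iL (del w G) X + b2n b * loops G w
  iL-ins b X = trans (G.iL≡ (ins w b X)) (trans (dot-punchIn (ind (ins w b X)) (loops G) w)
    (trans (cong₂ _+_ (cong (λ z → b2n z * loops G w) (insertAt-lookup X w b))
                      (trans (dot-cong (ind-ins w b X) (λ _ → refl)) (sym (K.iL≡ X))))
           (+-comm (b2n b * loops G w) _)))

  iE-ins : ∀ b X → iE G (ins w b X) ≡ iE (del w G) X + b2n b * dot (row G w) (ind X)
  iE-ins b X = *-cancelˡ-≡ _ _ 2 (begin
    2 * iE G Y                                        ≡⟨ G.2iE Y ⟩
    G.E y y                                           ≡⟨ dot-punchIn y (G.R y) w ⟩
    y w * G.R y w + dot (y ∘ punchIn w) (G.R y ∘ punchIn w)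
      ≡⟨ cong₂ _+_ (cong₂ _*_ yw (R-ins-self b X)) (trans (dot-cong (ind-ins w b X) rows) (dot-⊞ʳ x (λ i → row G w i * β) (K.R x))) ⟩
    β * r + (dot x (λ i → row G w i * β) + K.E x x)   ≡⟨ cong₂ (λ p q → β * r + (p + q)) scale (sym (K.2iE X)) ⟩
    β * r + (β * r + 2 * iE (del w G) X)              ≡⟨ collect (β * r) (iE (del w G) X) ⟩
    2 * (iE (del w G) X + β * r)                      ∎)
    where
    open ≡-Reasoning
    Y = ins w b X
    y = ind Y
    x = ind X
    β = b2n b
    r = dot (row G w) x
    yw : y w ≡ β
    yw = cong b2n (insertAt-lookup X w b)
    rows : ∀ i → G.R y (punchIn w i) ≡ row G w i * β + K.R x i
    rows i = trans (dot-punchIn (G.A (punchIn w i)) y w)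
      (cong₂ _+_ (cong₂ _*_ (G.A-sym (punchIn w i) w) yw) (dot-cong (λ _ → refl) (ind-ins w b X)))
    scale : dot x (λ i → row G w i * β) ≡ β * r
    scale = trans (dot≡ _ _) (trans (Sum-cong (λ i → shuffle (x i) (row G w i) β))
      (trans (sym (*-Sum β (λ i → row G w i * x i))) (cong (β *_) (sym (dot≡ _ _)))))
      where
      shuffle : ∀ a b c → a * (b * c) ≡ c * (b * a)
      shuffle a b c = trans (*-comm a (b * c)) (trans (cong (_* a) (*-comm b c)) (*-assoc c b a))
    collect : ∀ a b → a + (a + 2 * b) ≡ 2 * (b + a)
    collect a b = trans (sym (+-assoc a a (2 * b))) (trans (cong₂ _+_ (cong (a +_) (sym (+-identityʳ a))) refl)
      (trans (+-comm (2 * a) (2 * b)) (sym (*-distribˡ-+ 2 b a))))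

-- Deleting and adding edges and loops

iE-cong : {G H : LGraph n} → (∀ i j → adj G i j ≡ adj H i j) → ∀ X → iE G X ≡ iE H X
iE-cong {G = G} {H} h X = trans (sumFin≡ _) (trans (Sum-cong λ i →
    trans (sumFin≡ _) (trans (Sum-cong λ j → cong (λ z → b2n (does (i <? j) ∧ lookup X i ∧ lookup X j ∧ z)) (h i j)) (sym (sumFin≡ _))))
  (sym (sumFin≡ _)))

b2n-∨∧ : {n : ℕ} {u v : Fin n} → u ≢ v → ∀ i j →
         b2n ((i == u ∧ j == v) ∨ (i == v ∧ j == u)) ≡ δ u i * δ v j + δ v i * δ u j
b2n-∨∧ {u = u} {v} u≢v i j with i ≟ u
... | no _ = b2n-∧ (i == v) (j == u)
  where
  b2n-∧ : ∀ a b → b2n (a ∧ b) ≡ b2n a * b2n b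
  b2n-∧ true  b = sym (+-identityʳ _)
  b2n-∧ false b = refl
... | yes refl rewrite ==-≢ u≢v with j == v
...   | true  = refl
...   | false = refl

module EdgeDeletion {n : ℕ} (G : LGraph n) (ls : IsLoopedSimple G)
                    {u v : Fin n} (uv : adj G u v ≡ true) where
  u≢v : u ≢ v
  u≢v refl with () ← trans (sym uv) (adj-irrefl ls u)

  deleteEdge-looped : IsLoopedSimple (deleteEdge G u v)
  deleteEdge-looped = record
    { adj-sym    = λ i j → cong₂ (λ a b → a ∧ not b) (adj-sym ls i j)
        (trans (∨-comm (i == u ∧ j == v) (i == v ∧ j == u)) (cong₂ _∨_ (∧-comm (i == v) (j == u)) (∧-comm (i == u) (j == v))))
    ; adj-irrefl = λ i → cong (_∧ not ((i == u ∧ i == v) ∨ (i == v ∧ i == u))) (adj-irrefl ls i) }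

  private
    module G = Count G ls
    module D = Count (deleteEdge G u v) deleteEdge-looped

    entries : ∀ i j → G.A i j ≡ D.A i j + (δ u i * δ v j + δ v i * δ u j)
    entries i j = trans (aux (adj G i j) e hit) (cong (D.A i j +_) (b2n-∨∧ u≢v i j))
      where
      e = (i == u ∧ j == v) ∨ (i == v ∧ j == u)
      hit : e ≡ true → adj G i j ≡ true
      hit p with i ≟ u | j ≟ v
      ... | yes refl | yes refl = uv
      ... | yes refl | no _ with u ≟ v
      ...   | yes q = ⊥-elim (u≢v q)
      hit () | yes refl | no _ | no _
      hit p | no _ | q with i ≟ v | j ≟ u
      ...   | yes refl | yes refl = trans (adj-sym ls v u) uv
      aux : ∀ a e → (e ≡ true → a ≡ true) → b2n a ≡ b2n (a ∧ not e) + b2n e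
      aux true  true  h = refl
      aux true  false h = refl
      aux false true  h with () ← h refl
      aux false false h = refl

  iE-deleteEdge : ∀ X → iE G X ≡ iE (deleteEdge G u v) X + ind X u * ind X v
  iE-deleteEdge X = *-cancelˡ-≡ _ _ 2 (begin
    2 * iE G X                                    ≡⟨ G.2iE X ⟩
    dot x (G.R x)                                 ≡⟨ dot-cong {a = x} (λ _ → refl) rows ⟩
    dot x (D.R x ⊞ s)                             ≡⟨ dot-⊞ʳ x (D.R x) s ⟩
    D.E x x + dot x s                             ≡⟨ cong₂ _+_ (sym (D.2iE X)) total ⟩
    2 * iE (deleteEdge G u v) X + (x u * x v + x v * x u)
      ≡⟨ cong (λ z → 2 * iE (deleteEdge G u v) X + (x u * x v + z)) (trans (*-comm (x v) (x u)) (sym (+-identityʳ _))) ⟩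
    2 * iE (deleteEdge G u v) X + 2 * (x u * x v) ≡⟨ sym (*-distribˡ-+ 2 (iE (deleteEdge G u v) X) _) ⟩
    2 * (iE (deleteEdge G u v) X + x u * x v)     ∎)
    where
    open ≡-Reasoning
    x = ind X
    scaled : Fin n → ℕ → Fin n → ℕ
    scaled a k i = δ a i * k
    s = scaled u (x v) ⊞ scaled v (x u)
    dot-scaled : ∀ a k (b : Fin n → ℕ) → dot (scaled a k) b ≡ b a * k
    dot-scaled a k b = trans (dot≡ _ _) (trans (Sum-cong λ i → trans (*-assoc (δ a i) k (b i)) (cong (δ a i *_) (*-comm k (b i))))
      (trans (sym (dot≡ (δ a) (λ i → b i * k))) (dot-δ a (λ i → b i * k))))
    rows : ∀ i → G.R x i ≡ (D.R x ⊞ s) i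
    rows i = trans (dot-cong (entries i) (λ _ → refl)) (trans (dot-⊞ˡ (D.A i) (λ j → δ u i * δ v j + δ v i * δ u j) x)
      (cong (D.R x i +_) (trans (dot-⊞ˡ (λ j → δ u i * δ v j) (λ j → δ v i * δ u j) x)
        (cong₂ _+_ (side (δ u i) v) (side (δ v i) u)))))
      where
      side : ∀ k a → dot (λ j → k * δ a j) x ≡ k * x a
      side k a = trans (dot-cong (λ j → *-comm k (δ a j)) (λ _ → refl)) (trans (dot-scaled a k x) (*-comm (x a) k))
    total : dot x s ≡ x u * x v + x v * x u
    total = trans (dot-comm x s) (trans (dot-⊞ˡ (scaled u (x v)) (scaled v (x u)) x)
      (cong₂ _+_ (dot-scaled u (x v) x) (dot-scaled v (x u) x)))

iL-loops : {G H : LGraph n} {u : Fin n} → (∀ i → loops G i ≡ loops H i + δ u i) →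
           ∀ X → iL G X ≡ iL H X + ind X u
iL-loops {G = G} {H} {u} h X = trans (sumFin≡ _) (trans (Sum-cong pt) (trans (Sum-+ _ _)
  (cong₂ _+_ (sym (sumFin≡ _)) (trans (sym (dot≡ (δ u) (ind X))) (dot-δ u (ind X))))))
  where
  pt : ∀ i → (if lookup X i then loops G i else 0) ≡ (if lookup X i then loops H i else 0) + δ u i * ind X i
  pt i with lookup X i
  ... | true  = trans (h i) (cong (loops H i +_) (sym (*-identityʳ _)))
  ... | false = sym (*-zeroʳ (δ u i))

addEdge : LGraph n → Fin n → Fin n → LGraph n
addEdge G u v = record
  { adj   = λ i j → adj G i j ∨ ((i == u ∧ j == v) ∨ (i == v ∧ j == u))
  ; loops = loops G }

addLoop : LGraph n → Fin n → LGraph n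
addLoop G u = record
  { adj   = adj G
  ; loops = λ i → loops G i + δ u i }

module EdgeAddition {n : ℕ} (G : LGraph n) (ls : IsLoopedSimple G)
                    {u v : Fin n} (u≢v : u ≢ v) (¬uv : adj G u v ≡ false) where

  addEdge-looped : IsLoopedSimple (addEdge G u v)
  addEdge-looped = record
    { adj-sym    = λ i j → cong₂ _∨_ (adj-sym ls i j)
        (trans (∨-comm (i == u ∧ j == v) (i == v ∧ j == u)) (cong₂ _∨_ (∧-comm (i == v) (j == u)) (∧-comm (i == u) (j == v))))
    ; adj-irrefl = λ i → cong₂ _∨_ (adj-irrefl ls i) (diag i) }
    where
    diag : ∀ i → (i == u ∧ i == v) ∨ (i == v ∧ i == u) ≡ false
    diag i with i ≟ u | i ≟ v
    ... | yes refl | yes p = ⊥-elim (u≢v p)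
    ... | yes _    | no _  = refl
    ... | no _     | yes _ = refl
    ... | no _     | no _  = refl

  addEdge-adj : adj (addEdge G u v) u v ≡ true
  addEdge-adj rewrite ==-refl u | ==-refl v = ∨-zeroʳ _

  delete-add : ∀ i j → adj (deleteEdge (addEdge G u v) u v) i j ≡ adj G i j
  delete-add i j = aux (adj G i j) _ miss
    where
    miss : (i == u ∧ j == v) ∨ (i == v ∧ j == u) ≡ true → adj G i j ≡ false
    miss p with i ≟ u | j ≟ v
    ... | yes refl | yes refl = ¬uv
    ... | yes refl | no _ with u ≟ v
    ...   | yes q = ⊥-elim (u≢v q)
    miss () | yes refl | no _ | no _
    miss p | no _ | q with i ≟ v | j ≟ u
    ...   | yes refl | yes refl = trans (adj-sym ls v u) ¬uv
    aux : ∀ a e → (e ≡ true → a ≡ false) → (a ∨ e) ∧ not e ≡ a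
    aux true  true  h = sym (h refl)
    aux true  false h = refl
    aux false true  h = refl
    aux false false h = refl

  iE-addEdge : ∀ X → iE (addEdge G u v) X ≡ iE G X + ind X u * ind X v
  iE-addEdge X = trans (EdgeDeletion.iE-deleteEdge (addEdge G u v) addEdge-looped addEdge-adj X)
    (cong (_+ ind X u * ind X v) (iE-cong {G = deleteEdge (addEdge G u v) u v} {G} delete-add X))

bool-+₂ : ∀ a x y → b2n a ≡ b2n x + b2n y → a ≡ x ∨ y
bool-+₂ true  true  false _ = refl
bool-+₂ true  false true  _ = refl
bool-+₂ false false false _ = refl

bool-+₃ : ∀ a x y z → b2n a ≡ b2n x + b2n y + b2n z → a ≡ x ∨ y ∨ z
bool-+₃ true  true  false false _ = refl
bool-+₃ true  false true  false _ = refl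
bool-+₃ true  false false true  _ = refl
bool-+₃ false false false false _ = refl

bool-+₁ : ∀ a x → b2n a ≡ b2n x → a ≡ x
bool-+₁ true  true  _ = refl
bool-+₁ false false _ = refl

-- Isomorphisms

≐→≅ : {G H : LGraph n} → (∀ i j → adj H i j ≡ adj G i j) → (∀ i → loops H i ≡ loops G i) → G ≅ H
≐→≅ p q = record { σ = Perm.id ; pres-adj = p ; pres-loops = q }

addVertex-≅ : {G : LGraph (suc n)} {H : LGraph n} → IsLoopedSimple G → (w : Fin (suc n)) →
  (H≅ : H ≅ del w G) (nbr : Fin n → Bool) (k : ℕ) →
  (∀ j → nbr j ≡ adj G w (punchIn w (_≅_.σ H≅ ⟨$⟩ʳ j))) → k ≡ loops G w → addVertex H nbr k ≅ G
addVertex-≅ {n = n} {G = G} {H} ls w H≅ nbr k p q = record { σ = τ ; pres-adj = a ; pres-loops = l }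
  where
  open _≅_ H≅
  τ = insert zero w σ
  a : ∀ i j → adj G (τ ⟨$⟩ʳ i) (τ ⟨$⟩ʳ j) ≡ adj (addVertex H nbr k) i j
  a zero    zero    = adj-irrefl ls w
  a zero    (suc j) = sym (p j)
  a (suc i) zero    = trans (adj-sym ls _ w) (sym (p i))
  a (suc i) (suc j) = pres-adj i j
  l : ∀ i → loops G (τ ⟨$⟩ʳ i) ≡ loops (addVertex H nbr k) i
  l zero    = sym q
  l (suc i) = pres-loops i

-- Inverse operations

-- One step of the induction. The order of `H` is only required to be smaller, because undoing a
-- K4-extension removes two vertices.
Reducible : {n : ℕ} → LGraph n → Set
Reducible {n} G = Σ ℕ λ m → m < n × Σ (LGraph m) λ H →
  IsLoopedSimple H × RigidCircuit H × (Constructible H → Constructible G)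

≤∧≢⇒+1≤ : ∀ {a b} → a ≤ b → a ≢ b → a + 1 ≤ b
≤∧≢⇒+1≤ {a} {b} p q = subst (_≤ b) (+-comm 1 a) (≤∧≢⇒< p q)

-- Undoing a 1-extension

module Reduce {n : ℕ} (G : LGraph (suc n)) (ls : IsLoopedSimple G) (rc : RigidCircuit G) (w : Fin (suc n)) where
  open Tightness G ls rc
  open Del G ls w

  private
    K : LGraph n
    K = del w G
    lsK = del-looped w ls
    lift = ins w false

  iE-lift : ∀ X → iE G (lift X) ≡ iE K X
  iE-lift X = trans (iE-ins false X) (+-identityʳ _)

  iL-lift : ∀ X → iL G (lift X) ≡ iL K X
  iL-lift X = trans (iL-ins false X) (+-identityʳ _)

  count-del : dot (row G w) (ind ⊤) + loops G w ≡ 3 → iE K ⊤ + iL K ⊤ ≡ 2 * n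
  count-del d = +-cancelʳ-≡ 3 _ _ (begin
    iE K ⊤ + iL K ⊤ + 3                              ≡⟨ cong (iE K ⊤ + iL K ⊤ +_) (sym d) ⟩
    iE K ⊤ + iL K ⊤ + (r + loops G w)                ≡⟨ interchange (iE K ⊤) (iL K ⊤) r (loops G w) ⟩
    (iE K ⊤ + r) + (iL K ⊤ + loops G w)
      ≡⟨ sym (cong₂ _+_ (trans (iE-ins true ⊤) (cong (iE K ⊤ +_) (*-identityˡ r))) (trans (iL-ins true ⊤) (cong (iL K ⊤ +_) (*-identityˡ _)))) ⟩
    iE G (ins w true ⊤) + iL G (ins w true ⊤)        ≡⟨ cong (λ Z → iE G Z + iL G Z) (ins-⊤ w) ⟩
    nE G + nL G                                      ≡⟨ count ⟩
    2 * suc n + 1                                    ≡⟨ cong (_+ 1) (*-suc 2 n) ⟩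
    2 + 2 * n + 1                                    ≡⟨ trans (+-assoc 2 (2 * n) 1) (trans (+-comm 2 (2 * n + 1)) (+-assoc (2 * n) 1 2)) ⟩
    2 * n + 3                                        ∎)
    where
    open ≡-Reasoning
    r = dot (row G w) (ind ⊤)

  -- The function `ζ` counts the added edge or loop inside a set. Removing `w` leaves 2n edges and
  -- loops on n vertices, so the one added restores the count, and it exceeds the joint bound only
  -- on a set that was already tight.
  rigid-reduced : (H : LGraph n) (ζ : Subset n → ℕ) →
    dot (row G w) (ind ⊤) + loops G w ≡ 3 → ζ ⊤ ≡ 1 →
    (∀ X → iE H X + iL H X ≡ iE K X + iL K X + ζ X) →
    (∀ X → 2 ≤ ∣ X ∣ → iE H X + 3 ≤ 2 * ∣ X ∣) →
    (∀ X i → i ∉ X → ζ X ≡ 0 ⊎ (ζ X ≡ 1 × ¬ F (lift X))) →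
    RigidCircuit H
  rigid-reduced H ζ d ζ⊤ eq sE sEL = record
    { count    = trans (eq ⊤) (cong₂ _+_ (count-del d) ζ⊤)
    ; sparseE  = sE
    ; sparseEL = λ X X≢⊤ → bound X (Full⊎missing X) X≢⊤ }
    where
    old : ∀ X → iE K X + iL K X ≤ 2 * ∣ X ∣
    old X = subst₂ _≤_ (cong₂ _+_ (iE-lift X) (iL-lift X)) (cong (2 *_) (ins-card w false X))
      (sparseEL (lift X) (≢⊤ (ins-self w X)))
    bound : ∀ X → X ≡ ⊤ ⊎ (∃ λ i → i ∉ X) → X ≢ ⊤ → iE H X + iL H X ≤ 2 * ∣ X ∣
    bound X (inj₁ p) q = ⊥-elim (q p)
    bound X (inj₂ (i , i∉)) q with sEL X i i∉
    ... | inj₁ z = ≤-trans (≤-reflexive (trans (eq X) (trans (cong (iE K X + iL K X +_) z) (+-identityʳ _)))) (old X)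
    ... | inj₂ (z , ¬f) = ≤-trans (≤-reflexive (trans (eq X) (cong (iE K X + iL K X +_) z)))
      (≤∧≢⇒+1≤ (old X) λ f → ¬f (trans (cong₂ _+_ (iE-lift X) (iL-lift X)) (trans f (cong (2 *_) (sym (ins-card w false X))))))

  sparseE-K : ∀ X → 2 ≤ ∣ X ∣ → iE K X + 3 ≤ 2 * ∣ X ∣
  sparseE-K X h = subst₂ (λ a b → a + 3 ≤ 2 * b) (iE-lift X) (ins-card w false X)
    (sparseE (lift X) (subst (2 ≤_) (sym (ins-card w false X)) h))

  deg-lift : ∀ {X i} → i ∉ X → F (lift X) → dot (row G w) (ind X) + loops G w ≤ 2
  deg-lift {X} {i} i∉ f = subst (λ z → z + loops G w ≤ 2) (R-ins-self false X)
    (degree-into-F f (ins-self w X) (ins-out i∉) (punchInᵢ≢i w i))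

  module EdgeCase {c t q : Fin n} (l0 : loops G w ≡ 0) (nb : row G w ≗ δ c ⊞ δ t ⊞ δ q)
    (¬T : ∀ Y → T Y → punchIn w c ∈ Y → punchIn w t ∈ Y → w ∉ Y → ⊥)
    (¬F : ∀ Y → F Y → punchIn w c ∈ Y → punchIn w t ∈ Y → punchIn w q ∉ Y → w ∉ Y → ⊥) where

    private
      row≡ : ∀ (b : Fin n → ℕ) → dot (row G w) b ≡ b c + b t + b q
      row≡ b = trans (dot-cong nb (λ _ → refl)) (trans (dot-⊞ˡ (δ c ⊞ δ t) (δ q) b)
        (cong₂ _+_ (trans (dot-⊞ˡ (δ c) (δ t) b) (cong₂ _+_ (dot-δ c b) (dot-δ t b))) (dot-δ q b)))
      le1 : ∀ j → δ c j + δ t j + δ q j ≤ 1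
      le1 j = subst (_≤ 1) (nb j) (b2n≤1 _)
      c≢t : c ≢ t
      c≢t refl = n≮n 1 (≤-trans (≤-trans (≤-reflexive (sym (cong₂ _+_ (δ-self c) (δ-self c)))) (m≤m+n _ _)) (le1 c))
      q≢c : q ≢ c
      q≢c refl = n≮n 1 (≤-trans (≤-trans (≤-reflexive (sym (cong₂ _+_ (δ-self q) (δ-self q)))) (+-monoˡ-≤ (δ q q) (m≤m+n _ _))) (le1 q))
      q≢t : q ≢ t
      q≢t refl = n≮n 1 (≤-trans (≤-trans (≤-reflexive (sym (cong₂ _+_ (δ-self q) (δ-self q)))) (+-monoˡ-≤ (δ q q) (m≤n+m _ _))) (le1 q))
      pI-≢ : ∀ {i j} → i ≢ j → punchIn w i ≢ punchIn w j
      pI-≢ p = p ∘ punchIn-injective w _ _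
      -- An edge ct would make the pair itself tight for edges, 1 + 3 = 2 · 2. So the absence of
      -- blocking sets also excludes a parallel edge.
      ¬ct : adj K c t ≡ false
      ¬ct = non (adj K c t) refl
        where
        P = pair (punchIn w c) (punchIn w t)
        hP = ind-pair (pI-≢ c≢t)
        non : ∀ b → adj K c t ≡ b → b ≡ false
        non false _ = refl
        non true  p = ⊥-elim (¬T P (trans (cong (_+ 3) (trans (iE-pair P {punchIn w c} {punchIn w t} hP) (cong b2n p))) (sym (cong (2 *_) (card-pair P {punchIn w c} {punchIn w t} hP))))
          (pair-inˡ (punchIn w c) (punchIn w t)) (pair-inʳ (punchIn w c) (punchIn w t)) (pair-out (punchInᵢ≢i w c ∘ sym) (punchInᵢ≢i w t ∘ sym)))
      H = addEdge K c t
      module EA = EdgeAddition K lsK c≢t ¬ct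
      ζ : Subset n → ℕ
      ζ X = ind X c * ind X t
      both : ∀ X → (c ∈ X × t ∈ X × ζ X ≡ 1) ⊎ ζ X ≡ 0
      both X with c ∈? X | t ∈? X
      ... | inj₁ p | inj₁ r = inj₁ (p , r , cong₂ _*_ (in→1 p) (in→1 r))
      ... | inj₁ p | inj₂ r = inj₂ (trans (cong (ind X c *_) (out→0 r)) (*-zeroʳ (ind X c)))
      ... | inj₂ p | _      = inj₂ (cong (_* ind X t) (out→0 p))

      rcH : RigidCircuit H
      rcH = rigid-reduced H ζ
        (trans (cong₂ _+_ (row≡ (ind ⊤)) l0) (cong₂ (λ a b → a + b + 0) (cong₂ _+_ (ind-⊤ c) (ind-⊤ t)) (ind-⊤ q)))
        (cong₂ _*_ (ind-⊤ c) (ind-⊤ t))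
        (λ X → trans (cong (_+ iL K X) (EA.iE-addEdge X)) (trans (+-assoc (iE K X) (ζ X) _) (trans (cong (iE K X +_) (+-comm (ζ X) _)) (sym (+-assoc (iE K X) _ _)))))
        (λ X h → sE X h (both X))
        (λ X i i∉ → sEL X i i∉ (both X))
        where
        sE : ∀ X → 2 ≤ ∣ X ∣ → (c ∈ X × t ∈ X × ζ X ≡ 1) ⊎ ζ X ≡ 0 → iE H X + 3 ≤ 2 * ∣ X ∣
        sE X h (inj₂ z) = subst (λ a → a + 3 ≤ 2 * ∣ X ∣) (sym (trans (EA.iE-addEdge X) (trans (cong (iE K X +_) z) (+-identityʳ _)))) (sparseE-K X h)
        sE X h (inj₁ (c∈ , t∈ , z)) = subst (_≤ 2 * ∣ X ∣) (trans (trans (+-assoc (iE K X) 3 1) (sym (+-assoc (iE K X) 1 3))) (cong (_+ 3) (sym (trans (EA.iE-addEdge X) (cong (iE K X +_) z)))))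
          (≤∧≢⇒+1≤ (sparseE-K X h) λ e → ¬T (lift X) (trans (cong (_+ 3) (iE-lift X)) (trans e (cong (2 *_) (sym (ins-card w false X))))) (ins-in c∈) (ins-in t∈) (ins-self w X))
        sEL : ∀ X i → i ∉ X → (c ∈ X × t ∈ X × ζ X ≡ 1) ⊎ ζ X ≡ 0 → ζ X ≡ 0 ⊎ (ζ X ≡ 1 × ¬ F (lift X))
        sEL X i i∉ (inj₂ z) = inj₁ z
        sEL X i i∉ (inj₁ (c∈ , t∈ , z)) = inj₂ (z , λ f → no-F f (q ∈? X))
          where
          no-F : F (lift X) → q ∈ X ⊎ q ∉ X → ⊥
          no-F f (inj₂ q∉) = ¬F (lift X) f (ins-in c∈) (ins-in t∈) (ins-out q∉) (ins-self w X)
          -- Here `w` would send three edges into a tight set that misses another vertex besides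
          -- `w`.
          no-F f (inj₁ q∈) = n≮n 2 (subst (_≤ 2) (trans (cong₂ _+_ (row≡ (ind X)) l0) (cong₂ (λ a b → a + b + 0) (cong₂ _+_ (in→1 c∈) (in→1 t∈)) (in→1 q∈))) (deg-lift i∉ f))

    reduce-edge : Reducible G
    reduce-edge = n , ≤-refl , H , EA.addEdge-looped , rcH , λ built → iso (e-ee c t q built EA.addEdge-adj q≢c q≢t)
      (addVertex-≅ ls w (≐→≅ (λ i j → sym (EA.delete-add i j)) (λ _ → refl)) _ 0
        (λ j → sym (bool-+₃ _ (j == c) (j == t) (j == q) (nb j))) (sym l0))

  module LoopCase {t : Fin n} (d : dot (row G w) (ind ⊤) + loops G w ≡ 3)
    (¬F : ∀ X i → i ∉ X → t ∈ X → ¬ F (lift X)) where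

    reduced : LGraph n
    reduced = addLoop K t

    reduced-looped : IsLoopedSimple reduced
    reduced-looped = record { adj-sym = adj-sym lsK ; adj-irrefl = adj-irrefl lsK }

    reduced-rigid : RigidCircuit reduced
    reduced-rigid = rigid-reduced reduced (λ X → ind X t) d (ind-⊤ t)
      (λ X → trans (cong₂ _+_ (iE-cong {G = reduced} {K} (λ _ _ → refl) X) (iL-loops {G = reduced} {K} (λ _ → refl) X)) (sym (+-assoc (iE K X) _ _)))
      (λ X h → subst (λ a → a + 3 ≤ 2 * ∣ X ∣) (iE-cong {G = K} {reduced} (λ _ _ → refl) X) (sparseE-K X h))
      (λ X i i∉ → sEL X i i∉ (t ∈? X))
      where
      sEL : ∀ X i → i ∉ X → t ∈ X ⊎ t ∉ X → ind X t ≡ 0 ⊎ (ind X t ≡ 1 × ¬ F (lift X))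
      sEL X i i∉ (inj₁ t∈) = inj₂ (in→1 t∈ , ¬F X i i∉ t∈)
      sEL X i i∉ (inj₂ t∉) = inj₁ (out→0 t∉)

    loop-present : 1 ≤ loops reduced t
    loop-present = ≤-trans (≤-reflexive (sym (δ-self t))) (m≤n+m _ _)

    delete-≅ : deleteLoop reduced t ≅ K
    delete-≅ = ≐→≅ (λ _ _ → refl) l
      where
      l : ∀ i → loops K i ≡ (if i == t then loops K i + δ t i ∸ 1 else loops K i + δ t i)
      l i with i ≟ t
      ... | yes _ = sym (m+n∸n≡m (loops K i) 1)
      ... | no  _ = sym (+-identityʳ _)

  reduce-loop-edge : {t q : Fin n} → loops G w ≡ 1 → row G w ≗ δ t ⊞ δ q →
    (∀ Y → F Y → punchIn w t ∈ Y → punchIn w q ∉ Y → w ∉ Y → ⊥) → Reducible G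
  reduce-loop-edge {t} {q} l1 nb ¬F = n , ≤-refl , LC.reduced , LC.reduced-looped , LC.reduced-rigid , λ built →
    iso (e-le t q built LC.loop-present q≢t)
      (addVertex-≅ ls w LC.delete-≅ _ 1 (λ j → sym (bool-+₂ _ (j == t) (j == q) (nb j))) (sym l1))
    where
    row≡ : ∀ (b : Fin n → ℕ) → dot (row G w) b ≡ b t + b q
    row≡ b = trans (dot-cong nb (λ _ → refl)) (trans (dot-⊞ˡ (δ t) (δ q) b) (cong₂ _+_ (dot-δ t b) (dot-δ q b)))
    q≢t : q ≢ t
    q≢t refl = n≮n 1 (≤-trans (≤-reflexive (sym (cong₂ _+_ (δ-self q) (δ-self q)))) (subst (_≤ 1) (nb q) (b2n≤1 _)))
    no-F : ∀ X i → i ∉ X → t ∈ X → q ∈ X ⊎ q ∉ X → ¬ F (lift X)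
    no-F X i i∉ t∈ (inj₂ q∉) f = ¬F (lift X) f (ins-in t∈) (ins-out q∉) (ins-self w X)
    no-F X i i∉ t∈ (inj₁ q∈) f = n≮n 2 (subst (_≤ 2) (cong₂ _+_ (trans (row≡ (ind X)) (cong₂ _+_ (in→1 t∈) (in→1 q∈))) l1) (deg-lift i∉ f))
    module LC = LoopCase {t} (cong₂ _+_ (trans (row≡ (ind ⊤)) (cong₂ _+_ (ind-⊤ t) (ind-⊤ q))) l1)
      (λ X i i∉ t∈ → no-F X i i∉ t∈ (q ∈? X))

  -- Nothing can block this reduction: the neighbour and the two loops of `w` already exceed the
  -- bound 2 that a tight set containing `u` would impose.
  reduce-loop-loop : {u : Fin n} → loops G w ≡ 2 → row G w ≗ δ u → Reducible G
  reduce-loop-loop {u} l2 nb = n , ≤-refl , LC.reduced , LC.reduced-looped , LC.reduced-rigid , λ built →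
    iso (e-ll u built LC.loop-present)
      (addVertex-≅ ls w LC.delete-≅ _ 2 (λ j → sym (bool-+₁ _ (j == u) (nb j))) (sym l2))
    where
    row≡ : ∀ (b : Fin n → ℕ) → dot (row G w) b ≡ b u
    row≡ b = trans (dot-cong nb (λ _ → refl)) (dot-δ u b)
    module LC = LoopCase {u} (cong₂ _+_ (trans (row≡ (ind ⊤)) (ind-⊤ u)) l2)
      (λ X i i∉ u∈ f → n≮n 2 (subst (_≤ 2) (cong₂ _+_ (trans (row≡ (ind X)) (in→1 u∈)) l2) (deg-lift i∉ f)))

-- Undoing a K4-extension

module ReduceK4 {n : ℕ} (G : LGraph (suc (suc n))) (ls : IsLoopedSimple G) (rc : RigidCircuit G)
  (w : Fin (suc (suc n))) (t : Fin (suc n)) (u v : Fin n)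
  (wt : row G w t ≡ 1) (nw : row G w ∘ punchIn t ≗ δ u ⊞ δ v) (nt : row (del w G) t ≗ δ u ⊞ δ v)
  (lw : loops G w ≡ 0) (lt : loops G (punchIn w t) ≡ 0) where
  open RigidCircuit rc

  private
    K₁ = del w G
    K = del t K₁
    ls₁ = del-looped w ls
    lsK = del-looped t ls₁
    module D₁ = Del G ls w
    module D = Del K₁ ls₁ t

    row≡ : ∀ (b : Fin n → ℕ) → dot (δ u ⊞ δ v) b ≡ b u + b v
    row≡ b = trans (dot-⊞ˡ (δ u) (δ v) b) (cong₂ _+_ (dot-δ u b) (dot-δ v b))

    u≢v : u ≢ v
    u≢v refl = n≮n 1 (≤-trans (≤-reflexive (sym (cong₂ _+_ (δ-self u) (δ-self u)))) (subst (_≤ 1) (nt u) (b2n≤1 _)))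

    both : Subset n → Subset (suc (suc n))
    both X = ins w true (ins t true X)

    card-both : ∀ X → ∣ both X ∣ ≡ 2 + ∣ X ∣
    card-both X = trans (ins-card w true _) (cong suc (ins-card t true X))

    iE-both : ∀ X → iE G (both X) ≡ iE K X + (ind X u + ind X v) + (1 + (ind X u + ind X v))
    iE-both X = trans (D₁.iE-ins true (ins t true X)) (cong₂ _+_
      (trans (D.iE-ins true X) (cong (iE K X +_) (trans (*-identityˡ _) (trans (dot-cong nt (λ _ → refl)) (row≡ (ind X))))))
      (trans (*-identityˡ _) (trans (dot-punchIn (row G w) (ind (ins t true X)) t) (cong₂ _+_
        (cong₂ _*_ wt (cong b2n (insertAt-lookup X t true)))
        (trans (dot-cong nw (ind-ins t true X)) (row≡ (ind X)))))))

    iL-both : ∀ X → iL G (both X) ≡ iL K X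
    iL-both X = trans (D₁.iL-ins true (ins t true X)) (trans (cong₂ _+_ (trans (D.iL-ins true X) (cong (λ z → iL K X + (z + 0)) lt)) (cong (_+ 0) lw))
      (trans (+-identityʳ _) (+-identityʳ _)))

    both-⊤ : both ⊤ ≡ ⊤
    both-⊤ = trans (cong (ins w true) (ins-⊤ t)) (ins-⊤ w)

    both-full : ∀ X {a} → ind X u ≡ 1 → ind X v ≡ 1 → iE G (both X) + a ≡ iE K X + 5 + a
    both-full X {a} p q = cong (_+ a) (trans (iE-both X) (trans (cong₂ (λ y z → iE K X + (y + z) + (1 + (y + z))) p q) (+-assoc (iE K X) 2 3)))

    -- Around `u` and `v` the two removed vertices bring five edges but raise the bound only by
    -- four. Hence sets containing both are one edge sparser than required, which makes room for uv;
    -- on the pair itself the inequality shows that uv is not yet there.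
    sparse-K : ∀ X → ind X u ≡ 1 → ind X v ≡ 1 → iE K X + 4 ≤ 2 * ∣ X ∣
    sparse-K X p q = linear 2 (λ where (e ∷ x ∷ []) → e :+ con 5 :+ con 3 ≼ 2 :* (con 2 :+ x) ⇒ ⊢ e :+ con 4 ≼ 2 :* x)
      (iE K X ∷ ∣ X ∣ ∷ []) (subst₂ (λ a b → a ≤ 2 * b) (both-full X p q) (card-both X)
        (sparseE (both X) (subst (2 ≤_) (sym (card-both X)) (s≤s (s≤s z≤n)))))

    ¬uv : adj K u v ≡ false
    ¬uv = non (adj K u v) refl
      where
      P = pair u v
      hP = ind-pair u≢v
      non : ∀ b → adj K u v ≡ b → b ≡ false
      non false _ = refl
      non true  p = ⊥-elim (n≮n 4 (subst₂ (λ a b → a + 4 ≤ 2 * b) (trans (Count.iE-pair K lsK P {u} {v} hP) (cong b2n p)) (card-pair P {u} {v} hP)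
        (sparse-K P (in→1 (pair-inˡ u v)) (in→1 (pair-inʳ u v)))))

    H = addEdge K u v
    module EA = EdgeAddition K lsK u≢v ¬uv

    iE-H-off : ∀ X → ind X u * ind X v ≡ 0 → iE H X ≡ iE K X
    iE-H-off X z = trans (EA.iE-addEdge X) (trans (cong (iE K X +_) z) (+-identityʳ _))

    iE-H-on : ∀ X → ind X u ≡ 1 → ind X v ≡ 1 → iE H X ≡ iE K X + 1
    iE-H-on X p q = trans (EA.iE-addEdge X) (cong (iE K X +_) (cong₂ _*_ p q))

    cases : ∀ X → (ind X u ≡ 1 × ind X v ≡ 1) ⊎ ind X u * ind X v ≡ 0
    cases X with u ∈? X | v ∈? X
    ... | inj₁ p | inj₁ r = inj₁ (in→1 p , in→1 r)
    ... | inj₁ p | inj₂ r = inj₂ (trans (cong (ind X u *_) (out→0 r)) (*-zeroʳ (ind X u)))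
    ... | inj₂ p | _      = inj₂ (cong (_* ind X v) (out→0 p))

    neither : Subset n → Subset (suc (suc n))
    neither X = ins w false (ins t false X)

    card-neither : ∀ X → ∣ neither X ∣ ≡ ∣ X ∣
    card-neither X = trans (ins-card w false _) (ins-card t false X)

    iE-neither : ∀ X → iE G (neither X) ≡ iE K X
    iE-neither X = trans (D₁.iE-ins false _) (trans (+-identityʳ _) (trans (D.iE-ins false X) (+-identityʳ _)))

    iL-neither : ∀ X → iL G (neither X) ≡ iL K X
    iL-neither X = trans (D₁.iL-ins false _) (trans (+-identityʳ _) (trans (D.iL-ins false X) (+-identityʳ _)))

    countH : iE H ⊤ + iL H ⊤ ≡ 2 * n + 1
    countH = +-cancelʳ-≡ 4 _ _ (begin
      iE H ⊤ + iL K ⊤ + 4       ≡⟨ cong (λ z → z + iL K ⊤ + 4) (iE-H-on ⊤ (ind-⊤ u) (ind-⊤ v)) ⟩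
      iE K ⊤ + 1 + iL K ⊤ + 4   ≡⟨ move (iE K ⊤) (iL K ⊤) ⟩
      iE K ⊤ + 5 + iL K ⊤       ≡⟨ sym (trans (cong (iE G (both ⊤) +_) (iL-both ⊤)) (both-full ⊤ (ind-⊤ u) (ind-⊤ v))) ⟩
      iE G (both ⊤) + iL G (both ⊤) ≡⟨ cong (λ Z → iE G Z + iL G Z) both-⊤ ⟩
      nE G + nL G               ≡⟨ count ⟩
      2 * (2 + n) + 1           ≡⟨ cong (_+ 1) (*-distribˡ-+ 2 2 n) ⟩
      4 + 2 * n + 1             ≡⟨ trans (+-assoc 4 (2 * n) 1) (+-comm 4 (2 * n + 1)) ⟩
      2 * n + 1 + 4             ∎)
      where
      open ≡-Reasoning
      move : ∀ a b → a + 1 + b + 4 ≡ a + 5 + b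
      move a b = trans (+-assoc (a + 1) b 4) (trans (cong (a + 1 +_) (+-comm b 4)) (trans (sym (+-assoc (a + 1) 4 b)) (cong (_+ b) (+-assoc a 1 4))))

    rcH : RigidCircuit H
    rcH = record
      { count    = countH
      ; sparseE  = λ X h → sE X h (cases X)
      ; sparseEL = λ X X≢⊤ → sEL X X≢⊤ (Full⊎missing X) (cases X) }
      where
      sE : ∀ X → 2 ≤ ∣ X ∣ → (ind X u ≡ 1 × ind X v ≡ 1) ⊎ ind X u * ind X v ≡ 0 → iE H X + 3 ≤ 2 * ∣ X ∣
      sE X h (inj₁ (p , q)) = subst (_≤ 2 * ∣ X ∣) (trans (sym (+-assoc (iE K X) 1 3)) (cong (_+ 3) (sym (iE-H-on X p q)))) (sparse-K X p q)
      sE X h (inj₂ z) = subst₂ (λ a b → a + 3 ≤ 2 * b) (trans (iE-neither X) (sym (iE-H-off X z))) (card-neither X)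
        (sparseE (neither X) (subst (2 ≤_) (sym (card-neither X)) h))
      sEL : ∀ X → X ≢ ⊤ → X ≡ ⊤ ⊎ (∃ λ i → i ∉ X) → (ind X u ≡ 1 × ind X v ≡ 1) ⊎ ind X u * ind X v ≡ 0 →
            iE H X + iL H X ≤ 2 * ∣ X ∣
      sEL X ne (inj₁ p) _ = ⊥-elim (ne p)
      sEL X ne (inj₂ (i , i∉)) (inj₂ z) = subst₂ _≤_ (cong₂ _+_ (trans (iE-neither X) (sym (iE-H-off X z))) (iL-neither X))
        (cong (2 *_) (card-neither X)) (sparseEL (neither X) (≢⊤ (ins-self w (ins t false X))))
      sEL X ne (inj₂ (i , i∉)) (inj₁ (p , q)) = linear 4 (λ where
          (e ∷ e′ ∷ l ∷ x ∷ []) → e :+ con 5 :+ l ≼ 2 :* (con 2 :+ x) ⇒ e′ ≼ e :+ con 1 ⇒ ⊢ e′ :+ l ≼ 2 :* x)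
        (iE K X ∷ iE H X ∷ iL H X ∷ ∣ X ∣ ∷ [])
        (subst₂ (λ a b → a ≤ 2 * b) (trans (cong (iE G (both X) +_) (iL-both X)) (both-full X p q)) (card-both X)
          (sparseEL (both X) (≢⊤ (ins-out (ins-out i∉)))))
        (≤-reflexive (iE-H-on X p q))

  reduce-K4 : Reducible G
  reduce-K4 = n , s≤s (n≤1+n n) , H , EA.addEdge-looped , rcH , λ built → iso (e-K4 u v built EA.addEdge-adj)
    (addVertex-≅ ls w inner _ 0 outer (sym lw))
    where
    inner : addVertex (deleteEdge H u v) (λ j → j == u ∨ j == v) 0 ≅ K₁
    inner = addVertex-≅ ls₁ t (≐→≅ (λ i j → sym (EA.delete-add i j)) (λ _ → refl)) _ 0
      (λ j → sym (bool-+₂ _ (j == u) (j == v) (nt j))) (sym lt)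
    1→true : ∀ {b} → b2n b ≡ 1 → true ≡ b
    1→true {true} _ = refl
    outer : ∀ j → _ ≡ adj G w (punchIn w (_≅_.σ inner ⟨$⟩ʳ j))
    outer zero    = 1→true wt
    outer (suc j) = sym (bool-+₂ _ (j == u) (j == v) (nw j))

δ-punchIn : (w : Fin (suc n)) (i j : Fin n) → δ (punchIn w i) (punchIn w j) ≡ δ i j
δ-punchIn w i j with j ≟ i
... | yes refl = δ-self (punchIn w i)
... | no p     = δ-≢ (p ∘ punchIn-injective w j i)

-- A view: matching on it turns a vertex other than `w` into a vertex of the graph without `w`.
data Punched (w : Fin (suc n)) : Fin (suc n) → Set where
  punched : (i : Fin n) → Punched w (punchIn w i)

punch : {w i : Fin (suc n)} → i ≢ w → Punched w i
punch {w = w} p = subst (Punched w) (punchIn-punchOut (p ∘ sym)) (punched _)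

δ≡0→≢ : {i j : Fin n} → δ i j ≡ 0 → i ≢ j
δ≡0→≢ {i = i} p refl = 0≢1+n (trans (sym p) (δ-self i))

module Reductions (G : LGraph (suc n)) (ls : IsLoopedSimple G) (rc : RigidCircuit G) where
  open Tightness G ls rc

  private
    self₃ : ∀ {w} a b c → A w ≗ δ a ⊞ δ b ⊞ δ c → a ≢ w × b ≢ w × c ≢ w
    self₃ {w} a b c h = δ≡0→≢ (m+n≡0⇒m≡0 (δ a w) ab) , δ≡0→≢ (m+n≡0⇒n≡0 (δ a w) ab) ,
                        δ≡0→≢ (m+n≡0⇒n≡0 (δ a w + δ b w) z)
      where
      z : δ a w + δ b w + δ c w ≡ 0
      z = trans (sym (h w)) (A-irr w)
      ab = m+n≡0⇒m≡0 (δ a w + δ b w) z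

    self₂ : ∀ {w} a b → A w ≗ δ a ⊞ δ b → a ≢ w × b ≢ w
    self₂ {w} a b h = δ≡0→≢ (m+n≡0⇒m≡0 (δ a w) z) , δ≡0→≢ (m+n≡0⇒n≡0 (δ a w) z)
      where
      z : δ a w + δ b w ≡ 0
      z = trans (sym (h w)) (A-irr w)

  by-edge : ∀ {w c t q} → loops G w ≡ 0 → A w ≗ δ c ⊞ δ t ⊞ δ q →
    (∀ Y → T Y → c ∈ Y → t ∈ Y → w ∉ Y → ⊥) → (∀ Y → F Y → c ∈ Y → t ∈ Y → q ∉ Y → w ∉ Y → ⊥) → Reducible G
  by-edge {w} {c} {t} {q} l0 h ¬T ¬F with self₃ c t q h
  ... | c≢ , t≢ , q≢ with punch c≢ | punch t≢ | punch q≢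
  ...   | punched c′ | punched t′ | punched q′ = Reduce.EdgeCase.reduce-edge G ls rc w l0
    (λ j → trans (h (punchIn w j)) (cong₂ _+_ (cong₂ _+_ (δ-punchIn w c′ j) (δ-punchIn w t′ j)) (δ-punchIn w q′ j))) ¬T ¬F

  by-loop : ∀ {w t q} → loops G w ≡ 1 → A w ≗ δ t ⊞ δ q →
    (∀ Y → F Y → t ∈ Y → q ∉ Y → w ∉ Y → ⊥) → Reducible G
  by-loop {w} {t} {q} l1 h ¬F with self₂ t q h
  ... | t≢ , q≢ with punch t≢ | punch q≢
  ...   | punched t′ | punched q′ = Reduce.reduce-loop-edge G ls rc w l1
    (λ j → trans (h (punchIn w j)) (cong₂ _+_ (δ-punchIn w t′ j) (δ-punchIn w q′ j))) ¬F

  by-two-loops : ∀ {w u} → loops G w ≡ 2 → A w ≗ δ u → Reducible G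
  by-two-loops {w} {u} l2 h with punch {w = w} {u} (δ≡0→≢ (trans (sym (h w)) (A-irr w)))
  ... | punched u′ = Reduce.reduce-loop-loop G ls rc w l2 (λ j → trans (h (punchIn w j)) (δ-punchIn w u′ j))

by-K4 : (G : LGraph (suc (suc n))) (ls : IsLoopedSimple G) → RigidCircuit G →
  ∀ {w t c q} → loops G w ≡ 0 → loops G t ≡ 0 → c ≢ t → q ≢ t → Count.A G ls w ≗ δ c ⊞ δ t ⊞ δ q →
  Count.A G ls t ≗ δ w ⊞ δ c ⊞ δ q → Reducible G
by-K4 G ls rc {w} {t} {c} {q} lw lt c≢t q≢t hw ht
  with punch {w = w} {t} t≢w | punch {w = w} {c} c≢w | punch {w = w} {q} q≢w
  where
  open Count G ls
  z : δ c w + δ t w + δ q w ≡ 0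
  z = trans (sym (hw w)) (A-irr w)
  ct = m+n≡0⇒m≡0 (δ c w + δ t w) z
  c≢w : c ≢ w
  c≢w = δ≡0→≢ (m+n≡0⇒m≡0 (δ c w) ct)
  t≢w : t ≢ w
  t≢w = δ≡0→≢ (m+n≡0⇒n≡0 (δ c w) ct)
  q≢w : q ≢ w
  q≢w = δ≡0→≢ (m+n≡0⇒n≡0 (δ c w + δ t w) z)
... | punched t′ | punched c₁ | punched q₁
  with punch {w = t′} {c₁} (λ { refl → c≢t refl }) | punch {w = t′} {q₁} (λ { refl → q≢t refl })
... | punched c′ | punched q′ = ReduceK4.reduce-K4 G ls rc w t′ c′ q′ wt nw nt lw lt
  where
  open ≡-Reasoning
  p = punchIn w ∘ punchIn t′
  δ-p : ∀ i j → δ (p i) (p j) ≡ δ i j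
  δ-p i j = trans (δ-punchIn w _ _) (δ-punchIn t′ i j)
  wt : row G w t′ ≡ 1
  wt = trans (hw (punchIn w t′)) (cong₂ _+_ (cong₂ _+_ (δ-≢ (c≢t ∘ sym)) (δ-self (punchIn w t′))) (δ-≢ (q≢t ∘ sym)))
  nw : row G w ∘ punchIn t′ ≗ δ c′ ⊞ δ q′
  nw j = trans (hw (p j)) (cong₂ _+_ (trans (cong₂ _+_ (δ-p c′ j) (δ-≢ {i = punchIn w t′} {p j} (punchInᵢ≢i t′ j ∘ punchIn-injective w _ _))) (+-identityʳ _)) (δ-p q′ j))
  nt : row (del w G) t′ ≗ δ c′ ⊞ δ q′
  nt j = trans (ht (p j)) (cong₂ _+_ (cong₂ _+_ (δ-≢ {i = w} {p j} (punchInᵢ≢i w _)) (δ-p c′ j)) (δ-p q′ j))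

-- Existence of a reduction

card-∪-< : (X Y : Subset n) {s : Fin n} → s ∈ Y → s ∉ X → ∣ X ∣ + 1 ≤ ∣ X ∪ Y ∣
card-∪-< X Y p q = begin
  ∣ X ∣ + 1                              ≤⟨ +-monoʳ-≤ ∣ X ∣ (card-pos (∖-in p q)) ⟩
  ∣ X ∣ + ∣ Y ∖ X ∣                      ≡⟨ cong₂ _+_ (card≡ X) (card≡ (Y ∖ X)) ⟩
  dot (ind X) 𝟙 + dot (ind (Y ∖ X)) 𝟙    ≡⟨ sym (card-decomp (X ∪ Y) (ind X) (ind (Y ∖ X)) pt) ⟩
  ∣ X ∪ Y ∣                              ∎
  where
  open ≤-Reasoning
  pt : ind (X ∪ Y) ≗ ind X ⊞ ind (Y ∖ X)
  pt i = trans (ind-∪ X Y i) (trans (swap (ind (X ∖ Y) i) (ind (Y ∖ X) i) (ind (X ∩ Y) i)) (cong (_+ ind (Y ∖ X) i) (sym (ind-splitˡ X Y i))))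
    where
    swap : ∀ a b c → a + b + c ≡ a + c + b
    swap a b c = trans (+-assoc a b c) (trans (cong (a +_) (+-comm b c)) (sym (+-assoc a c b)))

∩-singleton : {Y Z : Subset n} {t : Fin n} → t ∈ Y → t ∈ Z → (∀ s → s ∈ Y → s ∈ Z → s ≡ t) → ind (Y ∩ Z) ≗ δ t
∩-singleton {Y = Y} {Z} {t} p q u i with i ≟ t
... | yes refl = in→1 (∩-in p q)
... | no i≢t with i ∈? Y | i ∈? Z
...   | inj₁ a | inj₁ b = ⊥-elim (i≢t (u i a b))
...   | inj₂ a | _      = out→0 (∩-outˡ Z a)
...   | inj₁ _ | inj₂ b = out→0 (∩-outʳ Y b)

∩-pair : {Y Z : Subset n} {a b : Fin n} → a ≢ b → a ∈ Y → a ∈ Z → b ∈ Y → b ∈ Z →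
         (∀ s → s ∈ Y → s ∈ Z → s ≡ a ⊎ s ≡ b) → ind (Y ∩ Z) ≗ δ a ⊞ δ b
∩-pair {Y = Y} {Z} {a} {b} a≢b aY aZ bY bZ u i with i ≟ a | i ≟ b
... | yes refl | yes p    = ⊥-elim (a≢b p)
... | yes refl | no _     = in→1 (∩-in aY aZ)
... | no _     | yes refl = in→1 (∩-in bY bZ)
... | no i≢a   | no i≢b with i ∈? Y | i ∈? Z
...   | inj₂ p | _      = out→0 (∩-outˡ Z p)
...   | inj₁ _ | inj₂ p = out→0 (∩-outʳ Y p)
...   | inj₁ p | inj₁ q with u i p q
...     | inj₁ r = ⊥-elim (i≢a r)
...     | inj₂ r = ⊥-elim (i≢b r)

outside : Subset n → (Fin n → Bool) → Subset n
outside X b = tabulate λ i → not (lookup X i) ∧ b i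

∈-outside : (X : Subset n) (b : Fin n → Bool) {i : Fin n} → i ∉ X → b i ≡ true → i ∈ outside X b
∈-outside X b {i} (mem p) q = mem (trans (lookup∘tabulate _ i) (cong₂ (λ x y → not x ∧ y) p q))

outside-∈ : (X : Subset n) (b : Fin n → Bool) {i : Fin n} → i ∈ outside X b → i ∉ X × b i ≡ true
outside-∈ X b {i} (mem p) = aux (lookup X i) (b i) refl refl (trans (sym (lookup∘tabulate _ i)) p)
  where
  aux : ∀ x y → lookup X i ≡ x → b i ≡ y → not x ∧ y ≡ true → i ∉ X × b i ≡ true
  aux false true p q _ = mem p , q

outside-partition : (X : Subset n) (b : Fin n → Bool) → 𝟙 ≗ ind X ⊞ ind (outside X b) ⊞ ind (outside X (not ∘ b))
outside-partition X b i = trans (aux (lookup X i) (b i))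
  (sym (cong₂ (λ y z → ind X i + b2n y + b2n z) (lookup∘tabulate _ i) (lookup∘tabulate _ i)))
  where
  aux : ∀ x y → 1 ≡ b2n x + b2n (not x ∧ y) + b2n (not x ∧ not y)
  aux true  y     = refl
  aux false true  = refl
  aux false false = refl

does-true : {P : Set} (d : Dec P) → does d ≡ true → P
does-true (yes p) _ = p

does-false : {P : Set} (d : Dec P) → not (does d) ≡ true → ¬ P
does-false (no p) _ = p

three-ones : (a : Fin n → ℕ) {i j k : Fin n} → i ≢ j → i ≢ k → j ≢ k →
  a i ≡ 1 → a j ≡ 1 → a k ≡ 1 → dot a 𝟙 ≤ 3 → a ≗ δ i ⊞ δ j ⊞ δ k
three-ones a {i} {j} {k} i≢j i≢k j≢k ai aj ak s with split-at a i (≤-reflexive (sym ai))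
... | b , hb with split-at b j (≤-reflexive (trans (sym aj) (trans (hb j) (cong (_+ b j) (δ-≢ (i≢j ∘ sym))))))
...   | c , hc with split-at c k (≤-reflexive (trans (sym ak) (trans (hb k) (trans (cong₂ _+_ (δ-≢ (i≢k ∘ sym)) (hc k)) (cong (_+ c k) (δ-≢ (j≢k ∘ sym)))))))
...     | d , hd = λ x → trans (all x) (trans (cong (δ i x + δ j x + δ k x +_) (dot-0→ d zero-d x)) (+-identityʳ _))
  where
  all : a ≗ δ i ⊞ δ j ⊞ δ k ⊞ d
  all x = trans (hb x) (trans (cong (δ i x +_) (trans (hc x) (cong (δ j x +_) (hd x))))
    (trans (sym (+-assoc (δ i x) (δ j x) _)) (sym (+-assoc (δ i x + δ j x) (δ k x) (d x)))))
  zero-d : dot d 𝟙 ≤ 0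
  zero-d = +-cancelˡ-≤ 3 _ _ (subst (_≤ 3) (trans (dot-cong all (λ _ → refl)) (trans (dot-⊞ˡ (δ i ⊞ δ j ⊞ δ k) d 𝟙)
    (cong (_+ dot d 𝟙) (trans (dot-⊞ˡ (δ i ⊞ δ j) (δ k) 𝟙) (cong₂ _+_ (trans (dot-⊞ˡ (δ i) (δ j) 𝟙) (cong₂ _+_ (dot-δ i 𝟙) (dot-δ j 𝟙))) (dot-δ k 𝟙)))))) s)

-- The deletion lemmas need the order in the form `suc n`; for `zero` there is no vertex `w`.
reduction-by-edge : (G : LGraph n) (ls : IsLoopedSimple G) (rc : RigidCircuit G) → let open Tightness G ls rc in
  ∀ {w c t q} → loops G w ≡ 0 → A w ≗ δ c ⊞ δ t ⊞ δ q →
  (∀ Y → T Y → c ∈ Y → t ∈ Y → w ∉ Y → ⊥) → (∀ Y → F Y → c ∈ Y → t ∈ Y → q ∉ Y → w ∉ Y → ⊥) → Reducible G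
reduction-by-edge {suc n} = Reductions.by-edge

reduction-by-loop : (G : LGraph n) (ls : IsLoopedSimple G) (rc : RigidCircuit G) → let open Tightness G ls rc in
  ∀ {w t q} → loops G w ≡ 1 → A w ≗ δ t ⊞ δ q →
  (∀ Y → F Y → t ∈ Y → q ∉ Y → w ∉ Y → ⊥) → Reducible G
reduction-by-loop {suc n} = Reductions.by-loop

reduction-by-two-loops : (G : LGraph n) (ls : IsLoopedSimple G) (rc : RigidCircuit G) →
  ∀ {w u} → loops G w ≡ 2 → Count.A G ls w ≗ δ u → Reducible G
reduction-by-two-loops {suc n} = Reductions.by-two-loops

reduction-by-K4 : (G : LGraph n) (ls : IsLoopedSimple G) → RigidCircuit G →
  ∀ {w t c q} → loops G w ≡ 0 → loops G t ≡ 0 → c ≢ t → q ≢ t → Count.A G ls w ≗ δ c ⊞ δ t ⊞ δ q →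
  Count.A G ls t ≗ δ w ⊞ δ c ⊞ δ q → Reducible G
reduction-by-K4 {suc zero} G ls rc {t = zero} {c = zero} _ _ c≢t = ⊥-elim (c≢t refl)
reduction-by-K4 {suc (suc n)} = by-K4

another-vertex : 2 ≤ n → (w : Fin n) → ∃ λ j → j ≢ w
another-vertex (s≤s (s≤s _)) w = punchIn w zero , punchInᵢ≢i w zero

some-vertex : 2 ≤ n → Fin n
some-vertex (s≤s _) = zero

module Search {n : ℕ} (2≤n : 2 ≤ n) (G : LGraph n) (ls : IsLoopedSimple G) (rc : RigidCircuit G) where
  open Tightness G ls rc

  -- Without `w` at most 2(n - 1) of the 2n + 1 edges and loops are left.
  degree≥3 : ∀ w → 3 ≤ dg w
  degree≥3 w = linear 7 (λ where
      (e ∷ l ∷ r ∷ k ∷ x ∷ M ∷ c ∷ []) → M ≼ e :+ r :+ (l :+ k) ⇒ e :+ l ≼ 2 :* x ⇒ 2 :* c :+ con 1 ≼ M ⇒ 2 :* (x :+ con 1) ≼ 2 :* c ⇒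
        ⊢ con 3 ≼ r :+ k)
    (iE G V ∷ iL G V ∷ R 𝟙 w ∷ loops G w ∷ ∣ V ∣ ∷ (nE G + nL G) ∷ n ∷ [])
    (≤-reflexive (cong₂ _+_ (trans (-₁-E w∈) (cong (iE G V +_) (R-cong ind-⊤ w))) (iL-δ V ⊤ (ind--₁ w∈))))
    (sparseEL V (≢⊤ (-₁-self ⊤ w))) (eq≥ count) (2*-mono (eq≤ (trans (sym (card--₁ w∈)) (∣⊤∣≡n n))))
    where
    V = ⊤ -₁ w
    w∈ : w ∈ ⊤
    w∈ = mem (lookup-replicate w true)

  -- By `degree-sum` and the tightness of `X`, the degrees over the complement `D` add up to
  -- `iE G D` + 2∣D∣ + 1. As `iE G D` is at most 2∣D∣ - 2, the average is below 4.
  node-exists : ∀ X {β} → F X → β ∉ X → ∃ λ i → i ∉ X × dg i ≡ 3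
  node-exists X {β} fX β∉ =
    let i , i∈ , lt = dot-< D dg 4 few in i , ∁-out i∈ , ≤-antisym (s≤s⁻¹ lt) (degree≥3 i)
    where
    D = ∁ X
    few : suc (dot (ind D) dg) ≤ 4 * ∣ D ∣
    few = linear 8 (λ where
        (s ∷ i ∷ l ∷ e ∷ M ∷ c ∷ x ∷ d ∷ []) → s :+ (i :+ l) ≼ e :+ M ⇒ M ≼ 2 :* c :+ con 1 ⇒ 2 :* c ≼ 2 :* (x :+ d) ⇒
          2 :* x ≼ i :+ l ⇒ e :+ con 2 ≼ 2 :* d ⇒ ⊢ con 1 :+ s ≼ 4 :* d)
      (dot (ind D) dg ∷ iE G X ∷ iL G X ∷ iE G D ∷ (nE G + nL G) ∷ n ∷ ∣ X ∣ ∷ ∣ D ∣ ∷ [])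
      (eq≤ (degree-sum D X (ind-∁ X))) (eq≤ count) (2*-mono (eq≤ (card-∁ X))) (eq≥ fX) (sparse₁ (∁-in β∉))

  -- The degrees over `Fs` add up to 3∣Fs∣, and the complement of `Fs` is proper and so obeys the
  -- joint bound. By `degree-sum`, `iE G Fs` is at most ∣Fs∣ - 1, as in a forest, so the average
  -- degree inside `Fs` is below 2.
  leaf-exists : ∀ Fs {i₀} → i₀ ∈ Fs → (∀ i → i ∈ Fs → dg i ≡ 3) → ∃ λ w → w ∈ Fs × R (ind Fs) w ≤ 1
  leaf-exists Fs {i₀} i₀∈ nodes =
    let w , w∈ , lt = dot-< Fs (R (ind Fs)) 2 few in w , w∈ , s≤s⁻¹ lt
    where
    X = ∁ Fs
    f = ind Fs
    complement : 𝟙 ≗ ind X ⊞ f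
    complement i = trans (ind-∁ Fs i) (+-comm (f i) (ind X i))
    dg-nodes : ∀ i → f i * dg i ≡ f i * 3
    dg-nodes i with i ∈? Fs
    ... | inj₁ p = cong (f i *_) (nodes i p)
    ... | inj₂ p = trans (cong (_* dg i) (out→0 p)) (sym (cong (_* 3) (out→0 p)))
    total : dot f dg ≡ 3 * ∣ Fs ∣
    total = trans (dot≡ f dg) (trans (Sum-cong λ i → trans (dg-nodes i) (trans (*-comm (f i) 3) (cong (3 *_) (sym (*-identityʳ (f i))))))
      (trans (sym (*-Sum 3 (λ i → f i * 1))) (cong (3 *_) (trans (sym (dot≡ f 𝟙)) (sym (card≡ Fs))))))
    few : suc (dot f (R f)) ≤ 2 * ∣ Fs ∣
    few = linear 9 (λ where
        (s ∷ i ∷ l ∷ e ∷ M ∷ c ∷ x ∷ d ∷ r ∷ []) → 2 :* (e :+ M) ≼ 2 :* (s :+ (i :+ l)) ⇒ 2 :* (2 :* c :+ con 1) ≼ 2 :* M ⇒ 4 :* (d :+ x) ≼ 4 :* c ⇒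
          2 :* (i :+ l) ≼ 2 :* (2 :* x) ⇒ 2 :* s ≼ 2 :* (3 :* d) ⇒ r ≼ 2 :* e ⇒ ⊢ con 1 :+ r ≼ 2 :* d)
      (dot f dg ∷ iE G X ∷ iL G X ∷ iE G Fs ∷ (nE G + nL G) ∷ n ∷ ∣ X ∣ ∷ ∣ Fs ∣ ∷ dot f (R f) ∷ [])
      (2*-mono (eq≥ (degree-sum Fs X complement))) (2*-mono (eq≥ count)) (*-monoʳ-≤ 4 (eq≥ (card-∁ Fs)))
      (2*-mono (sparseEL X (≢⊤ (∁-out′ i₀∈)))) (2*-mono (eq≤ total)) (eq≥ (2iE Fs))

  Candidate : Subset n → Set
  Candidate X = F X × ∃ λ β → β ∉ X × dg β ≢ 3

  Maximal : Subset n → Set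
  Maximal X = ∀ Y → Candidate Y → ∣ Y ∣ ≤ ∣ X ∣

  private
    candidate? : ∀ X → Dec (Candidate X)
    candidate? X = (iE G X + iL G X ≟ℕ 2 * ∣ X ∣) ×-dec any? (λ β → (β ∉ᵈ X) ×-dec ¬? (dg β ≟ℕ 3))

  -- The number `k` bounds the enlargements still possible, since no subset exceeds `n` elements.
  maximal-candidate : ∀ k X → Candidate X → n ≤ k + ∣ X ∣ → ∃ λ Y → Candidate Y × Maximal Y
  maximal-candidate k X cX h = decide k h (anySubset? (λ Y → candidate? Y ×-dec (suc ∣ X ∣ ≤? ∣ Y ∣)))
    where
    decide : ∀ k → n ≤ k + ∣ X ∣ → Dec (∃ λ Y → Candidate Y × suc ∣ X ∣ ≤ ∣ Y ∣) → ∃ λ Y → Candidate Y × Maximal Y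
    decide k       h (no ¬Y) = X , cX , λ Y cY → ≮⇒≥ (λ lt → ¬Y (Y , cY , lt))
    decide zero    h (yes (Y , cY , lt)) = ⊥-elim (n≮n _ (≤-trans lt (≤-trans (∣p∣≤n Y) h)))
    decide (suc k) h (yes (Y , cY , lt)) = maximal-candidate k Y cY
      (≤-trans h (≤-trans (≤-reflexive (sym (+-suc k ∣ X ∣))) (+-monoʳ-≤ k lt)))

  row-sum : ∀ {w c t q} → A w ≗ δ c ⊞ δ t ⊞ δ q → ∀ b → R b w ≡ b c + b t + b q
  row-sum {w} {c} {t} {q} h b = trans (dot-cong h (λ _ → refl)) (trans (dot-⊞ˡ (δ c ⊞ δ t) (δ q) b)
    (cong₂ _+_ (trans (dot-⊞ˡ (δ c) (δ t) b) (cong₂ _+_ (dot-δ c b) (dot-δ t b))) (dot-δ q b)))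

  -- Only sets tight for edges alone are recorded and searched for; blocking sets of the other kind
  -- are refuted by the maximality of `X`.
  Blocked : (w a b : Fin n) → Set
  Blocked w a b = ∃ λ Y → T Y × a ∈ Y × b ∈ Y × w ∉ Y

  blocked? : ∀ w a b → Dec (Blocked w a b)
  blocked? w a b = anySubset? λ Y → (iE G Y + 3 ≟ℕ 2 * ∣ Y ∣) ×-dec (a ∈ᵈ Y) ×-dec (b ∈ᵈ Y) ×-dec (w ∉ᵈ Y)

  module FromMaximal {X : Subset n} (fX : F X) {β : Fin n} (β∉ : β ∉ X) (β≢ : dg β ≢ 3) (max : Maximal X) where

    -- With two edges or loops to spend on `X`, the node could be added to give a larger candidate:
    -- `β` is not a node, so it differs from `w` and still lies outside.
    node-degree : ∀ {w} → w ∉ X → dg w ≡ 3 → R (ind X) w + loops G w ≤ 1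
    node-degree {w} w∉ d = ≮⇒≥ λ lt → n≮n _ (≤-trans
      (≤-reflexive (trans (+-comm 1 ∣ X ∣) (sym (card-∪₁ w∉))))
      (max (X ∪₁ w) (F-∪₁ fX w∉ β∉ β≢w lt , β , ∪₁-out β∉ β≢w , β≢)))
      where
      β≢w : β ≢ w
      β≢w refl = β≢ d

    private
      -- The vertex `s` makes the union larger than `X`; `γ`, which is not a node, makes it a
      -- candidate.
      too-big : ∀ {Y s γ} → F (X ∪ Y) → s ∈ Y → s ∉ X → γ ∉ X → γ ∉ Y → dg γ ≢ 3 → ⊥
      too-big {Y} {s} {γ} f s∈ s∉ γ∉X γ∉Y γ≢ = n≮n _ (≤-trans (≤-reflexive (+-comm 1 ∣ X ∣))
        (≤-trans (card-∪-< X Y s∈ s∉) (max (X ∪ Y) (f , γ , ∪-out γ∉X γ∉Y , γ≢))))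

    no-F : ∀ {Y s γ} → F Y → s ∈ Y → s ∉ X → γ ∉ X → γ ∉ Y → dg γ ≢ 3 → ⊥
    no-F fY s∈ s∉ γ∉X γ∉Y γ≢ = too-big (proj₁ (FF-union fX fY γ∉X γ∉Y)) s∈ s∉ γ∉X γ∉Y γ≢

    no-T : ∀ {Y s γ} → T Y → 2 ≤ ∣ X ∩ Y ∣ → s ∈ Y → s ∉ X → γ ∉ X → γ ∉ Y → dg γ ≢ 3 → ⊥
    no-T tY c s∈ s∉ γ∉X γ∉Y γ≢ = too-big (FT-union fX tY c γ∉X γ∉Y) s∈ s∉ γ∉X γ∉Y γ≢

    -- The vertices have different roles against a set tight for edges and loops. For the edge ct,
    -- `t` enlarges `X` and `q` stays outside. For cq, `q` enlarges `X` and `t` stays outside, once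
    -- it is known not to be a node. For tq, `t` enlarges `X` and `c` stays outside, provided that
    -- it is not in `X`.
    module AtNode {w c t q : Fin n} (w∉ : w ∉ X) (wd : dg w ≡ 3) (l0 : loops G w ≡ 0)
      (h : A w ≗ δ c ⊞ δ t ⊞ δ q) (q∉ : q ∉ X) (q≢3 : dg q ≢ 3) (t∉ : t ∉ X)
      (c-case : c ∈ X ⊎ (c ∉ X × dg c ≢ 3)) where

      private
        le1 : ∀ j → δ c j + δ t j + δ q j ≤ 1
        le1 j = subst (_≤ 1) (h j) (b2n≤1 _)

        c≢t : c ≢ t
        c≢t refl = n≮n 1 (≤-trans (≤-trans (≤-reflexive (sym (cong₂ _+_ (δ-self c) (δ-self c)))) (m≤m+n _ _)) (le1 c))

        q≢c : q ≢ c
        q≢c refl = n≮n 1 (≤-trans (≤-trans (≤-reflexive (sym (cong₂ _+_ (δ-self q) (δ-self q)))) (+-monoˡ-≤ (δ q q) (m≤m+n _ _))) (le1 q))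

        q≢t : q ≢ t
        q≢t refl = n≮n 1 (≤-trans (≤-trans (≤-reflexive (sym (cong₂ _+_ (δ-self q) (δ-self q)))) (+-monoˡ-≤ (δ q q) (m≤n+m _ _))) (le1 q))

        degree-to : ∀ {U} → c ∈ U → t ∈ U → q ∈ U → R (ind U) w ≡ 3
        degree-to {U} c∈ t∈ q∈ = trans (row-sum h (ind U)) (cong₂ _+_ (cong₂ _+_ (in→1 c∈) (in→1 t∈)) (in→1 q∈))

        no-wide : ∀ {U} → 2 * ∣ U ∣ ≤ iE G U + 3 → c ∈ U → t ∈ U → q ∈ U → w ∉ U → ⊥
        no-wide u c∈ t∈ q∈ w∉U = n≮n 2 (subst (_≤ 2) (degree-to c∈ t∈ q∈) (degree-into-T c∈ w∉U u))

        not-in : ∀ {U : Subset n} {i} → (i ∈ U → ⊥) → i ∉ U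
        not-in {U} {i} p with i ∈? U
        ... | inj₁ q = ⊥-elim (p q)
        ... | inj₂ q = q

        -- With two common vertices the union would again be tight for edges, but it contains all
        -- three neighbours of `w`, and a tight set admits only two.
        meet : ∀ {Y Z s t′} → T Y → T Z → w ∉ Y → w ∉ Z → c ∈ (Y ∪ Z) → t ∈ (Y ∪ Z) → q ∈ (Y ∪ Z) →
               t′ ∈ Y → t′ ∈ Z → s ∈ Y → s ∈ Z → s ≡ t′
        meet {Y} {Z} {s} {t′} tY tZ wY wZ c∈ t∈ q∈ tY′ tZ′ sY sZ with s ≟ t′
        ... | yes p = p
        ... | no  p = ⊥-elim (no-wide (TT-union {Y} {Z} tY tZ (card-pos-2 (∩-in sY sZ) (∩-in tY′ tZ′) p)) c∈ t∈ q∈ (∪-out wY wZ))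

      -- If c lies in X, then X ∪ Z misses only w and no edge joins X ∖ Z to Z ∖ X. But Y gives
      -- c a neighbour, which lies in Z ∖ X, as otherwise X ∪ Y would be a larger candidate.
      no-F-tq : ∀ {Y} → T Y → c ∈ Y → t ∈ Y → w ∉ Y → q ∉ Y → ∀ Z → F Z → t ∈ Z → q ∈ Z → c ∉ Z → w ∉ Z → ⊥
      no-F-tq {Y} tY c∈Y t∈Y w∉Y q∉Y Z fZ t∈Z q∈Z c∉Z w∉Z = split c-case
        where
        split : c ∈ X ⊎ (c ∉ X × dg c ≢ 3) → ⊥
        split (inj₂ (c∉ , c≢3)) = no-F fZ t∈Z t∉ c∉ c∉Z c≢3
        split (inj₁ c∈X) =
          let i , i∈ , a = T-neighbour tY c∈Y t∈Y (c≢t ∘ sym) in locate i i∈ a (i ∈? X)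
          where
          f∪ = FF-union fX fZ w∉ w∉Z
          everything : ∀ i → i ≢ w → i ∉ (X ∪ Z) → ⊥
          everything i i≢w i∉ = n≮n 2 (subst (_≤ 2)
            (cong₂ _+_ (degree-to (∪-inˡ Z c∈X) (∪-inʳ X t∈Z) (∪-inʳ X q∈Z)) l0)
            (degree-into-F (proj₁ f∪) (∪-out w∉ w∉Z) i∉ i≢w))
          locate : ∀ i → i ∈ Y → A c i ≡ 1 → i ∈ X ⊎ i ∉ X → ⊥
          locate i i∈Y a (inj₁ i∈X) = no-T tY (card-pos-2 (∩-in c∈X c∈Y) (∩-in i∈X i∈Y) c≢i) t∈Y t∉ q∉ q∉Y q≢3
            where
            c≢i : c ≢ i
            c≢i refl = 0≢1+n (trans (sym (A-irr c)) a)
          locate i i∈Y a (inj₂ i∉X) with i ∈? Z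
          ... | inj₁ i∈Z = n≮n 0 (≤-trans (≤-trans (≤-reflexive (sym a)) (E-pos (X ∖ Z) (Z ∖ X) (∖-in c∈X c∉Z) (∖-in i∈Z i∉X))) (proj₂ f∪))
          ... | inj₂ i∉Z = everything i (∈∉-≢ i∈Y w∉Y) (∪-out i∉X i∉Z)

      -- Besides w, the vertex t has only two neighbours left to share between Y and Z, which
      -- forces Y = {c , t} and Z = {t , q}.
      K4-case : ∀ {Y Z} → T Y → T Z → c ∈ Y → t ∈ Y → w ∉ Y → t ∈ Z → q ∈ Z → w ∉ Z →
        (∀ s → s ∈ Y → s ∈ Z → s ≡ t) → dg t ≡ 3 → Reducible G
      K4-case {Y} {Z} tY tZ c∈Y t∈Y w∉Y t∈Z q∈Z w∉Z only td =
        reduction-by-K4 G ls rc l0 lt c≢t q≢t h (three-ones (A t) (∈∉-≢ c∈Y w∉Y ∘ sym) (∈∉-≢ q∈Z w∉Z ∘ sym) (q≢c ∘ sym)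
          tw (T-leaf tY t∈Y c∈Y c≢t rY) (T-leaf tZ t∈Z q∈Z q≢t rZ) (≤-trans (m≤m+n (R 𝟙 t) _) (≤-reflexive td)))
        where
        y = ind Y
        z = ind Z
        tw : A t w ≡ 1
        tw = trans (A-sym t w) (trans (h t) (cong₂ _+_ (cong₂ _+_ (δ-≢ {i = c} (c≢t ∘ sym)) (δ-self t)) (δ-≢ {i = q} (q≢t ∘ sym))))
        -- `Y` and `Z` overlap only in `t`, and `w` lies in neither. The surplus `δ t` costs nothing
        -- in `sum≤`, since `t` is not adjacent to itself.
        cover : ∀ i → (y ⊞ z ⊞ δ w) i ≤ (𝟙 ⊞ δ t) i
        cover i with i ≟ w | i ≟ t
        ... | yes refl | _ = ≤-trans (≤-reflexive (cong (_+ 1) (cong₂ _+_ (out→0 w∉Y) (out→0 w∉Z)))) (m≤m+n 1 _)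
        ... | no _ | yes refl = ≤-reflexive (cong (_+ 0) (cong₂ _+_ (in→1 t∈Y) (in→1 t∈Z)))
        ... | no _ | no i≢t with i ∈? Y | i ∈? Z
        ...   | inj₁ p | inj₁ r = ⊥-elim (i≢t (only i p r))
        ...   | inj₁ p | inj₂ r = ≤-reflexive (cong (_+ 0) (cong₂ _+_ (in→1 p) (out→0 r)))
        ...   | inj₂ p | _      = ≤-trans (≤-reflexive (trans (+-identityʳ _) (cong (_+ z i) (out→0 p)))) (b2n≤1 (lookup Z i))
        sum≤ : R y t + R z t + A t w ≤ R 𝟙 t
        sum≤ = begin
          R y t + R z t + A t w                         ≡⟨ cong₂ _+_ (sym (R-⊞ y z t)) (sym (R-δ w t)) ⟩
          R (y ⊞ z) t + R (δ w) t                       ≡⟨ sym (R-⊞ (y ⊞ z) (δ w) t) ⟩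
          R (y ⊞ z ⊞ δ w) t                             ≡⟨ dot-comm (A t) (y ⊞ z ⊞ δ w) ⟩
          dot (y ⊞ z ⊞ δ w) (A t)                       ≤⟨ dot-mono (A t) cover ⟩
          dot (𝟙 ⊞ δ t) (A t)                           ≡⟨ dot-comm (𝟙 ⊞ δ t) (A t) ⟩
          R (𝟙 ⊞ δ t) t                                 ≡⟨ R-⊞ 𝟙 (δ t) t ⟩
          R 𝟙 t + R (δ t) t                             ≡⟨ cong (R 𝟙 t +_) (trans (R-δ t t) (A-irr t)) ⟩
          R 𝟙 t + 0                                     ≡⟨ +-identityʳ _ ⟩
          R 𝟙 t                                         ∎
          where open ≤-Reasoning
        -- The degree 3 of `t` is spent on the edge to `w` and on at least one edge into each of `Y`
        -- and `Z`, so nothing is left for a second one or for a loop.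
        bounds : R y t ≤ 1 × R z t ≤ 1 × loops G t ≤ 0
        bounds =
          linear 5 (λ where (a ∷ b ∷ d ∷ r ∷ l ∷ []) → a :+ b :+ d ≼ r ⇒ con 1 ≼ d ⇒ con 1 ≼ b ⇒ r :+ l ≼ con 3 ⇒ ⊢ a ≼ con 1) ρ sum≤ tw≥ zt≥ td≤ ,
          linear 5 (λ where (a ∷ b ∷ d ∷ r ∷ l ∷ []) → a :+ b :+ d ≼ r ⇒ con 1 ≼ d ⇒ con 1 ≼ a ⇒ r :+ l ≼ con 3 ⇒ ⊢ b ≼ con 1) ρ sum≤ tw≥ yt≥ td≤ ,
          linear 5 (λ where (a ∷ b ∷ d ∷ r ∷ l ∷ []) → a :+ b :+ d ≼ r ⇒ con 1 ≼ d ⇒ con 1 ≼ a ⇒ con 1 ≼ b ⇒ r :+ l ≼ con 3 ⇒ ⊢ l ≼ con 0) ρ sum≤ tw≥ yt≥ zt≥ td≤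
          where
          ρ = R y t ∷ R z t ∷ A t w ∷ R 𝟙 t ∷ loops G t ∷ []
          tw≥ = eq≥ tw
          td≤ = eq≤ td
          yt≥ = T-degree tY t∈Y c∈Y c≢t
          zt≥ = T-degree tZ t∈Z q∈Z q≢t
        rY = proj₁ bounds
        rZ = proj₁ (proj₂ bounds)
        lt : loops G t ≡ 0
        lt = n≤0⇒n≡0 (proj₂ (proj₂ bounds))

      -- Three tight sets meeting pairwise in the single vertices t, c and q have a tight union.
      three-T : ∀ {Y Z W} → T Y → T Z → T W → c ∈ Y → t ∈ Y → w ∉ Y → t ∈ Z → q ∈ Z → w ∉ Z → c ∈ W → q ∈ W → w ∉ W → ⊥
      three-T {Y} {Z} {W} tY tZ tW cY tY′ wY tZ′ qZ wZ cW qW wW =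
        -- The union of `Y` and `Z` has defect at most 4 less `A c q`, and `W` meets it exactly in
        -- `c` and `q`.
        no-wide (TT-union₂ {X = Y ∪ Z} {W} {c} {q} (TT-union₁ {X = Y} {Z} {t} tY tZ (∩-singleton tY′ tZ′ YZ) (∖-in cY c∉Z) (∖-in qZ q∉Y)) tW
            (∩-pair (q≢c ∘ sym) (∪-inˡ Z cY) cW (∪-inʳ Y qZ) qW only))
          (∪-inˡ W (∪-inˡ Z cY)) (∪-inˡ W (∪-inˡ Z tY′)) (∪-inʳ (Y ∪ Z) qW) (∪-out (∪-out wY wZ) wW)
        where
        YZ : ∀ s → s ∈ Y → s ∈ Z → s ≡ t
        YZ s = meet tY tZ wY wZ (∪-inˡ Z cY) (∪-inˡ Z tY′) (∪-inʳ Y qZ) tY′ tZ′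
        YW : ∀ s → s ∈ Y → s ∈ W → s ≡ c
        YW s = meet tY tW wY wW (∪-inˡ W cY) (∪-inˡ W tY′) (∪-inʳ Y qW) cY cW
        ZW : ∀ s → s ∈ Z → s ∈ W → s ≡ q
        ZW s = meet tZ tW wZ wW (∪-inʳ Z cW) (∪-inˡ W tZ′) (∪-inˡ W qZ) qZ qW
        c∉Z : c ∉ Z
        c∉Z = not-in λ p → c≢t (YZ c cY p)
        q∉Y : q ∉ Y
        q∉Y = not-in λ p → q≢t (YZ q p qZ)
        only : ∀ s → s ∈ (Y ∪ Z) → s ∈ W → s ≡ c ⊎ s ≡ q
        only s p r with s ∈? Y | s ∈? Z
        ... | inj₁ a | _      = inj₁ (YW s a r)
        ... | inj₂ _ | inj₁ b = inj₂ (ZW s b r)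
        ... | inj₂ a | inj₂ b = ⊥-elim (∈∉ p (∪-out a b))

      reduce-node : Reducible G
      reduce-node = step₁ (blocked? w c t)
        where
        shuffle₁ : A w ≗ δ t ⊞ δ q ⊞ δ c
        shuffle₁ i = trans (h i) (trans (+-assoc (δ c i) (δ t i) (δ q i)) (+-comm (δ c i) _))
        shuffle₂ : A w ≗ δ c ⊞ δ q ⊞ δ t
        shuffle₂ i = trans (h i) (trans (+-assoc (δ c i) (δ t i) (δ q i)) (trans (cong (δ c i +_) (+-comm (δ t i) (δ q i))) (sym (+-assoc (δ c i) _ _))))

        step₃ : ∀ {Y Z} → T Y → T Z → c ∈ Y → t ∈ Y → w ∉ Y → t ∈ Z → q ∈ Z → w ∉ Z →
                dg t ≢ 3 → Dec (Blocked w c q) → Reducible G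
        step₃ tY tZ cY tY′ wY tZ′ qZ wZ t≢3 (yes (W , tW , cW , qW , wW)) = ⊥-elim (three-T tY tZ tW cY tY′ wY tZ′ qZ wZ cW qW wW)
        step₃ tY tZ cY tY′ wY tZ′ qZ wZ t≢3 (no ¬b) = reduction-by-edge G ls rc l0 shuffle₂
          (λ W tW cW qW wW → ¬b (W , tW , cW , qW , wW))
          (λ W fW cW qW tW wW → no-F fW qW q∉ t∉ tW t≢3)

        step₂ : ∀ {Y} → T Y → c ∈ Y → t ∈ Y → w ∉ Y → Dec (Blocked w t q) → Dec (dg t ≡ 3) → Reducible G
        step₂ tY cY tY′ wY (no ¬b) _ = reduction-by-edge G ls rc l0 shuffle₁
          (λ Z tZ tZ′ qZ wZ → ¬b (Z , tZ , tZ′ , qZ , wZ))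
          (λ Z fZ tZ qZ cZ wZ → no-F-tq tY cY tY′ wY (not-in λ qY → no-wide (eq≥ tY) cY tY′ qY wY) Z fZ tZ qZ cZ wZ)
        step₂ {Y} tY cY tY′ wY (yes (Z , tZ , tZ′ , qZ , wZ)) (yes td) = K4-case tY tZ cY tY′ wY tZ′ qZ wZ
          (λ s → meet tY tZ wY wZ (∪-inˡ Z cY) (∪-inˡ Z tY′) (∪-inʳ Y qZ) tY′ tZ′) td
        step₂ tY cY tY′ wY (yes (Z , tZ , tZ′ , qZ , wZ)) (no t≢3) = step₃ tY tZ cY tY′ wY tZ′ qZ wZ t≢3 (blocked? w c q)

        step₁ : Dec (Blocked w c t) → Reducible G
        step₁ (no ¬b) = reduction-by-edge G ls rc l0 h (λ Y tY cY tY′ wY → ¬b (Y , tY , cY , tY′ , wY))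
          (λ Y fY cY tY qY wY → no-F fY tY t∉ q∉ qY q≢3)
        step₁ (yes (Y , tY , cY , tY′ , wY)) = step₂ tY cY tY′ wY (blocked? w t q) (dg t ≟ℕ 3)

  F∅ : F ∅
  F∅ = trans (cong₂ _+_ (iE-empty ∅ (≤-reflexive e)) (trans (iL≡ ∅) (trans (dot-cong ind-∅ (λ _ → refl)) (dot-0 (loops G))))) (sym (cong (2 *_) e))
    where
    e : ∣ ∅ {n} ∣ ≡ 0
    e = ∣⊥∣≡0 n

  -- The neighbours of a leaf

  private
    node? other? : Fin n → Bool
    node? i  = does (dg i ≟ℕ 3)
    other? i = not (node? i)

    outside-nodes outside-others : Subset n → Subset n
    outside-nodes  X = outside X node?
    outside-others X = outside X other?

    ∈-nodes : ∀ {X i} → i ∉ X → dg i ≡ 3 → i ∈ outside-nodes X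
    ∈-nodes {X} {i} p d = ∈-outside X node? p (dec-true (dg i ≟ℕ 3) d)

    nodes-∈ : ∀ X {i} → i ∈ outside-nodes X → i ∉ X × dg i ≡ 3
    nodes-∈ X {i} p = let q , r = outside-∈ X node? p in q , does-true (dg i ≟ℕ 3) r

    others-∈ : ∀ X {i} → i ∈ outside-others X → i ∉ X × dg i ≢ 3
    others-∈ X {i} p = let q , r = outside-∈ X other? p in q , does-false (dg i ≟ℕ 3) r

    partition : ∀ X → 𝟙 ≗ ind X ⊞ ind (outside-nodes X) ⊞ ind (outside-others X)
    partition X = outside-partition X node?

  -- By `rest-sum`, the remainder `rest` is either the third neighbour of `w` or zero, in which case
  -- `w` has a loop. Both cases share one record, so that `q` and `t` are chosen only once.
  record Neighbourhood (X : Subset n) (w : Fin n) : Set where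
    field
      q t        : Fin n
      rest       : Fin n → ℕ
      q∈         : q ∈ outside-others X
      t∉         : t ∉ X
      row-rest   : A w ≗ δ q ⊞ δ t ⊞ rest
      rest-sum   : dot rest 𝟙 + loops G w ≡ 1
      rest-nodes : dot rest (ind (outside-nodes X)) ≤ 0

  -- Choosing t among the nodes whenever possible ensures that the remaining neighbour, if it
  -- lies outside X, is not a node.
  neighbourhood : ∀ X w → dg w ≡ 3 → R (ind X) w + loops G w ≤ 1 → R (ind (outside-nodes X)) w ≤ 1 → Neighbourhood X w
  neighbourhood X w wd few leaf =
    let q , p , p′ = some-q
        a₁ , h₁ = split-at (A w) q p
    in with-q q (1→in (outside-others X) q p′) a₁ h₁
    where
    f r : Fin n → ℕ
    f = ind (outside-nodes X)
    r = ind (outside-others X)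

    total : (a : Fin n → ℕ) → dot a 𝟙 ≡ dot a (ind X) + dot a f + dot a r
    total a = trans (dot-cong {a = a} (λ _ → refl) (partition X)) (trans (dot-⊞ʳ a (ind X ⊞ f) r) (cong (_+ dot a r) (dot-⊞ʳ a (ind X) f)))

    peel : {a b : Fin n → ℕ} {i : Fin n} (c : Fin n → ℕ) → a ≗ δ i ⊞ b → dot a c ≡ c i + dot b c
    peel {a} {b} {i} c h = trans (dot-cong h (λ _ → refl)) (trans (dot-⊞ˡ (δ i) b c) (cong (_+ dot b c) (dot-δ i c)))

    some-q : ∃ λ q → 1 ≤ A w q × 1 ≤ r q
    -- Of the three edges and loops at `w`, at most one is a loop or leads to `X`, and at most one
    -- leads to a node outside `X`.
    some-q = dot-pos (A w) r (linear 5 (λ where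
        (x ∷ y ∷ z ∷ l ∷ s ∷ []) → s ≼ x :+ y :+ z ⇒ con 3 ≼ s :+ l ⇒ x :+ l ≼ con 1 ⇒ y ≼ con 1 ⇒ ⊢ con 1 ≼ z)
      (dot (A w) (ind X) ∷ dot (A w) f ∷ dot (A w) r ∷ loops G w ∷ dot (A w) 𝟙 ∷ [])
      (eq≤ (total (A w))) (eq≥ wd) few leaf)

    module _ (q : Fin n) (q∈ : q ∈ outside-others X) (a₁ : Fin n → ℕ) (h₁ : A w ≗ δ q ⊞ a₁) where

      q∉f : f q ≡ 0
      q∉f = out→0 (either (q ∈? outside-nodes X))
        where
        either : q ∈ outside-nodes X ⊎ q ∉ outside-nodes X → q ∉ outside-nodes X
        either (inj₁ p) = ⊥-elim (proj₂ (others-∈ X q∈) (proj₂ (nodes-∈ X p)))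
        either (inj₂ p) = p

      f₁ : dot a₁ f ≤ 1
      f₁ = subst (_≤ 1) (trans (peel f h₁) (cong (_+ dot a₁ f) q∉f)) leaf

      x₁ : dot a₁ (ind X) + loops G w ≤ 1
      x₁ = ≤-trans (+-monoˡ-≤ (loops G w) (≤-trans (m≤n+m _ (ind X q)) (≤-reflexive (sym (peel (ind X) h₁))))) few

      sum₁ : dot a₁ 𝟙 + loops G w ≡ 2
      sum₁ = suc-injective (trans (cong (_+ loops G w) (sym (peel 𝟙 h₁))) wd)

      -- The inequality `dot a₁ f ≤ f t` records that `t` uses up the neighbour among the nodes, if
      -- there is one; cancelling it later gives `rest-nodes`.
      some-t : ∀ k → dot a₁ f ≡ k → ∃ λ t → 1 ≤ a₁ t × t ∉ X × dot a₁ f ≤ f t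
      some-t (suc k) e =
        let t , p , p′ = dot-pos a₁ f (≤-trans (s≤s z≤n) (≤-reflexive (sym e)))
        in t , p , proj₁ (nodes-∈ X (1→in (outside-nodes X) t p′)) , ≤-trans f₁ p′
      some-t zero e =
        let t , p , p′ = dot-pos a₁ r (linear 5 (λ where
                (x ∷ y ∷ z ∷ l ∷ s ∷ []) → s ≼ x :+ y :+ z ⇒ con 2 ≼ s :+ l ⇒ x :+ l ≼ con 1 ⇒ y ≼ con 0 ⇒ ⊢ con 1 ≼ z)
              (dot a₁ (ind X) ∷ dot a₁ f ∷ dot a₁ r ∷ loops G w ∷ dot a₁ 𝟙 ∷ []) (eq≤ (total a₁)) (eq≥ sum₁) x₁ (eq≤ e))
        in t , p , proj₁ (others-∈ X (1→in (outside-others X) t p′)) , ≤-trans (≤-reflexive e) z≤n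

      with-t : (t : Fin n) → t ∉ X → dot a₁ f ≤ f t → (rest : Fin n → ℕ) → a₁ ≗ δ t ⊞ rest → Neighbourhood X w
      with-t t t∉ f≤ rest h₂ = record
        { q = q ; t = t ; rest = rest ; q∈ = q∈ ; t∉ = t∉
        ; row-rest   = λ i → trans (h₁ i) (trans (cong (δ q i +_) (h₂ i)) (sym (+-assoc (δ q i) (δ t i) (rest i))))
        ; rest-sum   = suc-injective (trans (cong (_+ loops G w) (sym (peel 𝟙 h₂))) sum₁)
        ; rest-nodes = +-cancelˡ-≤ (f t) _ _ (≤-trans (≤-reflexive (sym (peel f h₂))) (≤-trans f≤ (≤-reflexive (sym (+-identityʳ _))))) }

      with-q : Neighbourhood X w
      with-q =
        let t , p , t∉ , f≤ = some-t (dot a₁ f) refl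
            rest , h₂ = split-at a₁ t p
        in with-t t t∉ f≤ rest h₂

  module _ {X : Subset n} (fX : F X) {β : Fin n} (β∉ : β ∉ X) (β≢ : dg β ≢ 3) (max : Maximal X) where
    open FromMaximal fX β∉ β≢ max

    module _ {w : Fin n} (w∉ : w ∉ X) (wd : dg w ≡ 3) (nbh : Neighbourhood X w) where
      open Neighbourhood nbh

      private
        q∉ : q ∉ X
        q∉ = proj₁ (others-∈ X q∈)

        q≢3 : dg q ≢ 3
        q≢3 = proj₂ (others-∈ X q∈)

        with-third : loops G w ≡ 0 → (c : Fin n) → 1 ≤ rest c → (last : Fin n → ℕ) → rest ≗ δ c ⊞ last → Reducible G
        with-third l c c≥ last hc = AtNode.reduce-node w∉ wd l row-c q∉ q≢3 t∉ (place (c ∈? X))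
          where
          one : dot rest 𝟙 ≡ 1
          one = trans (sym (trans (cong (dot rest 𝟙 +_) l) (+-identityʳ _))) rest-sum
          none : last ≗ 𝟘
          none = dot-0→ last (≤-reflexive (suc-injective (trans (sym (trans (dot-cong hc (λ _ → refl))
            (trans (dot-⊞ˡ (δ c) last 𝟙) (cong (_+ dot last 𝟙) (dot-δ c 𝟙))))) one)))
          row-c : A w ≗ δ c ⊞ δ t ⊞ δ q
          row-c i = trans (row-rest i) (trans (cong (δ q i + δ t i +_) (trans (hc i) (trans (cong (δ c i +_) (none i)) (+-identityʳ _))))
            (rev (δ q i) (δ t i) (δ c i)))
            where
            rev : ∀ a b c → a + b + c ≡ c + b + a
            rev a b c = trans (+-comm (a + b) c) (trans (cong (c +_) (+-comm a b)) (sym (+-assoc c b a)))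
          place : c ∈ X ⊎ c ∉ X → c ∈ X ⊎ (c ∉ X × dg c ≢ 3)
          place (inj₁ p) = inj₁ p
          place (inj₂ p) = inj₂ (p , λ d → n≮n 0 (≤-trans
            (*-mono-≤ c≥ (≤-reflexive (sym (in→1 (∈-nodes p d)))))
            (≤-trans (term≤dot rest (ind (outside-nodes X)) c) rest-nodes)))

      by-loops : ∀ k → loops G w ≡ k → Reducible G
      by-loops (suc (suc k)) l = ⊥-elim (n≮0 (s≤s⁻¹ (subst (_≤ 1) l (≤-trans (m≤n+m _ _) (node-degree w∉ wd)))))
      by-loops (suc zero) l = reduction-by-loop G ls rc l
        (λ i → trans (row-rest i) (trans (cong (δ q i + δ t i +_) (none i)) (trans (+-identityʳ _) (+-comm (δ q i) (δ t i)))))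
        (λ Y fY tY qY wY → no-F fY tY t∉ q∉ qY q≢3)
        where
        none : rest ≗ 𝟘
        none = dot-0→ rest (≤-reflexive (+-cancelʳ-≡ 1 _ 0 (trans (cong (dot rest 𝟙 +_) (sym l)) rest-sum)))
      by-loops zero l =
        let c , c≥ , _ = dot-pos rest 𝟙 (≤-reflexive (sym (trans (sym (trans (cong (dot rest 𝟙 +_) l) (+-identityʳ _))) rest-sum)))
            last , hc = split-at rest c c≥
        in with-third l c c≥ last hc

    reduce-with-maximal : Reducible G
    reduce-with-maximal =
      let i , i∉ , d = node-exists X fX β∉
          w , w∈ , leaf = leaf-exists (outside-nodes X) (∈-nodes i∉ d) (λ _ → proj₂ ∘ nodes-∈ X)
          w∉ , wd = nodes-∈ X w∈
      in by-loops w∉ wd (neighbourhood X w wd (node-degree w∉ wd) leaf) (loops G w) refl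

  all-nodes : (∀ i → dg i ≡ 3) → Reducible G
  all-nodes nodes =
    let w , _ , leaf = leaf-exists ⊤ {some-vertex 2≤n} (mem (lookup-replicate (some-vertex 2≤n) true)) (λ i _ → nodes i)
    in at w (subst (_≤ 1) (R-cong ind-⊤ w) leaf)
    where
    at : ∀ w → R 𝟙 w ≤ 1 → Reducible G
    at w leaf = by-degree (R 𝟙 w) refl leaf
      where
      other : ∃ λ j → j ≢ w
      other = another-vertex 2≤n w
      w∉∅ : w ∉ ∅ {n}
      w∉∅ = mem (lookup-replicate w false)
      -- The empty set is tight, and a second vertex makes the set of `w` alone proper. This
      -- excludes a leaf with no edge and three loops.
      loops≤2 : loops G w ≤ 2
      loops≤2 = ≤-trans (m≤n+m _ _) (degree-into-F {∅} {w} {proj₁ other} F∅ w∉∅ (mem (lookup-replicate (proj₁ other) false)) (proj₂ other))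
      by-degree : ∀ k → R 𝟙 w ≡ k → k ≤ 1 → Reducible G
      by-degree zero e _ = ⊥-elim (n≮n 2 (subst (_≤ 2) (trans (cong (_+ loops G w) (sym e)) (nodes w)) loops≤2))
      by-degree (suc zero) e _ = one (dot-pos (A w) 𝟙 (≤-reflexive (sym e)))
        where
        one : (∃ λ u → 1 ≤ A w u × 1 ≤ 1) → Reducible G
        one (u , p , _) = reduction-by-two-loops G ls rc (suc-injective (trans (cong (_+ loops G w) (sym e)) (nodes w)))
          (λ i → trans (proj₂ (split-at (A w) u p) i) (trans (cong (δ u i +_) (none i)) (+-identityʳ _)))
          where
          b = proj₁ (split-at (A w) u p)
          none : b ≗ 𝟘
          none = dot-0→ b (≤-reflexive (suc-injective (trans (sym (trans (dot-cong (proj₂ (split-at (A w) u p)) (λ _ → refl))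
            (trans (dot-⊞ˡ (δ u) b 𝟙) (cong (_+ dot b 𝟙) (dot-δ u 𝟙))))) e)))
      by-degree (suc (suc k)) e (s≤s ())

  reduce : Reducible G
  reduce = decide (any? (λ β → ¬? (dg β ≟ℕ 3)))
    where
    decide : Dec (∃ λ β → dg β ≢ 3) → Reducible G
    decide (no all) = all-nodes (λ i → decidable-stable (dg i ≟ℕ 3) λ d → all (i , d))
    decide (yes (β , β≢)) =
      let X , (fX , γ , γ∉ , γ≢) , max = maximal-candidate n ∅ (F∅ , β , mem (lookup-replicate β false) , β≢) (m≤m+n n _)
      in reduce-with-maximal fX γ∉ γ≢ max

-- Invariance under isomorphism

module Transport {G H : LGraph n} (iso′ : G ≅ H) (ls : IsLoopedSimple G) where
  open _≅_ iso′

  private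
    to from : Fin n → Fin n
    to = σ ⟨$⟩ʳ_
    from = σ ⟨$⟩ˡ_

    to-from : ∀ i → to (from i) ≡ i
    to-from i = Perm.inverseʳ σ

    adj-from : ∀ i j → adj H i j ≡ adj G (from i) (from j)
    adj-from i j = trans (sym (cong₂ (adj H) (to-from i) (to-from j))) (pres-adj (from i) (from j))

  looped : IsLoopedSimple H
  looped = record
    { adj-sym    = λ i j → trans (adj-from i j) (trans (adj-sym ls _ _) (sym (adj-from j i)))
    ; adj-irrefl = λ i → trans (adj-from i i) (adj-irrefl ls _) }

  private
    module G = Count G ls
    module H = Count H looped

    pull : Subset n → Subset n
    pull X = tabulate λ i → lookup X (to i)

    ind-pull : ∀ X → ind X ∘ to ≗ ind (pull X)
    ind-pull X i = cong b2n (sym (lookup∘tabulate _ i))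

    card-pull : ∀ X → ∣ X ∣ ≡ ∣ pull X ∣
    card-pull X = trans (card≡ X) (trans (dot-permute (ind X) 𝟙 σ)
      (trans (dot-cong (ind-pull X) (λ _ → refl)) (sym (card≡ (pull X)))))

    iL-pull : ∀ X → iL H X ≡ iL G (pull X)
    iL-pull X = trans (H.iL≡ X) (trans (dot-permute (ind X) (loops H) σ)
      (trans (dot-cong (ind-pull X) pres-loops) (sym (G.iL≡ (pull X)))))

    iE-pull : ∀ X → iE H X ≡ iE G (pull X)
    iE-pull X = *-cancelˡ-≡ _ _ 2 (trans (H.2iE X) (trans (dot-permute (ind X) (H.R (ind X)) σ)
      (trans (dot-cong (ind-pull X) rows) (sym (G.2iE (pull X))))))
      where
      rows : ∀ i → H.R (ind X) (to i) ≡ G.R (ind (pull X)) i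
      rows i = trans (dot-permute (H.A (to i)) (ind X) σ) (dot-cong (λ j → cong b2n (pres-adj i j)) (ind-pull X))

    pull-⊤ : pull ⊤ ≡ ⊤
    pull-⊤ with Full⊎missing (pull ⊤)
    ... | inj₁ p = p
    ... | inj₂ (i , mem p) = ⊥-elim (∈∉ {X = ⊤} {to i} (mem (lookup-replicate (to i) true)) (mem (trans (sym (lookup∘tabulate _ i)) p)))

    pull-≢⊤ : ∀ X → X ≢ ⊤ → pull X ≢ ⊤
    pull-≢⊤ X ne with Full⊎missing X
    ... | inj₁ p = ⊥-elim (ne p)
    ... | inj₂ (i , mem p) = ≢⊤ {i = from i} (mem (trans (lookup∘tabulate _ (from i)) (trans (cong (lookup X) (to-from i)) p)))

  rigid : RigidCircuit G → RigidCircuit H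
  rigid rc = record
    { count    = trans (cong₂ _+_ (iE-pull ⊤) (iL-pull ⊤)) (trans (cong (λ Z → iE G Z + iL G Z) pull-⊤) count)
    ; sparseE  = λ X h → subst₂ (λ a b → a + 3 ≤ 2 * b) (sym (iE-pull X)) (sym (card-pull X))
        (sparseE (pull X) (subst (2 ≤_) (card-pull X) h))
    ; sparseEL = λ X ne → subst₂ _≤_ (sym (cong₂ _+_ (iE-pull X) (iL-pull X))) (cong (2 *_) (sym (card-pull X)))
        (sparseEL (pull X) (pull-≢⊤ X ne)) }
    where open RigidCircuit rc

-- Extensions of rigid circuits

addVertex-looped : {G : LGraph n} → IsLoopedSimple G → (nbr : Fin n → Bool) (k : ℕ) → IsLoopedSimple (addVertex G nbr k)
addVertex-looped {n} {G} ls nbr k = record { adj-sym = s ; adj-irrefl = r }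
  where
  s : ∀ i j → adj (addVertex G nbr k) i j ≡ adj (addVertex G nbr k) j i
  s zero    zero    = refl
  s zero    (suc j) = refl
  s (suc i) zero    = refl
  s (suc i) (suc j) = adj-sym ls i j
  r : ∀ i → adj (addVertex G nbr k) i i ≡ false
  r zero    = refl
  r (suc i) = adj-irrefl ls i

card-member : (X : Subset n) → 1 ≤ ∣ X ∣ → ∃ λ i → i ∈ X
card-member X h = let i , p , _ = dot-pos (ind X) 𝟙 (subst (1 ≤_) (card≡ X) h) in i , 1→in X i p

degree≤card : (nbr : Fin n → Bool) (X : Subset n) → dot (b2n ∘ nbr) (ind X) ≤ ∣ X ∣
degree≤card nbr X = ≤-trans (dot-mono (ind X) (λ i → b2n≤1 (nbr i)))
  (≤-reflexive (trans (dot-comm 𝟙 (ind X)) (sym (card≡ X))))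

-- What the four 1-extensions have in common. `D` is `G` without one edge or loop; `ε` and `μ` count
-- the deleted edge or loop inside a set. The bounds `ν-E` and `ν-EL` say that the new vertex brings
-- at most two more than was deleted there, as much as one more vertex allows.
module Extend (G : LGraph n) (ls : IsLoopedSimple G) (rc : RigidCircuit G) (D : LGraph n) (lsD : IsLoopedSimple D)
  (nbr : Fin n → Bool) (k : ℕ) (ε μ : Subset n → ℕ)
  (iE-D : ∀ X → iE G X ≡ iE D X + ε X) (iL-D : ∀ X → iL G X ≡ iL D X + μ X)
  (ν≡3 : dot (b2n ∘ nbr) (ind ⊤) + k ≡ 3) (one : ε ⊤ + μ ⊤ ≡ 1)
  (ν-E : ∀ X → dot (b2n ∘ nbr) (ind X) ≤ 2 + ε X)
  (ν-EL : ∀ X → dot (b2n ∘ nbr) (ind X) + k ≤ 2 + ε X + μ X) where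

  open Tightness G ls rc

  private
    H : LGraph (suc n)
    H = addVertex D nbr k

    open Del H (addVertex-looped lsD nbr k) zero

    ν : Subset n → ℕ
    ν X = dot (b2n ∘ nbr) (ind X)

    iE-true : ∀ X → iE H (true ∷ X) ≡ iE D X + ν X
    iE-true X = trans (iE-ins true X) (cong (iE D X +_) (*-identityˡ (ν X)))

    iL-true : ∀ X → iL H (true ∷ X) ≡ iL D X + k
    iL-true X = trans (iL-ins true X) (cong (iL D X +_) (*-identityˡ k))

    iE-false : ∀ X → iE H (false ∷ X) ≡ iE D X
    iE-false X = trans (iE-ins false X) (+-identityʳ _)

    iL-false : ∀ X → iL H (false ∷ X) ≡ iL D X
    iL-false X = trans (iL-ins false X) (+-identityʳ _)

    D≤G : ∀ X → iE D X + iL D X ≤ iE G X + iL G X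
    D≤G X = subst₂ (λ a b → iE D X + iL D X ≤ a + b) (sym (iE-D X)) (sym (iL-D X)) (+-mono-≤ (m≤m+n (iE D X) (ε X)) (m≤m+n (iL D X) (μ X)))

    countD : iE D ⊤ + iL D ⊤ ≡ 2 * n
    countD = +-cancelʳ-≡ 1 _ _ (trans (cong (iE D ⊤ + iL D ⊤ +_) (sym one)) (trans (interchange (iE D ⊤) (iL D ⊤) (ε ⊤) (μ ⊤))
      (trans (sym (cong₂ _+_ (iE-D ⊤) (iL-D ⊤))) count)))

  rigid : RigidCircuit H
  rigid = record { count = countH ; sparseE = sE ; sparseEL = sEL }
    where
    countH : iE H (true ∷ ⊤) + iL H (true ∷ ⊤) ≡ 2 * suc n + 1
    countH = ≤-antisym
      (linear 7 (λ where
        (e ∷ l ∷ r ∷ κ ∷ c ∷ e′ ∷ l′ ∷ []) → e′ ≼ e :+ r ⇒ l′ ≼ l :+ κ ⇒ e :+ l ≼ 2 :* c ⇒ r :+ κ ≼ con 3 ⇒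
          ⊢ e′ :+ l′ ≼ 2 :* (con 1 :+ c) :+ con 1) ρ (eq≤ (iE-true ⊤)) (eq≤ (iL-true ⊤)) (eq≤ countD) (eq≤ ν≡3))
      (linear 7 (λ where
        (e ∷ l ∷ r ∷ κ ∷ c ∷ e′ ∷ l′ ∷ []) → e :+ r ≼ e′ ⇒ l :+ κ ≼ l′ ⇒ 2 :* c ≼ e :+ l ⇒ con 3 ≼ r :+ κ ⇒
          ⊢ 2 :* (con 1 :+ c) :+ con 1 ≼ e′ :+ l′) ρ (eq≥ (iE-true ⊤)) (eq≥ (iL-true ⊤)) (eq≥ countD) (eq≥ ν≡3))
      where ρ = iE D ⊤ ∷ iL D ⊤ ∷ ν ⊤ ∷ k ∷ n ∷ iE H (true ∷ ⊤) ∷ iL H (true ∷ ⊤) ∷ []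

    D≤ : ∀ X → iE D X ≤ iE G X
    D≤ X = subst (iE D X ≤_) (sym (iE-D X)) (m≤m+n _ (ε X))

    new-E : ∀ X → 1 ≤ ∣ X ∣ → Dec (2 ≤ ∣ X ∣) → iE D X + ν X + 3 ≤ 2 * suc ∣ X ∣
    new-E X h (yes p) = linear 5 (λ where
      (d ∷ e ∷ g ∷ r ∷ x ∷ []) → d :+ e ≼ g ⇒ r ≼ con 2 :+ e ⇒ g :+ con 3 ≼ 2 :* x ⇒
        ⊢ d :+ r :+ con 3 ≼ 2 :* (con 1 :+ x))
      (iE D X ∷ ε X ∷ iE G X ∷ ν X ∷ ∣ X ∣ ∷ []) (eq≥ (iE-D X)) (ν-E X) (sparseE X p)
    new-E X h (no ¬p) = linear 4 (λ where
      (d ∷ g ∷ r ∷ x ∷ []) → d ≼ g ⇒ r ≼ x ⇒ x ≼ con 1 ⇒ g :+ con 2 ≼ 2 :* x ⇒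
        ⊢ d :+ r :+ con 3 ≼ 2 :* (con 1 :+ x))
      (iE D X ∷ iE G X ∷ ν X ∷ ∣ X ∣ ∷ []) (D≤ X) (degree≤card nbr X) (s≤s⁻¹ (≰⇒> ¬p)) (sparse₁ (proj₂ (card-member X h)))

    sE : ∀ X → 2 ≤ ∣ X ∣ → iE H X + 3 ≤ 2 * ∣ X ∣
    sE (false ∷ X) h = ≤-trans (≤-reflexive (cong (_+ 3) (iE-false X))) (≤-trans (+-monoˡ-≤ 3 (D≤ X)) (sparseE X h))
    sE (true ∷ X) (s≤s h) = ≤-trans (≤-reflexive (cong (_+ 3) (iE-true X))) (new-E X h (2 ≤? ∣ X ∣))

    sEL : ∀ X → X ≢ ⊤ → iE H X + iL H X ≤ 2 * ∣ X ∣
    sEL (false ∷ X) ne = ≤-trans (≤-reflexive (cong₂ _+_ (iE-false X) (iL-false X))) (old (Full⊎missing X))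
      where
      old : X ≡ ⊤ ⊎ (∃ λ i → i ∉ X) → iE D X + iL D X ≤ 2 * ∣ X ∣
      -- The old vertices together are now a proper subset; the deletion has lowered their count
      -- from 2n + 1 to 2n.
      old (inj₁ refl)     = ≤-reflexive (trans countD (cong (2 *_) (sym (∣⊤∣≡n n))))
      old (inj₂ (i , i∉)) = ≤-trans (D≤G X) (sparseEL X (≢⊤ i∉))
    sEL (true ∷ X) ne = ≤-trans (≤-reflexive (cong₂ _+_ (iE-true X) (iL-true X))) (linear 9 (λ where
        (d ∷ l ∷ e ∷ m ∷ g ∷ h ∷ r ∷ κ ∷ x ∷ []) → d :+ e ≼ g ⇒ l :+ m ≼ h ⇒ r :+ κ ≼ con 2 :+ e :+ m ⇒ g :+ h ≼ 2 :* x ⇒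
          ⊢ d :+ r :+ (l :+ κ) ≼ 2 :* (con 1 :+ x))
      (iE D X ∷ iL D X ∷ ε X ∷ μ X ∷ iE G X ∷ iL G X ∷ ν X ∷ k ∷ ∣ X ∣ ∷ [])
      (eq≥ (iE-D X)) (eq≥ (iL-D X)) (ν-EL X) (sparseEL X (ne ∘ cong (true ∷_))))

δ-∨ : {u w : Fin n} → u ≢ w → ∀ j → b2n ((j == u) ∨ (j == w)) ≡ δ u j + δ w j
δ-∨ {u = u} {w} p j with j ≟ u
... | yes refl = sym (cong (λ z → 1 + b2n z) (==-≢ p))
... | no _     = refl

δ-∨₃ : {u w x : Fin n} → u ≢ w → x ≢ u → x ≢ w → ∀ j → b2n ((j == u) ∨ (j == w) ∨ (j == x)) ≡ δ u j + (δ w j + δ x j)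
δ-∨₃ {u = u} {w} {x} p q r j with j ≟ u
... | yes refl = sym (cong (1 +_) (cong₂ _+_ (cong b2n (==-≢ p)) (cong b2n (==-≢ (q ∘ sym)))))
... | no _     = δ-∨ (r ∘ sym) j

dot-δ⊞δ : (u w : Fin n) {a : Fin n → ℕ} → (∀ j → a j ≡ δ u j + δ w j) → ∀ b → dot a b ≡ b u + b w
dot-δ⊞δ u w h b = trans (dot-cong h (λ _ → refl)) (trans (dot-⊞ˡ (δ u) (δ w) b) (cong₂ _+_ (dot-δ u b) (dot-δ w b)))

module EdgeExtensions (G : LGraph n) (ls : IsLoopedSimple G) (rc : RigidCircuit G) {u w : Fin n} (uw : adj G u w ≡ true) where
  open EdgeDeletion G ls uw

  private
    ε : Subset n → ℕ
    ε X = ind X u * ind X w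

    ε⊤ : ε ⊤ ≡ 1
    ε⊤ = cong₂ _*_ (ind-⊤ u) (ind-⊤ w)

  edge-edge-rigid : ∀ {x} → x ≢ u → x ≢ w → RigidCircuit (ext1-edge-edge G u w x)
  edge-edge-rigid {x} x≢u x≢w = Extend.rigid G ls rc (deleteEdge G u w) deleteEdge-looped _ 0 ε (λ _ → 0) iE-deleteEdge
    (λ X → sym (+-identityʳ _))
    (trans (cong (_+ 0) (ν (ind ⊤))) (cong₂ (λ a b → a + b + 0) (ind-⊤ u) (cong₂ _+_ (ind-⊤ w) (ind-⊤ x))))
    (cong (_+ 0) ε⊤) bound (λ X → +-monoˡ-≤ 0 (bound X))
    where
    ν : ∀ b → dot (λ j → b2n ((j == u) ∨ (j == w) ∨ (j == x))) b ≡ b u + (b w + b x)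
    ν b = trans (dot-cong (δ-∨₃ u≢v x≢u x≢w) (λ _ → refl)) (trans (dot-⊞ˡ (δ u) (δ w ⊞ δ x) b)
      (cong₂ _+_ (dot-δ u b) (dot-δ⊞δ w x (λ _ → refl) b)))
    cases : ∀ a b c → b2n a + (b2n b + b2n c) ≤ 2 + b2n a * b2n b
    cases true  true  c = s≤s (s≤s (b2n≤1 c))
    cases true  false c = s≤s (b2n≤1 c)
    cases false true  c = s≤s (b2n≤1 c)
    cases false false c = ≤-trans (b2n≤1 c) (s≤s z≤n)
    bound : ∀ X → dot (λ j → b2n ((j == u) ∨ (j == w) ∨ (j == x))) (ind X) ≤ 2 + ε X
    bound X = ≤-trans (≤-reflexive (ν (ind X))) (cases (lookup X u) (lookup X w) (lookup X x))

  edge-loop-rigid : RigidCircuit (ext1-edge-loop G u w)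
  edge-loop-rigid = Extend.rigid G ls rc (deleteEdge G u w) deleteEdge-looped _ 1 ε (λ _ → 0) iE-deleteEdge
    (λ X → sym (+-identityʳ _))
    (cong (_+ 1) (trans (ν (ind ⊤)) (cong₂ _+_ (ind-⊤ u) (ind-⊤ w)))) (cong (_+ 0) ε⊤)
    (λ X → ≤-trans (m≤m+n _ 1) (bound X)) (λ X → ≤-trans (bound X) (m≤m+n _ 0))
    where
    ν : ∀ b → dot (λ j → b2n ((j == u) ∨ (j == w))) b ≡ b u + b w
    ν = dot-δ⊞δ u w (δ-∨ u≢v)
    cases : ∀ a b → b2n a + b2n b + 1 ≤ 2 + b2n a * b2n b
    cases true  true  = ≤-refl
    cases true  false = ≤-refl
    cases false true  = ≤-refl
    cases false false = s≤s z≤n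
    bound : ∀ X → dot (λ j → b2n ((j == u) ∨ (j == w))) (ind X) + 1 ≤ 2 + ε X
    bound X = ≤-trans (≤-reflexive (cong (_+ 1) (ν (ind X)))) (cases (lookup X u) (lookup X w))

module LoopExtensions (G : LGraph n) (ls : IsLoopedSimple G) (rc : RigidCircuit G) {u : Fin n} (l : 1 ≤ loops G u) where

  deleteLoop-looped : IsLoopedSimple (deleteLoop G u)
  deleteLoop-looped = record { adj-sym = adj-sym ls ; adj-irrefl = adj-irrefl ls }

  private
    loops-split : ∀ i → loops G i ≡ loops (deleteLoop G u) i + δ u i
    loops-split i with i ≟ u
    ... | yes refl = sym (m∸n+n≡m l)
    ... | no _     = sym (+-identityʳ _)

    same-E : ∀ X → iE G X ≡ iE (deleteLoop G u) X + 0
    same-E X = trans (iE-cong {G = G} {deleteLoop G u} (λ _ _ → refl) X) (sym (+-identityʳ _))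

  loop-edge-rigid : ∀ {w} → w ≢ u → RigidCircuit (ext1-loop-edge G u w)
  loop-edge-rigid {w} w≢u = Extend.rigid G ls rc (deleteLoop G u) deleteLoop-looped _ 1 (λ _ → 0) (λ X → ind X u) same-E
    (iL-loops {G = G} {deleteLoop G u} loops-split)
    (cong (_+ 1) (trans (ν (ind ⊤)) (cong₂ _+_ (ind-⊤ u) (ind-⊤ w)))) (ind-⊤ u)
    (λ X → ≤-trans (≤-reflexive (ν (ind X))) (+-mono-≤ (b2n≤1 (lookup X u)) (b2n≤1 (lookup X w))))
    (λ X → ≤-trans (≤-reflexive (cong (_+ 1) (ν (ind X)))) (cases (lookup X u) (lookup X w)))
    where
    ν : ∀ b → dot (λ j → b2n ((j == u) ∨ (j == w))) b ≡ b u + b w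
    ν = dot-δ⊞δ u w (δ-∨ (w≢u ∘ sym))
    cases : ∀ a b → b2n a + b2n b + 1 ≤ 2 + 0 + b2n a
    cases true  true  = ≤-refl
    cases true  false = s≤s (s≤s z≤n)
    cases false true  = ≤-refl
    cases false false = s≤s z≤n

  loop-loop-rigid : RigidCircuit (ext1-loop-loop G u)
  loop-loop-rigid = Extend.rigid G ls rc (deleteLoop G u) deleteLoop-looped _ 2 (λ _ → 0) (λ X → ind X u) same-E
    (iL-loops {G = G} {deleteLoop G u} loops-split)
    (cong (_+ 2) (trans (dot-δ u (ind ⊤)) (ind-⊤ u))) (ind-⊤ u)
    (λ X → ≤-trans (≤-reflexive (dot-δ u (ind X))) (≤-trans (b2n≤1 (lookup X u)) (s≤s z≤n)))
    (λ X → ≤-reflexive (trans (cong (_+ 2) (dot-δ u (ind X))) (+-comm (ind X u) 2)))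

-- The K4-extension

module K4Extension (G : LGraph n) (ls : IsLoopedSimple G) (rc : RigidCircuit G) {u v : Fin n} (uv : adj G u v ≡ true) where
  open Tightness G ls rc
  open EdgeDeletion G ls uv

  private
    D = deleteEdge G u v
    nbr : Fin n → Bool
    nbr j = (j == u) ∨ (j == v)
    M = addVertex D nbr 0
    lsM = addVertex-looped deleteEdge-looped nbr 0
    H = K4-ext G u v

  K4-ext-looped : IsLoopedSimple H
  K4-ext-looped = addVertex-looped lsM _ 0

  private
    module DM = Del M lsM zero
    module DH = Del H K4-ext-looped zero

    s ε : Subset n → ℕ
    s X = ind X u + ind X v
    ε X = ind X u * ind X v

    iE-H : ∀ b a X → iE H (b ∷ a ∷ X) ≡ iE D X + b2n a * s X + b2n b * (b2n a + s X)
    iE-H b a X = trans (DH.iE-ins b (a ∷ X)) (cong₂ _+_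
      (trans (DM.iE-ins a X) (cong (λ z → iE D X + b2n a * z) (dot-δ⊞δ u v (δ-∨ u≢v) (ind X))))
      (cong (b2n b *_) (trans (dot-suc (row H zero) (ind (a ∷ X)))
        (cong₂ _+_ (*-identityˡ (b2n a)) (dot-δ⊞δ u v (δ-∨ u≢v) (ind X))))))

    iL-H : ∀ b a X → iL H (b ∷ a ∷ X) ≡ iL G X
    iL-H b a X = trans (DH.iL-ins b (a ∷ X)) (trans (cong₂ _+_ (trans (DM.iL-ins a X) (cong (iL D X +_) (*-zeroʳ (b2n a)))) (*-zeroʳ (b2n b)))
      (trans (+-identityʳ _) (+-identityʳ _)))

    s≤ : ∀ X → s X ≤ 1 + ε X
    s≤ X = cases (lookup X u) (lookup X v)
      where
      cases : ∀ a b → b2n a + b2n b ≤ 1 + b2n a * b2n b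
      cases true  true  = ≤-refl
      cases true  false = ≤-refl
      cases false true  = ≤-refl
      cases false false = z≤n

    s≤2 : ∀ X → s X ≤ 2
    s≤2 X = +-mono-≤ (b2n≤1 (lookup X u)) (b2n≤1 (lookup X v))

    s≤card : ∀ X → s X ≤ ∣ X ∣
    s≤card X = subst (_≤ ∣ X ∣) (dot-δ⊞δ u v (δ-∨ u≢v) (ind X)) (degree≤card nbr X)

    s⊤ : s ⊤ ≡ 2
    s⊤ = cong₂ _+_ (ind-⊤ u) (ind-⊤ v)

    -- The number of edges that the new vertices add to `X`, where the Booleans tell which of the
    -- two are included.
    gain : Bool → Bool → Subset n → ℕ
    gain b a X = b2n a * s X + b2n b * (b2n a + s X)

    new : Bool → Bool → ℕ
    new b a = b2n b + b2n a

    iE-gain : ∀ b a X → iE H (b ∷ a ∷ X) ≡ iE D X + gain b a X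
    iE-gain b a X = trans (iE-H b a X) (+-assoc (iE D X) _ _)

    card-new : ∀ b a (X : Subset n) → ∣ b ∷ a ∷ X ∣ ≡ new b a + ∣ X ∣
    card-new b a X = trans (ins-card zero b (a ∷ X)) (trans (cong (b2n b +_) (ins-card zero a X)) (sym (+-assoc (b2n b) _ _)))

    both≡ : ∀ X → gain true true X ≡ s X + (1 + s X)
    both≡ X = cong₂ _+_ (*-identityˡ (s X)) (*-identityˡ (1 + s X))

    single≡ : ∀ X → gain true false X ≡ s X
    single≡ X = *-identityˡ (s X)

    single′≡ : ∀ X → gain false true X ≡ s X
    single′≡ X = trans (+-identityʳ _) (*-identityˡ (s X))

    -- Two edges per new vertex are free. Only both together, over both ends of uv, bring a fifth
    -- edge, and then the deletion of uv inside `X` makes up for it.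
    gain≤ : ∀ b a X → gain b a X ≤ 2 * new b a + ε X
    gain≤ true  true  X = linear 2 (λ where (t ∷ e ∷ []) → t ≼ con 2 ⇒ t ≼ con 1 :+ e ⇒ ⊢ t :+ (con 1 :+ t) ≼ con 4 :+ e)
      (s X ∷ ε X ∷ []) (s≤2 X) (s≤ X) |> ≤-trans (≤-reflexive (both≡ X))
    gain≤ true  false X = ≤-trans (≤-reflexive (single≡ X)) (≤-trans (s≤ X) (n≤1+n _))
    gain≤ false true  X = ≤-trans (≤-reflexive (single′≡ X)) (≤-trans (s≤ X) (n≤1+n _))
    gain≤ false false X = z≤n

    small-gain : ∀ b a X → 2 ≤ new b a + ∣ X ∣ → ∣ X ∣ ≤ 1 → gain b a X + 3 ≤ 2 * (new b a + ∣ X ∣)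
    small-gain true true X h x≤ = linear 2 (λ where (t ∷ x ∷ []) → 2 :* t ≼ 2 :* x ⇒ ⊢ t :+ (con 1 :+ t) :+ con 3 ≼ 2 :* (con 2 :+ x))
      (s X ∷ ∣ X ∣ ∷ []) (2*-mono (s≤card X)) |> ≤-trans (≤-reflexive (cong (_+ 3) (both≡ X)))
    small-gain true false X h x≤ = ≤-trans (≤-reflexive (cong (_+ 3) (single≡ X))) (≤-trans (+-monoˡ-≤ 3 (≤-trans (s≤card X) x≤)) (2*-mono h))
    small-gain false true X h x≤ = ≤-trans (≤-reflexive (cong (_+ 3) (single′≡ X))) (≤-trans (+-monoˡ-≤ 3 (≤-trans (s≤card X) x≤)) (2*-mono h))
    small-gain false false X h x≤ = ⊥-elim (n≮n 1 (≤-trans h x≤))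

    small-E : ∀ X → ∣ X ∣ ≤ 1 → iE G X ≤ 0
    small-E X h with X-cases
      where
      X-cases : ∣ X ∣ ≤ 0 ⊎ 1 ≤ ∣ X ∣
      X-cases with ∣ X ∣
      ... | zero  = inj₁ z≤n
      ... | suc _ = inj₂ (s≤s z≤n)
    ... | inj₁ z = ≤-reflexive (iE-empty X z)
    ... | inj₂ p = +-cancelʳ-≤ 2 _ _ (≤-trans (sparse₁ (proj₂ (card-member X p))) (2*-mono h))

  K4-ext-rigid : RigidCircuit H
  K4-ext-rigid = record { count = countH ; sparseE = sE ; sparseEL = sEL }
    where
    D+ε : ∀ X → iE D X + ε X ≤ iE G X
    D+ε X = eq≥ (iE-deleteEdge X)

    countH : iE H (true ∷ true ∷ ⊤) + iL H (true ∷ true ∷ ⊤) ≡ 2 * (2 + n) + 1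
    countH = ≤-antisym
      (linear 7 (λ where
        (d ∷ e ∷ t ∷ g ∷ l ∷ h ∷ c ∷ []) → h ≼ d :+ (t :+ (con 1 :+ t)) ⇒ 2 :* t ≼ con 4 ⇒ d :+ e ≼ g ⇒ con 1 ≼ e ⇒ g :+ l ≼ 2 :* c :+ con 1 ⇒
          ⊢ h :+ l ≼ 2 :* (con 2 :+ c) :+ con 1) ρ (eq≤ total) (2*-mono (eq≤ s⊤)) (eq≥ (iE-deleteEdge ⊤)) (eq≥ ε⊤) (eq≤ count)
        |> subst (λ z → iE H (true ∷ true ∷ ⊤) + z ≤ 2 * (2 + n) + 1) (sym (iL-H true true ⊤)))
      (linear 7 (λ where
        (d ∷ e ∷ t ∷ g ∷ l ∷ h ∷ c ∷ []) → d :+ (t :+ (con 1 :+ t)) ≼ h ⇒ con 4 ≼ 2 :* t ⇒ g ≼ d :+ e ⇒ e ≼ con 1 ⇒ 2 :* c :+ con 1 ≼ g :+ l ⇒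
          ⊢ 2 :* (con 2 :+ c) :+ con 1 ≼ h :+ l) ρ (eq≥ total) (2*-mono (eq≥ s⊤)) (eq≤ (iE-deleteEdge ⊤)) (eq≤ ε⊤) (eq≥ count)
        |> subst (λ z → 2 * (2 + n) + 1 ≤ iE H (true ∷ true ∷ ⊤) + z) (sym (iL-H true true ⊤)))
      where
      total : iE H (true ∷ true ∷ ⊤) ≡ iE D ⊤ + (s ⊤ + (1 + s ⊤))
      total = trans (iE-gain true true ⊤) (cong (iE D ⊤ +_) (both≡ ⊤))
      ε⊤ : ε ⊤ ≡ 1
      ε⊤ = cong₂ _*_ (ind-⊤ u) (ind-⊤ v)
      ρ = iE D ⊤ ∷ ε ⊤ ∷ s ⊤ ∷ iE G ⊤ ∷ iL G ⊤ ∷ iE H (true ∷ true ∷ ⊤) ∷ n ∷ []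

    sE : ∀ X → 2 ≤ ∣ X ∣ → iE H X + 3 ≤ 2 * ∣ X ∣
    sE (b ∷ a ∷ X) h = subst₂ (λ y z → y + 3 ≤ 2 * z) (sym (iE-gain b a X)) (sym (card-new b a X)) (go (2 ≤? ∣ X ∣))
      where
      go : Dec (2 ≤ ∣ X ∣) → iE D X + gain b a X + 3 ≤ 2 * (new b a + ∣ X ∣)
      go (yes p) = linear 6 (λ where
        (d ∷ e ∷ g ∷ γ ∷ ω ∷ x ∷ []) → d :+ e ≼ g ⇒ γ ≼ 2 :* ω :+ e ⇒ g :+ con 3 ≼ 2 :* x ⇒
          ⊢ d :+ γ :+ con 3 ≼ 2 :* (ω :+ x))
        (iE D X ∷ ε X ∷ iE G X ∷ gain b a X ∷ new b a ∷ ∣ X ∣ ∷ []) (D+ε X) (gain≤ b a X) (sparseE X p)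
      go (no ¬p) = linear 6 (λ where
        (d ∷ e ∷ g ∷ γ ∷ ω ∷ x ∷ []) → d :+ e ≼ g ⇒ g ≼ con 0 ⇒ γ :+ con 3 ≼ 2 :* (ω :+ x) ⇒
          ⊢ d :+ γ :+ con 3 ≼ 2 :* (ω :+ x))
        (iE D X ∷ ε X ∷ iE G X ∷ gain b a X ∷ new b a ∷ ∣ X ∣ ∷ []) (D+ε X) (small-E X x≤) (small-gain b a X (subst (2 ≤_) (card-new b a X) h) x≤)
        where
        x≤ : ∣ X ∣ ≤ 1
        x≤ = s≤s⁻¹ (≰⇒> ¬p)

    sEL : ∀ X → X ≢ ⊤ → iE H X + iL H X ≤ 2 * ∣ X ∣
    sEL (b ∷ a ∷ X) ne = subst₂ _≤_ (sym (cong₂ _+_ (iE-gain b a X) (iL-H b a X))) (cong (2 *_) (sym (card-new b a X))) (go (Full⊎missing X))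
      where
      -- On all old vertices the count of `G` is one above the bound, and the deletion of uv is
      -- spent on that. So each new vertex may bring only two edges, which fails only if both are
      -- present.
      full-gain : ∀ b a → (true ∷ true ∷ ⊤ ≢ b ∷ a ∷ ⊤ {n}) → gain b a ⊤ ≤ 2 * new b a
      full-gain true  true  p = ⊥-elim (p refl)
      full-gain true  false p = ≤-reflexive (trans (single≡ ⊤) s⊤)
      full-gain false true  p = ≤-reflexive (trans (single′≡ ⊤) s⊤)
      full-gain false false p = z≤n
      go : X ≡ ⊤ ⊎ (∃ λ i → i ∉ X) → iE D X + gain b a X + iL G X ≤ 2 * (new b a + ∣ X ∣)
      go (inj₂ (i , i∉)) = linear 7 (λ where
        (d ∷ e ∷ g ∷ γ ∷ ω ∷ x ∷ l ∷ []) → d :+ e ≼ g ⇒ γ ≼ 2 :* ω :+ e ⇒ g :+ l ≼ 2 :* x ⇒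
          ⊢ d :+ γ :+ l ≼ 2 :* (ω :+ x))
        (iE D X ∷ ε X ∷ iE G X ∷ gain b a X ∷ new b a ∷ ∣ X ∣ ∷ iL G X ∷ []) (D+ε X) (gain≤ b a X) (sparseEL X (≢⊤ i∉))
      go (inj₁ refl) = linear 7 (λ where
        (d ∷ e ∷ g ∷ γ ∷ ω ∷ x ∷ l ∷ []) → d :+ e ≼ g ⇒ con 1 ≼ e ⇒ γ ≼ 2 :* ω ⇒ g :+ l ≼ 2 :* x :+ con 1 ⇒
          ⊢ d :+ γ :+ l ≼ 2 :* (ω :+ x))
        (iE D ⊤ ∷ ε ⊤ ∷ iE G ⊤ ∷ gain b a ⊤ ∷ new b a ∷ ∣ ⊤ {n} ∣ ∷ iL G ⊤ ∷ []) (D+ε ⊤)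
        (eq≥ (cong₂ _*_ (ind-⊤ u) (ind-⊤ v))) (full-gain b a (ne ∘ sym))
        (≤-reflexive (trans count (cong (λ z → 2 * z + 1) (sym (∣⊤∣≡n n)))))

-- Looped simplicity is proved alongside, because the counting lemmas rest on the symmetry and
-- irreflexivity of the smaller graph.
constructible-rigid : {G : LGraph n} → Constructible G → IsLoopedSimple G × RigidCircuit G
constructible-rigid base = record { adj-sym = λ _ _ → refl ; adj-irrefl = λ _ → refl } ,
  record { count = refl ; sparseE = λ { (true ∷ []) (s≤s ()) ; (false ∷ []) () } ; sparseEL = λ { (true ∷ []) ne → ⊥-elim (ne refl) ; (false ∷ []) _ → z≤n } }
constructible-rigid (iso c i) = let ls , rc = constructible-rigid c in Transport.looped i ls , Transport.rigid i ls rc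
constructible-rigid (e-ee {G = G} u w x c uw x≢u x≢w) = let ls , rc = constructible-rigid c in
  addVertex-looped (EdgeDeletion.deleteEdge-looped G ls uw) _ 0 , EdgeExtensions.edge-edge-rigid G ls rc uw x≢u x≢w
constructible-rigid (e-el {G = G} u w c uw) = let ls , rc = constructible-rigid c in
  addVertex-looped (EdgeDeletion.deleteEdge-looped G ls uw) _ 1 , EdgeExtensions.edge-loop-rigid G ls rc uw
constructible-rigid (e-le {G = G} u w c l w≢u) = let ls , rc = constructible-rigid c in
  addVertex-looped (LoopExtensions.deleteLoop-looped G ls rc l) _ 1 , LoopExtensions.loop-edge-rigid G ls rc l w≢u
constructible-rigid (e-ll {G = G} u c l) = let ls , rc = constructible-rigid c in
  addVertex-looped (LoopExtensions.deleteLoop-looped G ls rc l) _ 2 , LoopExtensions.loop-loop-rigid G ls rc l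
constructible-rigid (e-K4 {G = G} u v c uv) = let ls , rc = constructible-rigid c in
  K4Extension.K4-ext-looped G ls rc uv , K4Extension.K4-ext-rigid G ls rc uv

-- Induction on a bound `k` for the order, since a reduction may remove one vertex or two. The empty
-- graph is excluded by its count, which would read 0 = 1.
rigid-constructible : ∀ k {n} → n ≤ k → (G : LGraph n) → IsLoopedSimple G → RigidCircuit G → Constructible G
rigid-constructible k {zero} _ G ls rc = ⊥-elim (0≢1+n (RigidCircuit.count rc))
-- A single vertex carries no edges, so the count 2 · 1 + 1 consists of three loops.
rigid-constructible k {suc zero} _ G ls rc = iso base (record
  { σ           = Perm.id
  ; pres-adj    = λ { zero zero → adj-irrefl ls zero }
  ; pres-loops  = λ { zero → trans (sym (+-identityʳ _)) (RigidCircuit.count rc) } })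
rigid-constructible (suc k) {suc (suc n)} (s≤s h) G ls rc =
  let m , m< , H , lsH , rcH , build = Search.reduce (s≤s (s≤s z≤n)) G ls rc
  in build (rigid-constructible k (≤-trans (s≤s⁻¹ m<) h) H lsH rcH)

theorem6p10 : ∀ {n : ℕ} (G : LGraph n) → IsLoopedSimple G →
    (RigidCircuit G → Constructible G) × (Constructible G → RigidCircuit G)
theorem6p10 {n} G ls = rigid-constructible n ≤-refl G ls , proj₂ ∘ constructible-rigid
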